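{- There exist absolute constants $c,c'>0$ and $m_0$ such that for every $m\ge m_0$ the following holds. Any tester that distinguishes coverage functions on $2^{[m]}$ from set functions $f:2^{[m]}\to\mathbb{R}_{\ge 0}$, $f(\emptyset)=0$, of $W$-distance at least $1-e^{ -cm}$ from coverage must make at least $2^{c'm}$ queries in the worst case.
   Context: $[m]=\{1,\dots,m\}$. A function $f:2^{[m]}\to\mathbb{R}_{\ge 0}$ is a coverage function if there exist a finite set $U$, weights $w_u\ge 0$ for $u\in U$, and sets $A_1,\dots,A_m\subseteq U$ such that $f(T)=\sum_{u\in\bigcup_{i\in T}A_i} w_u$ for all $T\subseteq[m]$. The $W$-coefficients of a set function $f$ with $f(\emptyset)=0$ are, for each non-empty $S\subseteq[m]$, $w(S)=\sum_{T:\,S\cup T=[m]}(-1)^{|S\cap T|+1}f(T)$. The $W$-distance of $f$ from coverage is the fraction of its $2^m-1$ $W$-coefficients that are negative. A tester (for $W$-distance $\delta$) is a possibly randomized, computationally unbounded, adaptive algorithm with access to a value oracle of $f$ (returning $f(T)$ on query $T\subseteq[m]$) which returns Yes with certainty whenever $f$ is a coverage function, and returns No with probability at least $2/3$ whenever $f$ has $W$-distance at least $\delta$; its number of queries is the maximum over all inputs $f$ and all random choices. -}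

module Defs where

open import Data.Bool using (Bool; true; false; not)
open import Data.Fin using (Fin)
open import Data.Fin.Subset using (Subset; inside; outside; ⊤; ⊥; _∪_; _∩_; ⋃; Nonempty; ∣_∣)
open import Data.Fin.Subset.Properties using (_∈?_)
open import Data.Integer as ℤ using (+_)
import Data.Integer.Properties as ℤ
open import Data.List using (List; []; _∷_; _++_; map; filter; foldr; length; allFin; upTo)
open import Data.List.Relation.Unary.All using (All)
open import Data.List.Relation.Unary.Unique.Propositional using (Unique)
open import Data.Nat as ℕ using (ℕ; zero; suc; z≤n; s≤s; _!)
open import Data.Nat.Properties as ℕ using (_!≢0)
open import Data.Product using (_×_; _,_; ∃; proj₁; proj₂)
open import Data.Rational as ℚ using (ℚ; 0ℚ; 1ℚ; ½)
import Data.Rational.Properties as ℚ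
open import Data.Rational.Solver using (module +-*-Solver)
open +-*-Solver using (solve; con; _:=_; _:+_; _:-_; _:*_; :-_)
import Data.Rational.Unnormalised as ℚᵘ
import Data.Rational.Unnormalised.Properties as ℚᵘ
open import Data.Sum using (inj₁; inj₂)
open import Data.Vec using ([]; _∷_)
open import Data.Vec.Properties using (≡-dec)
import Data.Bool.Properties as Bool
open import Function using (_∘_; _⇔_)
open import Relation.Binary.PropositionalEquality
  using (_≡_; _≢_; refl; sym; trans; cong; cong₂; subst; subst₂)

------------------------------------------------------------------------
-- Rational estimates

ι : ℕ → ℚ
ι n = + n ℚ./ 1

ι-suc : ∀ n → ι (suc n) ≡ 1ℚ ℚ.+ ι n
ι-suc n = ℚ.toℚᵘ-injective (begin
  ℚ.toℚᵘ (ι (suc n))                ≈⟨ ℚ.toℚᵘ-fromℚᵘ (ℚᵘ.mkℚᵘ (+ suc n) 0) ⟩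
  ℚᵘ.mkℚᵘ (+ suc n) 0             ≈⟨ ℚᵘ.*≡* (cong (ℤ._* + 1) (cong (ℤ._+_ (+ 1)) (sym (ℤ.*-identityʳ (+ n))))) ⟩
  ℚᵘ.1ℚᵘ ℚᵘ.+ ℚᵘ.mkℚᵘ (+ n) 0     ≈⟨ ℚᵘ.+-congʳ ℚᵘ.1ℚᵘ (ℚᵘ.≃-sym (ℚ.toℚᵘ-fromℚᵘ (ℚᵘ.mkℚᵘ (+ n) 0))) ⟩
  ℚᵘ.1ℚᵘ ℚᵘ.+ ℚ.toℚᵘ (ι n)        ≈⟨ ℚᵘ.≃-sym (ℚ.toℚᵘ-homo-+ 1ℚ (ι n)) ⟩
  ℚ.toℚᵘ (1ℚ ℚ.+ ι n)           ∎)
  where open ℚᵘ.≃-Reasoning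

ι-mono : ∀ {m n} → m ℕ.≤ n → ι m ℚ.≤ ι n
ι-mono {m} {n} m≤n = ℚ.toℚᵘ-cancel-≤ (begin
  ℚ.toℚᵘ (ι m)        ≃⟨ ℚ.toℚᵘ-fromℚᵘ (ℚᵘ.mkℚᵘ (+ m) 0) ⟩
  ℚᵘ.mkℚᵘ (+ m) 0     ≤⟨ ℚᵘ.*≤* (ℤ.*-monoʳ-≤-nonNeg (+ 1) (ℤ.+≤+ m≤n)) ⟩
  ℚᵘ.mkℚᵘ (+ n) 0     ≃⟨ ℚᵘ.≃-sym (ℚ.toℚᵘ-fromℚᵘ (ℚᵘ.mkℚᵘ (+ n) 0)) ⟩
  ℚ.toℚᵘ (ι n)        ∎)
  where open ℚᵘ.≤-Reasoning

archimedean : ∀ p → ∃ λ n → p ℚ.≤ ι n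
archimedean p@(ℚ.mkℚ a d _) = ℤ.∣ a ∣ , ℚ.toℚᵘ-cancel-≤ (begin
  ℚᵘ.mkℚᵘ a d               ≤⟨ ℚᵘ.*≤* (bound a) ⟩
  ℚᵘ.mkℚᵘ (+ ℤ.∣ a ∣) 0     ≃⟨ ℚᵘ.≃-sym (ℚ.toℚᵘ-fromℚᵘ (ℚᵘ.mkℚᵘ (+ ℤ.∣ a ∣) 0)) ⟩
  ℚ.toℚᵘ (ι ℤ.∣ a ∣)        ∎)
  where
  open ℚᵘ.≤-Reasoning
  bound : ∀ a → a ℤ.* + 1 ℤ.≤ + ℤ.∣ a ∣ ℤ.* + suc d
  bound (+ n) = subst₂ ℤ._≤_ (ℤ.pos-* n 1) (ℤ.pos-* n (suc d)) (ℤ.+≤+ (ℕ.*-monoʳ-≤ n (s≤s z≤n)))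
  bound ℤ.-[1+ n ] = ℤ.-≤+

recip-inverse : ∀ k → (+ 1 ℚ./ suc k) ℚ.* ι (suc k) ≡ 1ℚ
recip-inverse k = ℚ.toℚᵘ-injective (begin
  ℚ.toℚᵘ ((+ 1 ℚ./ suc k) ℚ.* ι (suc k))             ≈⟨ ℚ.toℚᵘ-homo-* (+ 1 ℚ./ suc k) (ι (suc k)) ⟩
  ℚ.toℚᵘ (+ 1 ℚ./ suc k) ℚᵘ.* ℚ.toℚᵘ (ι (suc k))     ≈⟨ ℚᵘ.*-cong (ℚ.toℚᵘ-fromℚᵘ (ℚᵘ.mkℚᵘ (+ 1) k)) (ℚ.toℚᵘ-fromℚᵘ (ℚᵘ.mkℚᵘ (+ suc k) 0)) ⟩
  ℚᵘ.mkℚᵘ (+ 1) k ℚᵘ.* ℚᵘ.mkℚᵘ (+ suc k) 0           ≈⟨ ℚᵘ.*≡* (cong +_ (cong suc eq)) ⟩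
  ℚᵘ.1ℚᵘ                                             ∎)
  where
  open ℚᵘ.≃-Reasoning
  eq : (k ℕ.+ 0) ℕ.* 1 ≡ k ℕ.* 1 ℕ.+ 0
  eq = trans (ℕ.*-identityʳ (k ℕ.+ 0)) (cong (ℕ._+ 0) (sym (ℕ.*-identityʳ k)))

recip-* : ∀ a b .{{_ : ℕ.NonZero a}} .{{_ : ℕ.NonZero b}} .{{_ : ℕ.NonZero (a ℕ.* b)}} →
          + 1 ℚ./ (a ℕ.* b) ≡ (+ 1 ℚ./ a) ℚ.* (+ 1 ℚ./ b)
recip-* a@(suc m) b@(suc n) = ℚ.toℚᵘ-injective (begin
  ℚ.toℚᵘ (+ 1 ℚ./ (a ℕ.* b))                         ≈⟨ ℚ.toℚᵘ-fromℚᵘ (ℚᵘ.mkℚᵘ (+ 1) (ℕ.pred (a ℕ.* b))) ⟩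
  ℚᵘ.mkℚᵘ (+ 1) m ℚᵘ.* ℚᵘ.mkℚᵘ (+ 1) n               ≈⟨ ℚᵘ.≃-sym (ℚᵘ.*-cong (ℚ.toℚᵘ-fromℚᵘ (ℚᵘ.mkℚᵘ (+ 1) m)) (ℚ.toℚᵘ-fromℚᵘ (ℚᵘ.mkℚᵘ (+ 1) n))) ⟩
  ℚ.toℚᵘ (+ 1 ℚ./ a) ℚᵘ.* ℚ.toℚᵘ (+ 1 ℚ./ b)         ≈⟨ ℚᵘ.≃-sym (ℚ.toℚᵘ-homo-* (+ 1 ℚ./ a) (+ 1 ℚ./ b)) ⟩
  ℚ.toℚᵘ ((+ 1 ℚ./ a) ℚ.* (+ 1 ℚ./ b))               ∎)
  where open ℚᵘ.≃-Reasoning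

recip-anti : ∀ k → + 1 ℚ./ suc (suc k) ℚ.≤ + 1 ℚ./ suc k
recip-anti k = ℚ.toℚᵘ-cancel-≤ (begin
  ℚ.toℚᵘ (+ 1 ℚ./ suc (suc k))     ≃⟨ ℚ.toℚᵘ-fromℚᵘ (ℚᵘ.mkℚᵘ (+ 1) (suc k)) ⟩
  ℚᵘ.mkℚᵘ (+ 1) (suc k)            ≤⟨ ℚᵘ.*≤* (ℤ.*-monoˡ-≤-nonNeg (+ 1) (ℤ.+≤+ (ℕ.n≤1+n (suc k)))) ⟩
  ℚᵘ.mkℚᵘ (+ 1) k                  ≃⟨ ℚᵘ.≃-sym (ℚ.toℚᵘ-fromℚᵘ (ℚᵘ.mkℚᵘ (+ 1) k)) ⟩
  ℚ.toℚᵘ (+ 1 ℚ./ suc k)           ∎)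
  where open ℚᵘ.≤-Reasoning

0≤recip : ∀ n .{{_ : ℕ.NonZero n}} → 0ℚ ℚ.≤ + 1 ℚ./ n
0≤recip n = ℚ.nonNegative⁻¹ (+ 1 ℚ./ n) {{ℚ.normalize-nonNeg 1 n}}

0<1 : 0ℚ ℚ.< 1ℚ
0<1 = ℚ.positive⁻¹ 1ℚ

*-mono : ∀ {p q r s} → 0ℚ ℚ.≤ p → 0ℚ ℚ.≤ s → p ℚ.≤ q → r ℚ.≤ s → p ℚ.* r ℚ.≤ q ℚ.* s
*-mono {p} {q} {r} {s} 0≤p 0≤s p≤q r≤s = ℚ.≤-trans
  (ℚ.*-monoˡ-≤-nonNeg p {{ℚ.nonNegative 0≤p}} r≤s)
  (ℚ.*-monoʳ-≤-nonNeg s {{ℚ.nonNegative 0≤s}} p≤q)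

*-nonNeg : ∀ {p q} → 0ℚ ℚ.≤ p → 0ℚ ℚ.≤ q → 0ℚ ℚ.≤ p ℚ.* q
*-nonNeg {p} {q} 0≤p 0≤q =
  ℚ.≤-trans (ℚ.≤-reflexive (sym (ℚ.*-zeroˡ q))) (ℚ.*-monoʳ-≤-nonNeg q {{ℚ.nonNegative 0≤q}} 0≤p)

+-nonNeg : ∀ {p q} → 0ℚ ℚ.≤ p → 0ℚ ℚ.≤ q → 0ℚ ℚ.≤ p ℚ.+ q
+-nonNeg = ℚ.+-mono-≤

p≤p+q : ∀ p {q} → 0ℚ ℚ.≤ q → p ℚ.≤ p ℚ.+ q
p≤p+q p 0≤q = ℚ.≤-trans (ℚ.≤-reflexive (sym (ℚ.+-identityʳ p))) (ℚ.+-monoʳ-≤ p 0≤q)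

quotient : ∀ p ε → 0ℚ ℚ.< ε → ∃ λ n → p ℚ.≤ ι (suc n) ℚ.* ε
quotient p ε 0<ε with archimedean (p ℚ.* (ℚ.1/ ε) {{ℚ.>-nonZero 0<ε}})
... | n , le = n , (begin
  p                           ≡⟨ sym (ℚ.*-identityʳ p) ⟩
  p ℚ.* 1ℚ                    ≡⟨ cong (p ℚ.*_) (sym (ℚ.*-inverseˡ ε)) ⟩
  p ℚ.* (ℚ.1/ ε ℚ.* ε)        ≡⟨ sym (ℚ.*-assoc p (ℚ.1/ ε) ε) ⟩
  p ℚ.* ℚ.1/ ε ℚ.* ε          ≤⟨ ℚ.*-monoʳ-≤-nonNeg ε {{ℚ.nonNegative (ℚ.<⇒≤ 0<ε)}} (ℚ.≤-trans le (ι-mono (ℕ.n≤1+n n))) ⟩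
  ι (suc n) ℚ.* ε             ∎)
  where
  open ℚ.≤-Reasoning
  instance _ = ℚ.>-nonZero 0<ε

------------------------------------------------------------------------
-- Real numbers as Cauchy sequences of rationals

Cauchy : (ℕ → ℚ) → Set
Cauchy s = ∀ ε → 0ℚ ℚ.< ε → ∃ λ N → ∀ i j → N ℕ.≤ i → N ℕ.≤ j → ℚ.∣ s i ℚ.- s j ∣ ℚ.≤ ε

record ℝ : Set where
  constructor mkℝ
  field
    seq    : ℕ → ℚ
    cauchy : Cauchy seq

open ℝ public

infix 4 _≤_ _<_ _≈_

_≤_ : ℝ → ℝ → Set
x ≤ y = ∀ ε → 0ℚ ℚ.< ε → ∃ λ N → ∀ n → N ℕ.≤ n → seq x n ℚ.≤ seq y n ℚ.+ ε

_<_ : ℝ → ℝ → Set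
x < y = ∃ λ ε → 0ℚ ℚ.< ε × ∃ λ N → ∀ n → N ℕ.≤ n → seq x n ℚ.+ ε ℚ.≤ seq y n

_≈_ : ℝ → ℝ → Set
x ≈ y = x ≤ y × y ≤ x

scaled : ∀ s K → 0ℚ ℚ.< K →
         (∀ ε → 0ℚ ℚ.< ε → ∃ λ N → ∀ i j → N ℕ.≤ i → N ℕ.≤ j → ℚ.∣ s i ℚ.- s j ∣ ℚ.≤ K ℚ.* ε) →
         Cauchy s
scaled s K 0<K h ε 0<ε with h (ℚ.1/ K ℚ.* ε) 0<δ
  where
  instance
    _ = ℚ.>-nonZero 0<K
    _ = ℚ.positive 0<K
    _ = ℚ.positive 0<ε
    _ = ℚ.1/pos⇒pos K
  0<δ : 0ℚ ℚ.< ℚ.1/ K ℚ.* ε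
  0<δ = ℚ.positive⁻¹ (ℚ.1/ K ℚ.* ε) {{ℚ.pos*pos⇒pos (ℚ.1/ K) ε}}
... | N , le = N , λ i j p q → ℚ.≤-trans (le i j p q) (ℚ.≤-reflexive eq)
  where
  instance _ = ℚ.>-nonZero 0<K
  eq : K ℚ.* (ℚ.1/ K ℚ.* ε) ≡ ε
  eq = trans (sym (ℚ.*-assoc K (ℚ.1/ K) ε)) (trans (cong (ℚ._* ε) (ℚ.*-inverseʳ K)) (ℚ.*-identityˡ ε))

bounded : ∀ s → Cauchy s → ∃ λ B → 0ℚ ℚ.< B × ∃ λ N → ∀ n → N ℕ.≤ n → ℚ.∣ s n ∣ ℚ.≤ B
bounded s c with c 1ℚ 0<1
... | N , le = 1ℚ ℚ.+ ℚ.∣ s N ∣ , ℚ.+-mono-<-≤ 0<1 (ℚ.0≤∣p∣ (s N)) , N , λ n N≤n → begin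
  ℚ.∣ s n ∣                              ≡⟨ cong ℚ.∣_∣ (split (s n) (s N)) ⟩
  ℚ.∣ (s n ℚ.- s N) ℚ.+ s N ∣            ≤⟨ ℚ.∣p+q∣≤∣p∣+∣q∣ (s n ℚ.- s N) (s N) ⟩
  ℚ.∣ s n ℚ.- s N ∣ ℚ.+ ℚ.∣ s N ∣        ≤⟨ ℚ.+-monoˡ-≤ ℚ.∣ s N ∣ (le n N N≤n ℕ.≤-refl) ⟩
  1ℚ ℚ.+ ℚ.∣ s N ∣                       ∎
  where
  open ℚ.≤-Reasoning
  split : ∀ a b → a ≡ (a ℚ.- b) ℚ.+ b
  split = solve 2 (λ a b → a := (a :- b) :+ b) refl

∣p-p∣≡0 : ∀ p → ℚ.∣ p ℚ.- p ∣ ≡ 0ℚ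
∣p-p∣≡0 p = cong ℚ.∣_∣ (ℚ.+-inverseʳ p)

-- Convergence proofs are abstract so that moduli never unfold.
abstract

  const-cauchy : ∀ p → Cauchy (λ _ → p)
  const-cauchy p ε 0<ε = 0 , λ _ _ _ _ → ℚ.≤-trans (ℚ.≤-reflexive (∣p-p∣≡0 p)) (ℚ.<⇒≤ 0<ε)

fromℚ : ℚ → ℝ
fromℚ p = mkℝ (λ _ → p) (const-cauchy p)

fromℕ : ℕ → ℝ
fromℕ n = fromℚ (+ n ℚ./ 1)

0ℝ 1ℝ : ℝ
0ℝ = fromℚ 0ℚ
1ℝ = fromℚ 1ℚ

abstract

  +-cauchy : ∀ x y → Cauchy (λ n → seq x n ℚ.+ seq y n)
  +-cauchy x y = scaled (λ n → seq x n ℚ.+ seq y n) (1ℚ ℚ.+ 1ℚ) (ℚ.positive⁻¹ (1ℚ ℚ.+ 1ℚ)) λ ε 0<ε →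
    let M , p = cauchy x ε 0<ε
        N , q = cauchy y ε 0<ε
    in M ℕ.⊔ N , λ i j le le′ → let open ℚ.≤-Reasoning in begin
      ℚ.∣ (seq x i ℚ.+ seq y i) ℚ.- (seq x j ℚ.+ seq y j) ∣
        ≡⟨ cong ℚ.∣_∣ (regroup (seq x i) (seq y i) (seq x j) (seq y j)) ⟩
      ℚ.∣ (seq x i ℚ.- seq x j) ℚ.+ (seq y i ℚ.- seq y j) ∣
        ≤⟨ ℚ.∣p+q∣≤∣p∣+∣q∣ (seq x i ℚ.- seq x j) (seq y i ℚ.- seq y j) ⟩
      ℚ.∣ seq x i ℚ.- seq x j ∣ ℚ.+ ℚ.∣ seq y i ℚ.- seq y j ∣
        ≤⟨ ℚ.+-mono-≤ (p i j (ℕ.m⊔n≤o⇒m≤o M N le) (ℕ.m⊔n≤o⇒m≤o M N le′))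
                      (q i j (ℕ.m⊔n≤o⇒n≤o M N le) (ℕ.m⊔n≤o⇒n≤o M N le′)) ⟩
      ε ℚ.+ ε
        ≡⟨ double ε ⟩
      (1ℚ ℚ.+ 1ℚ) ℚ.* ε ∎
    where
    regroup : ∀ a b c d → (a ℚ.+ b) ℚ.- (c ℚ.+ d) ≡ (a ℚ.- c) ℚ.+ (b ℚ.- d)
    regroup = solve 4 (λ a b c d → (a :+ b) :- (c :+ d) := (a :- c) :+ (b :- d)) refl
    double : ∀ a → a ℚ.+ a ≡ (1ℚ ℚ.+ 1ℚ) ℚ.* a
    double = solve 1 (λ a → a :+ a := (con 1ℚ :+ con 1ℚ) :* a) refl

  -‿cauchy : ∀ x → Cauchy (λ n → ℚ.- seq x n)
  -‿cauchy x ε 0<ε =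
    let N , p = cauchy x ε 0<ε
    in N , λ i j le le′ → ℚ.≤-trans (ℚ.≤-reflexive (eq (seq x i) (seq x j))) (p i j le le′)
    where
    eq : ∀ a b → ℚ.∣ ℚ.- a ℚ.- (ℚ.- b) ∣ ≡ ℚ.∣ a ℚ.- b ∣
    eq a b = trans (cong ℚ.∣_∣ (solve 2 (λ a b → :- a :- (:- b) := :- (a :- b)) refl a b)) (ℚ.∣-p∣≡∣p∣ (a ℚ.- b))

∣ab-cd∣ : ∀ a b c d → ℚ.∣ a ℚ.* b ℚ.- c ℚ.* d ∣ ℚ.≤ ℚ.∣ a ∣ ℚ.* ℚ.∣ b ℚ.- d ∣ ℚ.+ ℚ.∣ d ∣ ℚ.* ℚ.∣ a ℚ.- c ∣
∣ab-cd∣ a b c d = begin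
  ℚ.∣ a ℚ.* b ℚ.- c ℚ.* d ∣
    ≡⟨ cong ℚ.∣_∣ (solve 4 (λ a b c d → a :* b :- c :* d := a :* (b :- d) :+ d :* (a :- c)) refl a b c d) ⟩
  ℚ.∣ a ℚ.* (b ℚ.- d) ℚ.+ d ℚ.* (a ℚ.- c) ∣
    ≤⟨ ℚ.∣p+q∣≤∣p∣+∣q∣ (a ℚ.* (b ℚ.- d)) (d ℚ.* (a ℚ.- c)) ⟩
  ℚ.∣ a ℚ.* (b ℚ.- d) ∣ ℚ.+ ℚ.∣ d ℚ.* (a ℚ.- c) ∣
    ≡⟨ cong₂ ℚ._+_ (ℚ.∣p*q∣≡∣p∣*∣q∣ a (b ℚ.- d)) (ℚ.∣p*q∣≡∣p∣*∣q∣ d (a ℚ.- c)) ⟩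
  ℚ.∣ a ∣ ℚ.* ℚ.∣ b ℚ.- d ∣ ℚ.+ ℚ.∣ d ∣ ℚ.* ℚ.∣ a ℚ.- c ∣ ∎
  where
  open ℚ.≤-Reasoning

product-estimate : ∀ {A B} u v u′ v′ ε → 0ℚ ℚ.≤ ε →
                   ℚ.∣ u ∣ ℚ.≤ A → ℚ.∣ v ℚ.- v′ ∣ ℚ.≤ ε → ℚ.∣ v′ ∣ ℚ.≤ B → ℚ.∣ u ℚ.- u′ ∣ ℚ.≤ ε →
                   ℚ.∣ u ℚ.* v ℚ.- u′ ℚ.* v′ ∣ ℚ.≤ (A ℚ.+ B) ℚ.* ε
product-estimate {A} {B} u v u′ v′ ε 0≤ε u≤ dv≤ v≤ du≤ = begin
  ℚ.∣ u ℚ.* v ℚ.- u′ ℚ.* v′ ∣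
    ≤⟨ ∣ab-cd∣ u v u′ v′ ⟩
  ℚ.∣ u ∣ ℚ.* ℚ.∣ v ℚ.- v′ ∣ ℚ.+ ℚ.∣ v′ ∣ ℚ.* ℚ.∣ u ℚ.- u′ ∣
    ≤⟨ ℚ.+-mono-≤ (*-mono (ℚ.0≤∣p∣ u) 0≤ε u≤ dv≤) (*-mono (ℚ.0≤∣p∣ v′) 0≤ε v≤ du≤) ⟩
  A ℚ.* ε ℚ.+ B ℚ.* ε
    ≡⟨ sym (ℚ.*-distribʳ-+ ε A B) ⟩
  (A ℚ.+ B) ℚ.* ε ∎
  where open ℚ.≤-Reasoning

abstract

  *-cauchy : ∀ x y → Cauchy (λ n → seq x n ℚ.* seq y n)
  *-cauchy x y =
    let A , 0<A , M , a = bounded (seq x) (cauchy x)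
        B , 0<B , N , b = bounded (seq y) (cauchy y)
    in scaled (λ n → seq x n ℚ.* seq y n) (A ℚ.+ B) (ℚ.+-mono-< 0<A 0<B) λ ε 0<ε →
      let M′ , p = cauchy x ε 0<ε
          N′ , q = cauchy y ε 0<ε
      in (M ℕ.⊔ N) ℕ.⊔ (M′ ℕ.⊔ N′) , λ i j le le′ →
        let MN≤i   = ℕ.m⊔n≤o⇒m≤o (M ℕ.⊔ N) (M′ ℕ.⊔ N′) le
            M′N′≤i = ℕ.m⊔n≤o⇒n≤o (M ℕ.⊔ N) (M′ ℕ.⊔ N′) le
            MN≤j   = ℕ.m⊔n≤o⇒m≤o (M ℕ.⊔ N) (M′ ℕ.⊔ N′) le′
            M′N′≤j = ℕ.m⊔n≤o⇒n≤o (M ℕ.⊔ N) (M′ ℕ.⊔ N′) le′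
        in product-estimate (seq x i) (seq y i) (seq x j) (seq y j) ε (ℚ.<⇒≤ 0<ε)
             (a i (ℕ.m⊔n≤o⇒m≤o M N MN≤i))
             (q i j (ℕ.m⊔n≤o⇒n≤o M′ N′ M′N′≤i) (ℕ.m⊔n≤o⇒n≤o M′ N′ M′N′≤j))
             (b j (ℕ.m⊔n≤o⇒n≤o M N MN≤j))
             (p i j (ℕ.m⊔n≤o⇒m≤o M′ N′ M′N′≤i) (ℕ.m⊔n≤o⇒m≤o M′ N′ M′N′≤j))

infix  8 -_
infixl 7 _*_
infixl 6 _+_ _-_
infixr 8 _^_

_+_ : ℝ → ℝ → ℝ
x + y = mkℝ (λ n → seq x n ℚ.+ seq y n) (+-cauchy x y)

-_ : ℝ → ℝ
- x = mkℝ (λ n → ℚ.- seq x n) (-‿cauchy x)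

_-_ : ℝ → ℝ → ℝ
x - y = x + (- y)

_*_ : ℝ → ℝ → ℝ
x * y = mkℝ (λ n → seq x n ℚ.* seq y n) (*-cauchy x y)

_^_ : ℝ → ℕ → ℝ
x ^ zero  = 1ℝ
x ^ suc n = x * x ^ n

sum : List ℝ → ℝ
sum = foldr _+_ 0ℝ

------------------------------------------------------------------------
-- Series, the exponential and powers of 2

infixr 8 _^ℚ_

_^ℚ_ : ℚ → ℕ → ℚ
p ^ℚ zero  = 1ℚ
p ^ℚ suc n = p ℚ.* p ^ℚ n

partialSum : (ℕ → ℚ) → ℕ → ℚ
partialSum t zero    = 0ℚ
partialSum t (suc n) = partialSum t n ℚ.+ t n

module RatioTest (t : ℕ → ℚ) (0≤t : ∀ k → 0ℚ ℚ.≤ t k)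
                 (M : ℕ) (ratio : ∀ k → M ℕ.≤ k → t (suc k) ℚ.≤ ½ ℚ.* t k) where

  open ℚ.≤-Reasoning

  S : ℕ → ℚ
  S = partialSum t

  S-mono-step : ∀ i d → S i ℚ.≤ S (d ℕ.+ i)
  S-mono-step i zero    = ℚ.≤-refl
  S-mono-step i (suc d) = ℚ.≤-trans (S-mono-step i d) (p≤p+q (S (d ℕ.+ i)) (0≤t (d ℕ.+ i)))

  S-mono : ∀ {i j} → i ℕ.≤ j → S i ℚ.≤ S j
  S-mono {i} {j} i≤j = subst (λ z → S i ℚ.≤ S z) (ℕ.m∸n+n≡m i≤j) (S-mono-step i (j ℕ.∸ i))

  -- S k + 2 t k is non-increasing from M on.
  G : ℕ → ℚ
  G k = S k ℚ.+ (t k ℚ.+ t k)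

  G-step : ∀ k → M ℕ.≤ k → G (suc k) ℚ.≤ G k
  G-step k M≤k = begin
    (S k ℚ.+ t k) ℚ.+ (t (suc k) ℚ.+ t (suc k))
      ≤⟨ ℚ.+-monoʳ-≤ (S k ℚ.+ t k) (ℚ.+-mono-≤ (ratio k M≤k) (ratio k M≤k)) ⟩
    (S k ℚ.+ t k) ℚ.+ (½ ℚ.* t k ℚ.+ ½ ℚ.* t k)
      ≡⟨ solve 2 (λ s u → (s :+ u) :+ (con ½ :* u :+ con ½ :* u) := s :+ (u :+ u)) refl (S k) (t k) ⟩
    S k ℚ.+ (t k ℚ.+ t k) ∎

  G-anti-step : ∀ i d → M ℕ.≤ i → G (d ℕ.+ i) ℚ.≤ G i
  G-anti-step i zero    M≤i = ℚ.≤-refl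
  G-anti-step i (suc d) M≤i =
    ℚ.≤-trans (G-step (d ℕ.+ i) (ℕ.≤-trans M≤i (ℕ.m≤n+m i d))) (G-anti-step i d M≤i)

  S≤G : ∀ {i j} → M ℕ.≤ i → i ℕ.≤ j → S j ℚ.≤ G i
  S≤G {i} {j} M≤i i≤j = ℚ.≤-trans (p≤p+q (S j) (+-nonNeg (0≤t j) (0≤t j)))
    (subst (λ z → G z ℚ.≤ G i) (ℕ.m∸n+n≡m i≤j) (G-anti-step i (j ℕ.∸ i) M≤i))

  S-bound : ∀ n → S n ℚ.≤ G M
  S-bound n with ℕ.≤-total M n
  ... | inj₁ M≤n = S≤G ℕ.≤-refl M≤n
  ... | inj₂ n≤M = ℚ.≤-trans (S-mono n≤M) (S≤G ℕ.≤-refl ℕ.≤-refl)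

  decay : ∀ p → ι (suc p) ℚ.* t (p ℕ.+ M) ℚ.≤ t M
  decay zero    = ℚ.≤-reflexive (ℚ.*-identityˡ (t M))
  decay (suc p) = begin
    ι (suc (suc p)) ℚ.* t (suc p ℕ.+ M)
      ≡⟨ cong (ℚ._* t (suc p ℕ.+ M)) (trans (ι-suc (suc p)) (cong (1ℚ ℚ.+_) (ι-suc p))) ⟩
    (1ℚ ℚ.+ (1ℚ ℚ.+ P)) ℚ.* t (suc p ℕ.+ M)
      ≤⟨ *-mono (+-nonNeg (ℚ.<⇒≤ 0<1) (+-nonNeg (ℚ.<⇒≤ 0<1) 0≤P)) (*-nonNeg (ℚ.nonNegative⁻¹ ½) (0≤t (p ℕ.+ M)))
           (ℚ.≤-trans (p≤p+q _ 0≤P) ℚ.≤-refl) (ratio (p ℕ.+ M) (ℕ.m≤n+m M p)) ⟩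
    ((1ℚ ℚ.+ (1ℚ ℚ.+ P)) ℚ.+ P) ℚ.* (½ ℚ.* u)
      ≡⟨ solve 2 (λ P u → ((con 1ℚ :+ (con 1ℚ :+ P)) :+ P) :* (con ½ :* u) := (con 1ℚ :+ P) :* u) refl P u ⟩
    (1ℚ ℚ.+ P) ℚ.* u
      ≡⟨ cong (ℚ._* u) (sym (ι-suc p)) ⟩
    ι (suc p) ℚ.* u
      ≤⟨ decay p ⟩
    t M ∎
    where
    P = ι p
    u = t (p ℕ.+ M)
    0≤P : 0ℚ ℚ.≤ P
    0≤P = ι-mono {0} {p} z≤n

  tail : ∀ ε → 0ℚ ℚ.< ε → ∃ λ N → ∀ i j → N ℕ.≤ i → i ℕ.≤ j → S j ℚ.- S i ℚ.≤ (1ℚ ℚ.+ 1ℚ) ℚ.* ε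
  tail ε 0<ε with quotient (t M) ε 0<ε
  ... | p , le = p ℕ.+ M , λ i j N≤i i≤j → begin
    S j ℚ.- S i
      ≤⟨ ℚ.+-mono-≤ (S≤G (ℕ.m≤n+m M p) (ℕ.≤-trans N≤i i≤j)) (ℚ.neg-antimono-≤ (S-mono N≤i)) ⟩
    G (p ℕ.+ M) ℚ.- S (p ℕ.+ M)
      ≡⟨ solve 2 (λ s u → (s :+ (u :+ u)) :- s := (con 1ℚ :+ con 1ℚ) :* u) refl (S (p ℕ.+ M)) (t (p ℕ.+ M)) ⟩
    (1ℚ ℚ.+ 1ℚ) ℚ.* t (p ℕ.+ M)
      ≤⟨ ℚ.*-monoˡ-≤-nonNeg (1ℚ ℚ.+ 1ℚ) small ⟩
    (1ℚ ℚ.+ 1ℚ) ℚ.* ε ∎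
    where
    small : t (p ℕ.+ M) ℚ.≤ ε
    small = ℚ.*-cancelˡ-≤-pos (ι (suc p)) {{ℚ.normalize-pos (suc p) 1}} (ℚ.≤-trans (decay p) le)

tails⇒cauchy : ∀ s K → 0ℚ ℚ.< K →
               (∀ ε → 0ℚ ℚ.< ε → ∃ λ N → ∀ i j → N ℕ.≤ i → i ℕ.≤ j → ℚ.∣ s j ℚ.- s i ∣ ℚ.≤ K ℚ.* ε) →
               Cauchy s
tails⇒cauchy s K 0<K h = scaled s K 0<K λ ε 0<ε → let N , p = h ε 0<ε in N , λ i j N≤i N≤j → go ε N p i j N≤i N≤j
  where
  flip : ∀ a b → ℚ.∣ a ℚ.- b ∣ ≡ ℚ.∣ b ℚ.- a ∣
  flip a b = trans (cong ℚ.∣_∣ (solve 2 (λ a b → a :- b := :- (b :- a)) refl a b)) (ℚ.∣-p∣≡∣p∣ (b ℚ.- a))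
  go : ∀ ε N → (∀ i j → N ℕ.≤ i → i ℕ.≤ j → ℚ.∣ s j ℚ.- s i ∣ ℚ.≤ K ℚ.* ε) →
       ∀ i j → N ℕ.≤ i → N ℕ.≤ j → ℚ.∣ s i ℚ.- s j ∣ ℚ.≤ K ℚ.* ε
  go ε N p i j N≤i N≤j with ℕ.≤-total i j
  ... | inj₁ i≤j = ℚ.≤-trans (ℚ.≤-reflexive (flip (s i) (s j))) (p i j N≤i i≤j)
  ... | inj₂ j≤i = p j i N≤j j≤i

dominated : ∀ u t → (∀ k → ℚ.∣ u k ∣ ℚ.≤ t k) → ∀ {i j} → i ℕ.≤ j →
            ℚ.∣ partialSum u j ℚ.- partialSum u i ∣ ℚ.≤ partialSum t j ℚ.- partialSum t i
dominated u t le {i} {j} i≤j =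
  subst (λ z → ℚ.∣ partialSum u z ℚ.- partialSum u i ∣ ℚ.≤ partialSum t z ℚ.- partialSum t i) (ℕ.m∸n+n≡m i≤j) (go (j ℕ.∸ i))
  where
  open ℚ.≤-Reasoning
  shift : ∀ a b c → (a ℚ.+ b) ℚ.- c ≡ (a ℚ.- c) ℚ.+ b
  shift = solve 3 (λ a b c → (a :+ b) :- c := (a :- c) :+ b) refl
  go : ∀ d → ℚ.∣ partialSum u (d ℕ.+ i) ℚ.- partialSum u i ∣ ℚ.≤ partialSum t (d ℕ.+ i) ℚ.- partialSum t i
  go zero    = ℚ.≤-reflexive (trans (∣p-p∣≡0 (partialSum u i)) (sym (ℚ.+-inverseʳ (partialSum t i))))
  go (suc d) = begin
    ℚ.∣ (partialSum u (d ℕ.+ i) ℚ.+ u (d ℕ.+ i)) ℚ.- partialSum u i ∣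
      ≡⟨ cong ℚ.∣_∣ (shift (partialSum u (d ℕ.+ i)) (u (d ℕ.+ i)) (partialSum u i)) ⟩
    ℚ.∣ (partialSum u (d ℕ.+ i) ℚ.- partialSum u i) ℚ.+ u (d ℕ.+ i) ∣
      ≤⟨ ℚ.∣p+q∣≤∣p∣+∣q∣ (partialSum u (d ℕ.+ i) ℚ.- partialSum u i) (u (d ℕ.+ i)) ⟩
    ℚ.∣ partialSum u (d ℕ.+ i) ℚ.- partialSum u i ∣ ℚ.+ ℚ.∣ u (d ℕ.+ i) ∣
      ≤⟨ ℚ.+-mono-≤ (go d) (le (d ℕ.+ i)) ⟩
    (partialSum t (d ℕ.+ i) ℚ.- partialSum t i) ℚ.+ t (d ℕ.+ i)
      ≡⟨ sym (shift (partialSum t (d ℕ.+ i)) (t (d ℕ.+ i)) (partialSum t i)) ⟩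
    (partialSum t (d ℕ.+ i) ℚ.+ t (d ℕ.+ i)) ℚ.- partialSum t i ∎

expTerm : ℚ → ℕ → ℚ
expTerm p k = p ^ℚ k ℚ.* (+ 1 ℚ./ k !) {{k !≢0}}

expTerm-suc : ∀ p k → expTerm p (suc k) ≡ expTerm p k ℚ.* (p ℚ.* (+ 1 ℚ./ suc k))
expTerm-suc p k = trans
  (cong (p ^ℚ suc k ℚ.*_) (recip-* (suc k) (k !) {{_}} {{k !≢0}} {{suc k !≢0}}))
  (solve 4 (λ p q a b → (p :* q) :* (a :* b) := (q :* b) :* (p :* a)) refl
    p (p ^ℚ k) (+ 1 ℚ./ suc k) ((+ 1 ℚ./ k !) {{k !≢0}}))

module Exp (B : ℚ) (0<B : 0ℚ ℚ.< B) where

  open ℚ.≤-Reasoning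

  T : ℕ → ℚ
  T = expTerm B

  c : ℕ → ℚ
  c k = + 1 ℚ./ suc k

  0≤B : 0ℚ ℚ.≤ B
  0≤B = ℚ.<⇒≤ 0<B

  0≤Bc : ∀ k → 0ℚ ℚ.≤ B ℚ.* c k
  0≤Bc k = *-nonNeg 0≤B (0≤recip (suc k))

  0≤T : ∀ k → 0ℚ ℚ.≤ T k
  0≤T zero    = ℚ.nonNegative⁻¹ (T 0)
  0≤T (suc k) = ℚ.≤-trans (*-nonNeg (0≤T k) (0≤Bc k)) (ℚ.≤-reflexive (sym (expTerm-suc B k)))

  M : ℕ
  M = archimedean (B ℚ.+ B) .proj₁

  ratio : ∀ k → M ℕ.≤ k → T (suc k) ℚ.≤ ½ ℚ.* T k
  ratio k M≤k = begin
    T (suc k)                      ≡⟨ expTerm-suc B k ⟩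
    T k ℚ.* (B ℚ.* c k)            ≤⟨ ℚ.*-monoˡ-≤-nonNeg (T k) {{ℚ.nonNegative (0≤T k)}} Bc≤½ ⟩
    T k ℚ.* ½                      ≡⟨ ℚ.*-comm (T k) ½ ⟩
    ½ ℚ.* T k                      ∎
    where
    Bc≤½ : B ℚ.* c k ℚ.≤ ½
    Bc≤½ = begin
      B ℚ.* c k                        ≡⟨ solve 2 (λ b c → b :* c := con ½ :* (c :* (b :+ b))) refl B (c k) ⟩
      ½ ℚ.* (c k ℚ.* (B ℚ.+ B))        ≤⟨ ℚ.*-monoˡ-≤-nonNeg ½ (ℚ.*-monoˡ-≤-nonNeg (c k) {{ℚ.nonNegative (0≤recip (suc k))}}
                                            (ℚ.≤-trans (archimedean (B ℚ.+ B) .proj₂) (ι-mono (ℕ.m≤n⇒m≤1+n M≤k)))) ⟩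
      ½ ℚ.* (c k ℚ.* ι (suc k))        ≡⟨ cong (½ ℚ.*_) (recip-inverse k) ⟩
      ½ ℚ.* 1ℚ                         ≡⟨ ℚ.*-identityʳ ½ ⟩
      ½                                ∎

  open RatioTest T 0≤T M ratio public

  absorb : ∀ k → B ℚ.* T k ≡ ι (suc k) ℚ.* T (suc k)
  absorb k = sym (begin-equality
    ι (suc k) ℚ.* T (suc k)                       ≡⟨ cong (ι (suc k) ℚ.*_) (expTerm-suc B k) ⟩
    ι (suc k) ℚ.* (T k ℚ.* (B ℚ.* c k))           ≡⟨ solve 4 (λ i t b c → i :* (t :* (b :* c)) := (c :* i) :* (b :* t)) refl (ι (suc k)) (T k) B (c k) ⟩
    (c k ℚ.* ι (suc k)) ℚ.* (B ℚ.* T k)           ≡⟨ cong (ℚ._* (B ℚ.* T k)) (recip-inverse k) ⟩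
    1ℚ ℚ.* (B ℚ.* T k)                            ≡⟨ ℚ.*-identityˡ (B ℚ.* T k) ⟩
    B ℚ.* T k                                     ∎)

  ∣pc∣ : ∀ p k → ℚ.∣ p ℚ.* c k ∣ ≡ ℚ.∣ p ∣ ℚ.* c k
  ∣pc∣ p k = trans (ℚ.∣p*q∣≡∣p∣*∣q∣ p (c k)) (cong (ℚ.∣ p ∣ ℚ.*_) (ℚ.0≤p⇒∣p∣≡p (0≤recip (suc k))))

  ∣pc∣≤ : ∀ p k → ℚ.∣ p ∣ ℚ.≤ B → ℚ.∣ p ℚ.* c k ∣ ℚ.≤ B ℚ.* c k
  ∣pc∣≤ p k p≤B = ℚ.≤-trans (ℚ.≤-reflexive (∣pc∣ p k)) (ℚ.*-monoʳ-≤-nonNeg (c k) {{ℚ.nonNegative (0≤recip (suc k))}} p≤B)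

  term≤T : ∀ p → ℚ.∣ p ∣ ℚ.≤ B → ∀ k → ℚ.∣ expTerm p k ∣ ℚ.≤ T k
  term≤T p p≤B zero    = ℚ.≤-refl
  term≤T p p≤B (suc k) = begin
    ℚ.∣ expTerm p (suc k) ∣                           ≡⟨ cong ℚ.∣_∣ (expTerm-suc p k) ⟩
    ℚ.∣ expTerm p k ℚ.* (p ℚ.* c k) ∣                 ≡⟨ ℚ.∣p*q∣≡∣p∣*∣q∣ (expTerm p k) (p ℚ.* c k) ⟩
    ℚ.∣ expTerm p k ∣ ℚ.* ℚ.∣ p ℚ.* c k ∣             ≤⟨ *-mono (ℚ.0≤∣p∣ (expTerm p k)) (0≤Bc k) (term≤T p p≤B k) (∣pc∣≤ p k p≤B) ⟩
    T k ℚ.* (B ℚ.* c k)                               ≡⟨ sym (expTerm-suc B k) ⟩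
    T (suc k)                                         ∎

  module _ (p q : ℚ) (p≤B : ℚ.∣ p ∣ ℚ.≤ B) (q≤B : ℚ.∣ q ∣ ℚ.≤ B) where

    δ : ℚ
    δ = ℚ.∣ p ℚ.- q ∣

    0≤δ : 0ℚ ℚ.≤ δ
    0≤δ = ℚ.0≤∣p∣ (p ℚ.- q)

    ∣pc-qc∣ : ∀ k → ℚ.∣ p ℚ.* c k ℚ.- q ℚ.* c k ∣ ≡ δ ℚ.* c k
    ∣pc-qc∣ k = trans (cong ℚ.∣_∣ (solve 3 (λ p q c → p :* c :- q :* c := (p :- q) :* c) refl p q (c k))) (∣pc∣ (p ℚ.- q) k)

    term-lipschitz : ∀ k → ℚ.∣ expTerm p (suc k) ℚ.- expTerm q (suc k) ∣ ℚ.≤ δ ℚ.* T k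
    term-lipschitz-step : ∀ k D → ℚ.∣ expTerm p k ℚ.- expTerm q k ∣ ℚ.≤ D →
      ℚ.∣ expTerm p (suc k) ℚ.- expTerm q (suc k) ∣ ℚ.≤ T k ℚ.* (δ ℚ.* c k) ℚ.+ (B ℚ.* c k) ℚ.* D
    term-lipschitz-step k D le = begin
      ℚ.∣ expTerm p (suc k) ℚ.- expTerm q (suc k) ∣
        ≡⟨ cong₂ (λ a b → ℚ.∣ a ℚ.- b ∣) (expTerm-suc p k) (expTerm-suc q k) ⟩
      ℚ.∣ expTerm p k ℚ.* (p ℚ.* c k) ℚ.- expTerm q k ℚ.* (q ℚ.* c k) ∣
        ≤⟨ ∣ab-cd∣ (expTerm p k) (p ℚ.* c k) (expTerm q k) (q ℚ.* c k) ⟩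
      ℚ.∣ expTerm p k ∣ ℚ.* ℚ.∣ p ℚ.* c k ℚ.- q ℚ.* c k ∣ ℚ.+ ℚ.∣ q ℚ.* c k ∣ ℚ.* ℚ.∣ expTerm p k ℚ.- expTerm q k ∣
        ≤⟨ ℚ.+-mono-≤
             (*-mono (ℚ.0≤∣p∣ (expTerm p k)) (*-nonNeg 0≤δ (0≤recip (suc k))) (term≤T p p≤B k) (ℚ.≤-reflexive (∣pc-qc∣ k)))
             (*-mono (ℚ.0≤∣p∣ (q ℚ.* c k)) (ℚ.≤-trans (ℚ.0≤∣p∣ (expTerm p k ℚ.- expTerm q k)) le) (∣pc∣≤ q k q≤B) le) ⟩
      T k ℚ.* (δ ℚ.* c k) ℚ.+ (B ℚ.* c k) ℚ.* D ∎

    term-lipschitz zero = ℚ.≤-trans (term-lipschitz-step 0 0ℚ ℚ.≤-refl)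
      (ℚ.≤-reflexive (solve 2 (λ d b → con 1ℚ :* (d :* con 1ℚ) :+ (b :* con 1ℚ) :* con 0ℚ := d :* con 1ℚ) refl δ B))
    term-lipschitz (suc k) = begin
      ℚ.∣ expTerm p (suc (suc k)) ℚ.- expTerm q (suc (suc k)) ∣
        ≤⟨ term-lipschitz-step (suc k) (δ ℚ.* T k) (term-lipschitz k) ⟩
      T (suc k) ℚ.* (δ ℚ.* c (suc k)) ℚ.+ (B ℚ.* c (suc k)) ℚ.* (δ ℚ.* T k)
        ≡⟨ solve 5 (λ t d c b u → t :* (d :* c) :+ (b :* c) :* (d :* u) := (d :* c) :* (t :+ b :* u)) refl (T (suc k)) δ (c (suc k)) B (T k) ⟩
      (δ ℚ.* c (suc k)) ℚ.* (T (suc k) ℚ.+ B ℚ.* T k)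
        ≡⟨ cong (λ z → (δ ℚ.* c (suc k)) ℚ.* (T (suc k) ℚ.+ z)) (absorb k) ⟩
      (δ ℚ.* c (suc k)) ℚ.* (T (suc k) ℚ.+ ι (suc k) ℚ.* T (suc k))
        ≡⟨ solve 4 (λ d c t i → (d :* c) :* (t :+ i :* t) := d :* ((c :* (con 1ℚ :+ i)) :* t)) refl δ (c (suc k)) (T (suc k)) (ι (suc k)) ⟩
      δ ℚ.* ((c (suc k) ℚ.* (1ℚ ℚ.+ ι (suc k))) ℚ.* T (suc k))
        ≡⟨ cong (λ z → δ ℚ.* (z ℚ.* T (suc k))) (trans (cong (c (suc k) ℚ.*_) (sym (ι-suc (suc k)))) (recip-inverse (suc k))) ⟩
      δ ℚ.* (1ℚ ℚ.* T (suc k))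
        ≡⟨ cong (δ ℚ.*_) (ℚ.*-identityˡ (T (suc k))) ⟩
      δ ℚ.* T (suc k) ∎

    sum-lipschitz : ∀ n → ℚ.∣ partialSum (expTerm p) (suc n) ℚ.- partialSum (expTerm q) (suc n) ∣ ℚ.≤ δ ℚ.* S n
    sum-lipschitz zero    = ℚ.≤-reflexive (sym (ℚ.*-zeroʳ δ))
    sum-lipschitz (suc n) = begin
      ℚ.∣ (P ℚ.+ expTerm p (suc n)) ℚ.- (Q ℚ.+ expTerm q (suc n)) ∣
        ≡⟨ cong ℚ.∣_∣ (solve 4 (λ a b c d → (a :+ b) :- (c :+ d) := (a :- c) :+ (b :- d)) refl P (expTerm p (suc n)) Q (expTerm q (suc n))) ⟩
      ℚ.∣ (P ℚ.- Q) ℚ.+ (expTerm p (suc n) ℚ.- expTerm q (suc n)) ∣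
        ≤⟨ ℚ.∣p+q∣≤∣p∣+∣q∣ (P ℚ.- Q) (expTerm p (suc n) ℚ.- expTerm q (suc n)) ⟩
      ℚ.∣ P ℚ.- Q ∣ ℚ.+ ℚ.∣ expTerm p (suc n) ℚ.- expTerm q (suc n) ∣
        ≤⟨ ℚ.+-mono-≤ (sum-lipschitz n) (term-lipschitz n) ⟩
      δ ℚ.* S n ℚ.+ δ ℚ.* T n
        ≡⟨ sym (ℚ.*-distribˡ-+ δ (S n) (T n)) ⟩
      δ ℚ.* (S n ℚ.+ T n) ∎
      where
      P = partialSum (expTerm p) (suc n)
      Q = partialSum (expTerm q) (suc n)

    lipschitz : ∀ n → ℚ.∣ partialSum (expTerm p) n ℚ.- partialSum (expTerm q) n ∣ ℚ.≤ δ ℚ.* G M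
    lipschitz zero    = *-nonNeg 0≤δ (S-bound 0)
    lipschitz (suc n) = ℚ.≤-trans (sum-lipschitz n) (ℚ.*-monoˡ-≤-nonNeg δ {{ℚ.nonNegative 0≤δ}} (S-bound n))

  E : ℚ → ℕ → ℚ
  E p = partialSum (expTerm p)

  exp-estimate : ∀ y z i j ε → ℚ.∣ y ∣ ℚ.≤ B → ℚ.∣ z ∣ ℚ.≤ B → ℚ.∣ z ℚ.- y ∣ ℚ.≤ ε → i ℕ.≤ j →
                 S j ℚ.- S i ℚ.≤ (1ℚ ℚ.+ 1ℚ) ℚ.* ε →
                 ℚ.∣ E z j ℚ.- E y i ∣ ℚ.≤ ((1ℚ ℚ.+ 1ℚ) ℚ.+ G M) ℚ.* ε
  exp-estimate y z i j ε y≤B z≤B dz≤ε i≤j ts = begin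
    ℚ.∣ E z j ℚ.- E y i ∣
      ≡⟨ cong ℚ.∣_∣ (solve 3 (λ a b c → a :- b := (a :- c) :+ (c :- b)) refl (E z j) (E y i) (E z i)) ⟩
    ℚ.∣ (E z j ℚ.- E z i) ℚ.+ (E z i ℚ.- E y i) ∣
      ≤⟨ ℚ.∣p+q∣≤∣p∣+∣q∣ (E z j ℚ.- E z i) (E z i ℚ.- E y i) ⟩
    ℚ.∣ E z j ℚ.- E z i ∣ ℚ.+ ℚ.∣ E z i ℚ.- E y i ∣
      ≤⟨ ℚ.+-mono-≤
           (ℚ.≤-trans (dominated (expTerm z) T (term≤T z z≤B) i≤j) ts)
           (ℚ.≤-trans (lipschitz z y z≤B y≤B i) (ℚ.*-monoʳ-≤-nonNeg (G M) {{ℚ.nonNegative (S-bound 0)}} dz≤ε)) ⟩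
    (1ℚ ℚ.+ 1ℚ) ℚ.* ε ℚ.+ ε ℚ.* G M
      ≡⟨ solve 2 (λ e g → (con 1ℚ :+ con 1ℚ) :* e :+ e :* g := ((con 1ℚ :+ con 1ℚ) :+ g) :* e) refl ε (G M) ⟩
    ((1ℚ ℚ.+ 1ℚ) ℚ.+ G M) ℚ.* ε ∎

  0<K : 0ℚ ℚ.< (1ℚ ℚ.+ 1ℚ) ℚ.+ G M
  0<K = ℚ.<-≤-trans (ℚ.positive⁻¹ (1ℚ ℚ.+ 1ℚ)) (p≤p+q (1ℚ ℚ.+ 1ℚ) (S-bound 0))

  exp-cauchy-bounded : ∀ s → Cauchy s → ∀ N₀ → (∀ n → N₀ ℕ.≤ n → ℚ.∣ s n ∣ ℚ.≤ B) → Cauchy (λ n → E (s n) n)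
  exp-cauchy-bounded s cs N₀ b = tails⇒cauchy (λ n → E (s n) n) ((1ℚ ℚ.+ 1ℚ) ℚ.+ G M) 0<K λ ε 0<ε →
    let N₁ , p = cs ε 0<ε
        N₂ , q = tail ε 0<ε
    in N₀ ℕ.⊔ (N₁ ℕ.⊔ N₂) , λ i j N≤i i≤j →
      let N₀≤i  = ℕ.m⊔n≤o⇒m≤o N₀ (N₁ ℕ.⊔ N₂) N≤i
          N₁₂≤i = ℕ.m⊔n≤o⇒n≤o N₀ (N₁ ℕ.⊔ N₂) N≤i
          N₁≤i  = ℕ.m⊔n≤o⇒m≤o N₁ N₂ N₁₂≤i
          N₂≤i  = ℕ.m⊔n≤o⇒n≤o N₁ N₂ N₁₂≤i
      in exp-estimate (s i) (s j) i j ε (b i N₀≤i) (b j (ℕ.≤-trans N₀≤i i≤j))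
           (p j i (ℕ.≤-trans N₁≤i i≤j) N₁≤i) i≤j (q i j N₂≤i i≤j)

abstract

  exp-cauchy : ∀ x → Cauchy (λ n → partialSum (expTerm (seq x n)) n)
  exp-cauchy x =
    let B , 0<B , N₀ , b = bounded (seq x) (cauchy x)
    in Exp.exp-cauchy-bounded B 0<B (seq x) (cauchy x) N₀ b

exp : ℝ → ℝ
exp x = mkℝ (λ n → partialSum (expTerm (seq x n)) n) (exp-cauchy x)

ln2Term : ℕ → ℚ
ln2Term k = (+ 1 ℚ./ suc k) ℚ.* ½ ^ℚ suc k

0≤½^ : ∀ k → 0ℚ ℚ.≤ ½ ^ℚ k
0≤½^ zero    = ℚ.<⇒≤ 0<1
0≤½^ (suc k) = *-nonNeg (ℚ.nonNegative⁻¹ ½) (0≤½^ k)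

abstract

  ln2-cauchy : Cauchy (partialSum ln2Term)
  ln2-cauchy = tails⇒cauchy (partialSum ln2Term) (1ℚ ℚ.+ 1ℚ) (ℚ.positive⁻¹ (1ℚ ℚ.+ 1ℚ)) λ ε 0<ε →
    let N , p = tail ε 0<ε
    in N , λ i j N≤i i≤j →
      ℚ.≤-trans (dominated ln2Term ln2Term (λ k → ℚ.≤-reflexive (ℚ.0≤p⇒∣p∣≡p (0≤t k))) i≤j) (p i j N≤i i≤j)
    where
    0≤t : ∀ k → 0ℚ ℚ.≤ ln2Term k
    0≤t k = *-nonNeg (0≤recip (suc k)) (0≤½^ (suc k))
    ratio : ∀ k → 0 ℕ.≤ k → ln2Term (suc k) ℚ.≤ ½ ℚ.* ln2Term k
    ratio k _ = ℚ.≤-trans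
      (ℚ.*-monoʳ-≤-nonNeg (½ ^ℚ suc (suc k)) {{ℚ.nonNegative (0≤½^ (suc (suc k)))}} (recip-anti k))
      (ℚ.≤-reflexive (solve 3 (λ a h p → a :* (h :* p) := h :* (a :* p)) refl (+ 1 ℚ./ suc k) ½ (½ ^ℚ suc k)))
    open RatioTest ln2Term 0≤t 0 ratio

-- ln 2 = -ln (1 - 1/2) = Σ_{k≥1} (1/k) (1/2)^k.
ln2 : ℝ
ln2 = mkℝ (partialSum ln2Term) ln2-cauchy

2^_ : ℝ → ℝ
2^ x = exp (x * ln2)

------------------------------------------------------------------------
-- Set functions

elements : ∀ {n} → Subset n → List (Fin n)
elements T = filter (_∈? T) (allFin _)

subsets : ∀ n → List (Subset n)
subsets zero    = [] ∷ []
subsets (suc n) = map (outside ∷_) (subsets n) ++ map (inside ∷_) (subsets n)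

record SetFunction (m : ℕ) : Set where
  field
    value      : Subset m → ℝ
    nonNeg     : ∀ T → 0ℝ ≤ value T
    value-of-∅ : value ⊥ ≈ 0ℝ

open SetFunction public

record IsCoverage {m} (f : Subset m → ℝ) : Set where
  field
    ∣U∣       : ℕ
    weight    : Fin ∣U∣ → ℝ
    weight≥0  : ∀ u → 0ℝ ≤ weight u
    A         : Fin m → Subset ∣U∣
    f≈        : ∀ T → f T ≈ sum (map weight (elements (⋃ (map A (elements T)))))

wCoefficient : ∀ {m} → (Subset m → ℝ) → Subset m → ℝ
wCoefficient {m} f S =
  sum (map (λ T → (- 1ℝ) ^ (∣ S ∩ T ∣ ℕ.+ 1) * f T)
           (filter (λ T → ≡-dec Bool._≟_ (S ∪ T) ⊤) (subsets m)))

-- "The W-distance of f is at least δ".  The sign of a real is not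
-- decidable, so the negative coefficients cannot be counted; instead one
-- exhibits a list of distinct non-empty sets with negative coefficient whose
-- length is at least the fraction δ of 2^m - 1.
record WDistanceAtLeast {m} (δ : ℝ) (f : Subset m → ℝ) : Set where
  field
    sets     : List (Subset m)
    distinct : Unique sets
    nonempty : All Nonempty sets
    negative : All (λ S → wCoefficient f S < 0ℝ) sets
    many     : δ * fromℕ (2 ℕ.^ m ℕ.∸ 1) ≤ fromℕ (length sets)

------------------------------------------------------------------------
-- Deterministic adaptive algorithms

-- The output true stands for Yes, false for No.
data DecisionTree (m : ℕ) : Set where
  output : Bool → DecisionTree m
  query  : Subset m → (ℝ → DecisionTree m) → DecisionTree m

run : ∀ {m} → DecisionTree m → (Subset m → ℝ) → Bool
run (output b)  f = b
run (query T k) f = run (k (f T)) f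

queryCount : ∀ {m} → DecisionTree m → (Subset m → ℝ) → ℕ
queryCount (output b)  f = 0
queryCount (query T k) f = suc (queryCount (k (f T)) f)

-- A partial equivalence relation: t ≈ᵗ t says that t depends only on the
-- real numbers returned by the oracle, not on the Cauchy sequences
-- representing them.
data _≈ᵗ_ {m : ℕ} : DecisionTree m → DecisionTree m → Set where
  output : ∀ b → output b ≈ᵗ output b
  query  : ∀ T {k k′} → (∀ {x y} → x ≈ y → k x ≈ᵗ k′ y) → query T k ≈ᵗ query T k′

------------------------------------------------------------------------
-- Probability spaces

_⟶_ : (ℕ → ℝ) → ℝ → Set
s ⟶ x = ∀ ε → 0ℚ ℚ.< ε → ∃ λ N → ∀ n → N ℕ.≤ n → s n ≤ x + fromℚ ε × x ≤ s n + fromℚ ε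

-- Events are Bool-valued; classically these are all subsets of Ω.  A
-- countable union need not be Bool-valued constructively, so the closure and
-- additivity axioms speak of events B that are the union of the A n.
-- P is total, but constrained only on measurable events.
record ProbabilitySpace : Set₁ where
  field
    Ω : Set

  Event : Set
  Event = Ω → Bool

  IsUnion : (ℕ → Event) → Event → Set
  IsUnion A B = ∀ ω → B ω ≡ true ⇔ (∃ λ n → A n ω ≡ true)

  Disjoint : (ℕ → Event) → Set
  Disjoint A = ∀ i j → i ≢ j → ∀ ω → A i ω ≡ true → A j ω ≡ false

  field
    Measurable   : Event → Set
    measurable-Ω : Measurable (λ _ → true)
    measurable-∁ : ∀ {A} → Measurable A → Measurable (not ∘ A)
    measurable-⋃ : ∀ {A B} → (∀ n → Measurable (A n)) → IsUnion A B → Measurable B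

    P            : Event → ℝ
    P≥0          : ∀ {A} → Measurable A → 0ℝ ≤ P A
    P-Ω          : P (λ _ → true) ≈ 1ℝ
    P-⋃          : ∀ {A B} → (∀ n → Measurable (A n)) → Disjoint A → IsUnion A B →
                   (λ n → sum (map (P ∘ A) (upTo n))) ⟶ P B

------------------------------------------------------------------------
-- Testers

-- All the randomness is drawn at once: each outcome ω determines a
-- deterministic algorithm.
record RandomizedAlgorithm (m : ℕ) : Set₁ where
  field
    space      : ProbabilitySpace

  open ProbabilitySpace space public

  field
    tree        : Ω → DecisionTree m
    extensional : ∀ ω → tree ω ≈ᵗ tree ω
    measurable  : ∀ (f : SetFunction m) → Measurable (λ ω → not (run (tree ω) (value f)))

  accepts rejects : SetFunction m → Event
  accepts f ω = run (tree ω) (value f)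
  rejects f ω = not (accepts f ω)

record IsTester {m} (δ : ℝ) (A : RandomizedAlgorithm m) : Set where
  open RandomizedAlgorithm A
  field
    completeness : ∀ f → IsCoverage (value f) → ∀ ω → accepts f ω ≡ true
    soundness    : ∀ f → WDistanceAtLeast δ (value f) → fromℚ (+ 2 ℚ./ 3) ≤ P (rejects f)

QueriesAtMost : ∀ {m} → RandomizedAlgorithm m → ℕ → Set
QueriesAtMost A q = ∀ f ω → queryCount (tree ω) (value f) ℕ.≤ q
  where open RandomizedAlgorithm A

{-# OPTIONS --safe #-}

-- A tester never rejects a coverage function, so it is enough to find one function f far from coverage
-- such that any few answers of f are also the answers of a coverage function.
--
-- Let f have W-coefficients w = -1 on the window a ≤ |S| ≤ m - a and large positive ones elsewhere, where
-- a is slightly below m/2; Chernoff's bound makes f far from coverage.  Let v be another weight such that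
-- D T = Σ_{S ∩ T = ∅} v S is bounded by K for all T, while v S ≥ 2^a on the window.  Resetting D to 0 at
-- ∅ and at the queried sets changes each v S by at most K per query, and f keeps its answers when the
-- modified v is added to w.  So fewer than about 2^a / K queries leave w + v non-negative.  Such a v is
-- ±(-2)^|S| times the polynomial in |S| of degree L = m - 2a which interpolates the alternating sign on
-- the window: D is then the binomial transform of an exponential with base -2 times a polynomial of low
-- degree, and cancellation keeps it below 2^(a - Ω(m)).
module Submission where

open import Defs
open import Data.Bool using (Bool; true; false; if_then_else_; not)
import Data.Bool.Properties as Bool
open import Data.Fin using (Fin; zero; suc)
open import Data.Fin.Subset as Subset using (Subset; inside; outside; ⊤; ⊥; _∪_; _∩_; ∣_∣; Nonempty; ∁; ⋃)
open import Data.Fin.Subset.Properties using (_∈?_; x∈p∪q⁻; x∈p∪q⁺; ∉⊥; ∣∁p∣≡n∸∣p∣; ∣p∣≤n)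
open import Data.Integer using (+_)
open import Data.List using (List; []; _∷_; _++_; map; filter; foldr; length; allFin; lookup; upTo; applyUpTo)
import Data.List.Properties as List
open import Data.List.Membership.Propositional using (_∈_)
open import Data.List.Membership.Propositional.Properties using (∈-filter⁺; ∈-filter⁻; ∈-allFin; ∈-map⁺; ∈-map⁻)
import Data.List.Relation.Unary.All as All
import Data.List.Relation.Unary.All.Properties as All
open import Data.List.Relation.Unary.Any using (here; there)
open import Data.List.Relation.Unary.AllPairs using ([]; _∷_)
open import Data.List.Relation.Unary.All using ([]; _∷_)
open import Data.List.Relation.Unary.Unique.Propositional using (Unique)
import Data.List.Relation.Unary.Unique.Propositional.Properties as Unique
open import Data.Nat as ℕ using (ℕ; zero; suc; z≤n; s≤s)
open import Data.Nat.DivMod using (_/_; _%_; m≡m%n+[m/n]*n; m%n<n; /-monoˡ-≤)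
import Data.Nat.Properties as ℕ
import Data.Nat.Tactic.RingSolver as ℕ-Ring
open import Data.Product using (_×_; _,_; ∃; proj₁; proj₂)
open import Data.Rational as ℚ using (ℚ; 0ℚ; 1ℚ; ½)
import Data.Rational.Properties as ℚ
open import Data.Rational.Solver using (module +-*-Solver)
open +-*-Solver using (solve; con; _:=_; _:+_; _:-_; _:*_; :-_)
open import Data.Sum using (_⊎_; inj₁; inj₂)
open import Data.Unit using (tt)
open import Data.Vec as Vec using ([]; _∷_; here; there)
import Data.Vec.Properties as Vec
open import Data.Vec.Properties using (≡-dec)
open import Function using (_∘_; mk⇔)
open import Relation.Binary.PropositionalEquality
open import Relation.Nullary using (¬_; Dec; does; yes; no; contradiction; _×-dec_)
open import Relation.Nullary.Decidable using (toWitness; toWitnessFalse; dec-true; dec-false)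
open import Relation.Unary using (Decidable)

-- The base -2 comes from the binomial theorem: Σ_j C(r,j) (-2)^j = (1 - 2)^r has modulus 1 although
-- the summands are exponentially large. The price is a sign alternating with |S|, while v has to be
-- positive on the whole window; the polynomial factor repairs the sign. Its degree must reach the
-- width of the window, and each degree costs a constant factor (64 here) in K. But the width must
-- be linear in m, as otherwise the sets outside the window are not an exponentially small fraction
-- of all sets. Both demands can be met because a width of about m/32 already suffices for
-- Chernoff's bound: with m = 2048p + ρ and a = 992p, K is at most 2^(640p + 7ρ) against 2^a =
-- 2^(992p), and each of the two tails has at most 2^(m - p) sets.
--
-- All functions constructed are rational-valued and given by constant Cauchy sequences, so f and
-- the coverage function return identical reals on the queried sets, not merely equivalent ones.

p≤∣p∣ : ∀ p → p ℚ.≤ ℚ.∣ p ∣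
p≤∣p∣ p with ℚ.≤-total 0ℚ p
... | inj₁ 0≤p = ℚ.≤-reflexive (sym (ℚ.0≤p⇒∣p∣≡p 0≤p))
... | inj₂ p≤0 = ℚ.≤-trans p≤0 (ℚ.0≤∣p∣ p)

-- Finite sums over lists and over the subsets of [m]

∑ : List ℚ → ℚ
∑ = foldr ℚ._+_ 0ℚ

∑-++ : ∀ xs ys → ∑ (xs ++ ys) ≡ ∑ xs ℚ.+ ∑ ys
∑-++ []       ys = sym (ℚ.+-identityˡ (∑ ys))
∑-++ (x ∷ xs) ys = trans (cong (x ℚ.+_) (∑-++ xs ys)) (sym (ℚ.+-assoc x (∑ xs) (∑ ys)))

∑-filter : ∀ {A : Set} {P : A → Set} (P? : Decidable P) (g : A → ℚ) xs →
           ∑ (map g (filter P? xs)) ≡ ∑ (map (λ x → if does (P? x) then g x else 0ℚ) xs)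
∑-filter P? g [] = refl
∑-filter P? g (x ∷ xs) with does (P? x)
... | true  = cong (g x ℚ.+_) (∑-filter P? g xs)
... | false = trans (∑-filter P? g xs) (sym (ℚ.+-identityˡ _))

-- Recursion on the first coordinate, so that `hit`, `avoid` and `mobius` unfold in step with the
-- sum.
Σˢ : ∀ {m} → (Subset m → ℚ) → ℚ
Σˢ {zero}  w = w []
Σˢ {suc m} w = Σˢ (w ∘ (outside ∷_)) ℚ.+ Σˢ (w ∘ (inside ∷_))

Σˢ-cong : ∀ {m} {w w′ : Subset m → ℚ} → w ≗ w′ → Σˢ w ≡ Σˢ w′
Σˢ-cong {zero}  h = h []
Σˢ-cong {suc m} h = cong₂ ℚ._+_ (Σˢ-cong (h ∘ (outside ∷_))) (Σˢ-cong (h ∘ (inside ∷_)))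

Σˢ-neg : ∀ {m} (w : Subset m → ℚ) → Σˢ (ℚ.-_ ∘ w) ≡ ℚ.- Σˢ w
Σˢ-neg {zero}  w = refl
Σˢ-neg {suc m} w = trans (cong₂ ℚ._+_ (Σˢ-neg (w ∘ (outside ∷_))) (Σˢ-neg (w ∘ (inside ∷_))))
  (sym (ℚ.neg-distrib-+ (Σˢ (w ∘ (outside ∷_))) (Σˢ (w ∘ (inside ∷_)))))

Σˢ-zero : ∀ {m} → Σˢ {m} (λ _ → 0ℚ) ≡ 0ℚ
Σˢ-zero {zero}  = refl
Σˢ-zero {suc m} = cong₂ ℚ._+_ (Σˢ-zero {m}) (Σˢ-zero {m})

∑-subsets : ∀ {m} (w : Subset m → ℚ) → ∑ (map w (subsets m)) ≡ Σˢ w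
∑-subsets {zero}  w = ℚ.+-identityʳ (w [])
∑-subsets {suc m} w = begin
  ∑ (map w (map (outside ∷_) (subsets m) ++ map (inside ∷_) (subsets m)))
    ≡⟨ cong ∑ (List.map-++ w (map (outside ∷_) (subsets m)) _) ⟩
  ∑ (map w (map (outside ∷_) (subsets m)) ++ map w (map (inside ∷_) (subsets m)))
    ≡⟨ ∑-++ (map w (map (outside ∷_) (subsets m))) _ ⟩
  ∑ (map w (map (outside ∷_) (subsets m))) ℚ.+ ∑ (map w (map (inside ∷_) (subsets m)))
    ≡⟨ cong₂ (λ xs ys → ∑ xs ℚ.+ ∑ ys) (List.map-∘ (subsets m)) (List.map-∘ (subsets m)) ⟨
  ∑ (map (w ∘ (outside ∷_)) (subsets m)) ℚ.+ ∑ (map (w ∘ (inside ∷_)) (subsets m))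
    ≡⟨ cong₂ ℚ._+_ (∑-subsets (w ∘ (outside ∷_))) (∑-subsets (w ∘ (inside ∷_))) ⟩
  Σˢ w ∎
  where open ≡-Reasoning

-- hit w T = Σ_{S ∩ T ≠ ∅} w S and avoid w T = Σ_{S ∩ T = ∅} w S.

hit : ∀ {m} → (Subset m → ℚ) → Subset m → ℚ
hit w []            = 0ℚ
hit w (outside ∷ T) = hit (w ∘ (outside ∷_)) T ℚ.+ hit (w ∘ (inside ∷_)) T
hit w (inside  ∷ T) = hit (w ∘ (outside ∷_)) T ℚ.+ Σˢ (w ∘ (inside ∷_))

avoid : ∀ {m} → (Subset m → ℚ) → Subset m → ℚ
avoid w []            = w []
avoid w (outside ∷ T) = avoid (w ∘ (outside ∷_)) T ℚ.+ avoid (w ∘ (inside ∷_)) T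
avoid w (inside  ∷ T) = avoid (w ∘ (outside ∷_)) T

avoid-cong : ∀ {m} {w w′ : Subset m → ℚ} → w ≗ w′ → avoid w ≗ avoid w′
avoid-cong h []            = h []
avoid-cong h (outside ∷ T) = cong₂ ℚ._+_ (avoid-cong (h ∘ (outside ∷_)) T) (avoid-cong (h ∘ (inside ∷_)) T)
avoid-cong h (inside  ∷ T) = avoid-cong (h ∘ (outside ∷_)) T

avoid-linear : ∀ {m} (v z : Subset m → ℚ) k T →
               avoid (λ S → v S ℚ.+ k ℚ.* z S) T ≡ avoid v T ℚ.+ k ℚ.* avoid z T
avoid-linear v z k []            = refl
avoid-linear v z k (outside ∷ T) = trans
  (cong₂ ℚ._+_ (avoid-linear (v ∘ (outside ∷_)) (z ∘ (outside ∷_)) k T) (avoid-linear (v ∘ (inside ∷_)) (z ∘ (inside ∷_)) k T))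
  (solve 5 (λ a b c d k → (a :+ k :* b) :+ (c :+ k :* d) := (a :+ c) :+ k :* (b :+ d)) refl
    (avoid (v ∘ (outside ∷_)) T) (avoid (z ∘ (outside ∷_)) T) (avoid (v ∘ (inside ∷_)) T) (avoid (z ∘ (inside ∷_)) T) k)
avoid-linear v z k (inside ∷ T)  = avoid-linear (v ∘ (outside ∷_)) (z ∘ (outside ∷_)) k T

avoid-zero : ∀ {m} (T : Subset m) → avoid (λ _ → 0ℚ) T ≡ 0ℚ
avoid-zero []            = refl
avoid-zero (outside ∷ T) = cong₂ ℚ._+_ (avoid-zero T) (avoid-zero T)
avoid-zero (inside ∷ T)  = avoid-zero T

avoid-⊥ : ∀ {m} (w : Subset m → ℚ) → avoid w ⊥ ≡ Σˢ w
avoid-⊥ {zero}  w = refl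
avoid-⊥ {suc m} w = cong₂ ℚ._+_ (avoid-⊥ (w ∘ (outside ∷_))) (avoid-⊥ (w ∘ (inside ∷_)))

hit-avoid : ∀ {m} (w : Subset m → ℚ) T → hit w T ≡ Σˢ w ℚ.- avoid w T
hit-avoid w []            = sym (ℚ.+-inverseʳ (w []))
hit-avoid w (outside ∷ T) = trans
  (cong₂ ℚ._+_ (hit-avoid (w ∘ (outside ∷_)) T) (hit-avoid (w ∘ (inside ∷_)) T))
  (solve 4 (λ a b c d → (a :- b) :+ (c :- d) := (a :+ c) :- (b :+ d)) refl
    (Σˢ (w ∘ (outside ∷_))) (avoid (w ∘ (outside ∷_)) T) (Σˢ (w ∘ (inside ∷_))) (avoid (w ∘ (inside ∷_)) T))
hit-avoid w (inside ∷ T)  = trans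
  (cong (ℚ._+ Σˢ (w ∘ (inside ∷_))) (hit-avoid (w ∘ (outside ∷_)) T))
  (solve 3 (λ a b c → (a :- b) :+ c := (a :+ c) :- b) refl
    (Σˢ (w ∘ (outside ∷_))) (avoid (w ∘ (outside ∷_)) T) (Σˢ (w ∘ (inside ∷_))))

hit-+ : ∀ {m} (v w : Subset m → ℚ) T → hit (λ S → v S ℚ.+ w S) T ≡ hit v T ℚ.+ hit w T
hit-+ v w T = begin
  hit (λ S → v S ℚ.+ w S) T
    ≡⟨ hit-avoid _ T ⟩
  Σˢ (λ S → v S ℚ.+ w S) ℚ.- avoid (λ S → v S ℚ.+ w S) T
    ≡⟨ cong (ℚ._- avoid (λ S → v S ℚ.+ w S) T) (avoid-⊥ (λ S → v S ℚ.+ w S)) ⟨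
  avoid (λ S → v S ℚ.+ w S) ⊥ ℚ.- avoid (λ S → v S ℚ.+ w S) T
    ≡⟨ cong₂ ℚ._-_ (additive ⊥) (additive T) ⟩
  (avoid v ⊥ ℚ.+ avoid w ⊥) ℚ.- (avoid v T ℚ.+ avoid w T)
    ≡⟨ cong₂ (λ x y → (x ℚ.+ y) ℚ.- (avoid v T ℚ.+ avoid w T)) (avoid-⊥ v) (avoid-⊥ w) ⟩
  (Σˢ v ℚ.+ Σˢ w) ℚ.- (avoid v T ℚ.+ avoid w T)
    ≡⟨ solve 4 (λ a b c d → (a :+ b) :- (c :+ d) := (a :- c) :+ (b :- d)) refl (Σˢ v) (Σˢ w) (avoid v T) (avoid w T) ⟩
  (Σˢ v ℚ.- avoid v T) ℚ.+ (Σˢ w ℚ.- avoid w T)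
    ≡⟨ cong₂ ℚ._+_ (hit-avoid v T) (hit-avoid w T) ⟨
  hit v T ℚ.+ hit w T ∎
  where
  open ≡-Reasoning
  additive : ∀ T → avoid (λ S → v S ℚ.+ w S) T ≡ avoid v T ℚ.+ avoid w T
  additive T = begin
    avoid (λ S → v S ℚ.+ w S) T          ≡⟨ avoid-cong (λ S → cong (v S ℚ.+_) (sym (ℚ.*-identityˡ (w S)))) T ⟩
    avoid (λ S → v S ℚ.+ 1ℚ ℚ.* w S) T   ≡⟨ avoid-linear v w 1ℚ T ⟩
    avoid v T ℚ.+ 1ℚ ℚ.* avoid w T       ≡⟨ cong (avoid v T ℚ.+_) (ℚ.*-identityˡ (avoid w T)) ⟩
    avoid v T ℚ.+ avoid w T              ∎

hit-⊥ : ∀ {m} (w : Subset m → ℚ) → hit w ⊥ ≡ 0ℚ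
hit-⊥ w = trans (hit-avoid w ⊥) (trans (cong (λ z → Σˢ w ℚ.- z) (avoid-⊥ w)) (ℚ.+-inverseʳ (Σˢ w)))

-- The inverse of avoid: mobius G S = Σ_{S ∪ T = [m]} (-1)^|S ∩ T| G T.

mobius : ∀ {m} → (Subset m → ℚ) → Subset m → ℚ
mobius G []            = G []
mobius G (outside ∷ S) = mobius (G ∘ (inside ∷_)) S
mobius G (inside  ∷ S) = mobius (G ∘ (outside ∷_)) S ℚ.- mobius (G ∘ (inside ∷_)) S

mobius-cong : ∀ {m} {G H : Subset m → ℚ} → G ≗ H → mobius G ≗ mobius H
mobius-cong h []            = h []
mobius-cong h (outside ∷ S) = mobius-cong (h ∘ (inside ∷_)) S
mobius-cong h (inside  ∷ S) = cong₂ ℚ._-_ (mobius-cong (h ∘ (outside ∷_)) S) (mobius-cong (h ∘ (inside ∷_)) S)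

mobius-+ : ∀ {m} (G H : Subset m → ℚ) S → mobius (λ T → G T ℚ.+ H T) S ≡ mobius G S ℚ.+ mobius H S
mobius-+ G H []            = refl
mobius-+ G H (outside ∷ S) = mobius-+ (G ∘ (inside ∷_)) (H ∘ (inside ∷_)) S
mobius-+ G H (inside  ∷ S) = trans
  (cong₂ ℚ._-_ (mobius-+ (G ∘ (outside ∷_)) (H ∘ (outside ∷_)) S) (mobius-+ (G ∘ (inside ∷_)) (H ∘ (inside ∷_)) S))
  (solve 4 (λ a b c d → (a :+ b) :- (c :+ d) := (a :- c) :+ (b :- d)) refl
    (mobius (G ∘ (outside ∷_)) S) (mobius (H ∘ (outside ∷_)) S) (mobius (G ∘ (inside ∷_)) S) (mobius (H ∘ (inside ∷_)) S))

mobius-neg : ∀ {m} (G : Subset m → ℚ) S → mobius (ℚ.-_ ∘ G) S ≡ ℚ.- mobius G S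
mobius-neg G []            = refl
mobius-neg G (outside ∷ S) = mobius-neg (G ∘ (inside ∷_)) S
mobius-neg G (inside  ∷ S) = trans
  (cong₂ ℚ._-_ (mobius-neg (G ∘ (outside ∷_)) S) (mobius-neg (G ∘ (inside ∷_)) S))
  (solve 2 (λ a b → (:- a) :- (:- b) := :- (a :- b)) refl (mobius (G ∘ (outside ∷_)) S) (mobius (G ∘ (inside ∷_)) S))

mobius-const : ∀ {m} k (S : Subset m) → Nonempty S → mobius (λ _ → k) S ≡ 0ℚ
mobius-const k (inside  ∷ S) _                          = ℚ.+-inverseʳ (mobius (λ _ → k) S)
mobius-const k (outside ∷ S) (suc i , there i∈S) = mobius-const k S (i , i∈S)

mobius-avoid : ∀ {m} (w : Subset m → ℚ) → mobius (avoid w) ≗ w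
mobius-avoid w []            = refl
mobius-avoid w (outside ∷ S) = mobius-avoid (w ∘ (outside ∷_)) S
mobius-avoid w (inside  ∷ S) = begin
  mobius (λ T → avoid w₀ T ℚ.+ avoid w₁ T) S ℚ.- mobius (avoid w₀) S
    ≡⟨ cong (ℚ._- mobius (avoid w₀) S) (mobius-+ (avoid w₀) (avoid w₁) S) ⟩
  (mobius (avoid w₀) S ℚ.+ mobius (avoid w₁) S) ℚ.- mobius (avoid w₀) S
    ≡⟨ solve 2 (λ a b → (a :+ b) :- a := b) refl (mobius (avoid w₀) S) (mobius (avoid w₁) S) ⟩
  mobius (avoid w₁) S
    ≡⟨ mobius-avoid w₁ S ⟩
  w₁ S ∎
  where
  open ≡-Reasoning
  w₀ = w ∘ (outside ∷_)
  w₁ = w ∘ (inside ∷_)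

-- `hit w` is a constant minus `avoid w`. The constant is annihilated because S is non-empty, and
-- `mobius` inverts `avoid`. The minus sign is absorbed later by the +1 in the exponent of the
-- W-coefficient.
mobius-hit : ∀ {m} (w : Subset m → ℚ) S → Nonempty S → mobius (hit w) S ≡ ℚ.- w S
mobius-hit w S ne = begin
  mobius (hit w) S                                            ≡⟨ mobius-cong (hit-avoid w) S ⟩
  mobius (λ T → Σˢ w ℚ.- avoid w T) S                         ≡⟨ mobius-+ (λ _ → Σˢ w) (ℚ.-_ ∘ avoid w) S ⟩
  mobius (λ _ → Σˢ w) S ℚ.+ mobius (ℚ.-_ ∘ avoid w) S         ≡⟨ cong₂ ℚ._+_ (mobius-const (Σˢ w) S ne) (mobius-neg (avoid w) S) ⟩
  0ℚ ℚ.+ ℚ.- mobius (avoid w) S                               ≡⟨ ℚ.+-identityˡ _ ⟩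
  ℚ.- mobius (avoid w) S                                      ≡⟨ cong ℚ.-_ (mobius-avoid w S) ⟩
  ℚ.- w S                                                     ∎
  where open ≡-Reasoning

-- W-coefficients as Möbius inversion

covers? : ∀ {m} (S T : Subset m) → Dec (S ∪ T ≡ ⊤)
covers? S T = ≡-dec Bool._≟_ (S ∪ T) ⊤

-- The covering condition becomes a zero value instead of a filter, so the sum runs over all T and
-- splits along the first coordinate. The W-coefficient has d = 1.
signed : ∀ {m} → ℕ → (Subset m → ℚ) → Subset m → Subset m → ℚ
signed d G S T = if does (covers? S T) then (ℚ.- 1ℚ) ^ℚ (∣ S ∩ T ∣ ℕ.+ d) ℚ.* G T else 0ℚ

-- If the first element is not in S, only sets T containing it can cover, as in the `outside` clause
-- of `mobius`. If it is in S, both kinds of T can cover, and those containing it gain a factor -1.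
Σˢ-signed : ∀ {m} d (G : Subset m → ℚ) S → Σˢ (signed d G S) ≡ (ℚ.- 1ℚ) ^ℚ d ℚ.* mobius G S
Σˢ-signed d G []            = refl
Σˢ-signed {suc m} d G (outside ∷ S) = trans
  (cong₂ ℚ._+_ (Σˢ-zero {m}) (Σˢ-signed d (G ∘ (inside ∷_)) S))
  (ℚ.+-identityˡ _)
Σˢ-signed d G (inside  ∷ S) = begin
  Σˢ (signed d (G ∘ (outside ∷_)) S) ℚ.+ Σˢ (λ T → signed d G (inside ∷ S) (inside ∷ T))
    ≡⟨ cong (Σˢ (signed d (G ∘ (outside ∷_)) S) ℚ.+_) (trans (Σˢ-cong flip) (Σˢ-neg (signed d (G ∘ (inside ∷_)) S))) ⟩
  Σˢ (signed d (G ∘ (outside ∷_)) S) ℚ.- Σˢ (signed d (G ∘ (inside ∷_)) S)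
    ≡⟨ cong₂ ℚ._-_ (Σˢ-signed d (G ∘ (outside ∷_)) S) (Σˢ-signed d (G ∘ (inside ∷_)) S) ⟩
  s ℚ.* mobius (G ∘ (outside ∷_)) S ℚ.- s ℚ.* mobius (G ∘ (inside ∷_)) S
    ≡⟨ solve 3 (λ s a b → s :* a :- s :* b := s :* (a :- b)) refl s (mobius (G ∘ (outside ∷_)) S) (mobius (G ∘ (inside ∷_)) S) ⟩
  s ℚ.* mobius G (inside ∷ S) ∎
  where
  open ≡-Reasoning
  s = (ℚ.- 1ℚ) ^ℚ d
  flip : ∀ T → signed d G (inside ∷ S) (inside ∷ T) ≡ ℚ.- signed d (G ∘ (inside ∷_)) S T
  flip T with does (covers? S T)
  ... | false = refl
  ... | true  = solve 2 (λ x g → (:- con 1ℚ :* x) :* g := :- (x :* g)) refl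
    ((ℚ.- 1ℚ) ^ℚ (∣ S ∩ T ∣ ℕ.+ d)) (G (inside ∷ T))

-- dual T₀ is the weight whose avoid-transform is the indicator function of T₀.

dual : ∀ {m} → Subset m → Subset m → ℚ
dual []             []            = 1ℚ
dual (outside ∷ T₀) (outside ∷ S) = 0ℚ
dual (outside ∷ T₀) (inside  ∷ S) = dual T₀ S
dual (inside  ∷ T₀) (outside ∷ S) = dual T₀ S
dual (inside  ∷ T₀) (inside  ∷ S) = ℚ.- dual T₀ S

∣dual∣≤1 : ∀ {m} (T₀ S : Subset m) → ℚ.∣ dual T₀ S ∣ ℚ.≤ 1ℚ
∣dual∣≤1 []             []            = ℚ.≤-refl
∣dual∣≤1 (outside ∷ T₀) (outside ∷ S) = ℚ.<⇒≤ 0<1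
∣dual∣≤1 (outside ∷ T₀) (inside  ∷ S) = ∣dual∣≤1 T₀ S
∣dual∣≤1 (inside  ∷ T₀) (outside ∷ S) = ∣dual∣≤1 T₀ S
∣dual∣≤1 (inside  ∷ T₀) (inside  ∷ S) = ℚ.≤-trans (ℚ.≤-reflexive (ℚ.∣-p∣≡∣p∣ (dual T₀ S))) (∣dual∣≤1 T₀ S)

avoid-dual-in-out : ∀ {m} (T₀ T : Subset m) → avoid (dual (inside ∷ T₀)) (outside ∷ T) ≡ 0ℚ
avoid-dual-in-out T₀ T = begin
  avoid (dual T₀) T ℚ.+ avoid (ℚ.-_ ∘ dual T₀) T
    ≡⟨ cong (avoid (dual T₀) T ℚ.+_) (avoid-cong (λ S → solve 1 (λ x → :- x := con 0ℚ :+ :- con 1ℚ :* x) refl (dual T₀ S)) T) ⟩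
  avoid (dual T₀) T ℚ.+ avoid (λ S → 0ℚ ℚ.+ ℚ.- 1ℚ ℚ.* dual T₀ S) T
    ≡⟨ cong (avoid (dual T₀) T ℚ.+_) (avoid-linear (λ _ → 0ℚ) (dual T₀) (ℚ.- 1ℚ) T) ⟩
  avoid (dual T₀) T ℚ.+ (avoid (λ _ → 0ℚ) T ℚ.+ ℚ.- 1ℚ ℚ.* avoid (dual T₀) T)
    ≡⟨ cong (λ z → avoid (dual T₀) T ℚ.+ (z ℚ.+ ℚ.- 1ℚ ℚ.* avoid (dual T₀) T)) (avoid-zero T) ⟩
  avoid (dual T₀) T ℚ.+ (0ℚ ℚ.+ ℚ.- 1ℚ ℚ.* avoid (dual T₀) T)
    ≡⟨ solve 1 (λ x → x :+ (con 0ℚ :+ :- con 1ℚ :* x) := con 0ℚ) refl (avoid (dual T₀) T) ⟩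
  0ℚ ∎
  where open ≡-Reasoning

avoid-dual-same : ∀ {m} (T : Subset m) → avoid (dual T) T ≡ 1ℚ
avoid-dual-same []            = refl
avoid-dual-same (outside ∷ T) = trans (cong₂ ℚ._+_ (avoid-zero T) (avoid-dual-same T)) (ℚ.+-identityˡ 1ℚ)
avoid-dual-same (inside  ∷ T) = avoid-dual-same T

avoid-dual-other : ∀ {m} (T₀ T : Subset m) → T₀ ≢ T → avoid (dual T₀) T ≡ 0ℚ
avoid-dual-other []             []            ≢ = contradiction refl ≢
avoid-dual-other (outside ∷ T₀) (outside ∷ T) ≢ =
  cong₂ ℚ._+_ (avoid-zero T) (avoid-dual-other T₀ T (≢ ∘ cong (outside ∷_)))
avoid-dual-other (outside ∷ T₀) (inside  ∷ T) ≢ = avoid-zero T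
avoid-dual-other (inside  ∷ T₀) (outside ∷ T) ≢ = avoid-dual-in-out T₀ T
avoid-dual-other (inside  ∷ T₀) (inside  ∷ T) ≢ = avoid-dual-other T₀ T (≢ ∘ cong (inside ∷_))

-- Resetting the avoid-transform at given sets

kill : ∀ {m} → (Subset m → ℚ) → List (Subset m) → Subset m → ℚ
kill v []       S = v S
-- The coefficient is the current value at T, not the original one; if T was reset before, it is 0,
-- so repeated queries do no harm.
kill v (T ∷ Ts) S = kill v Ts S ℚ.+ (ℚ.- avoid (kill v Ts) T) ℚ.* dual T S

avoid-kill-head : ∀ {m} (v : Subset m → ℚ) T Ts → avoid (kill v (T ∷ Ts)) T ≡ 0ℚ
avoid-kill-head v T Ts = begin
  avoid (kill v (T ∷ Ts)) T                     ≡⟨ avoid-linear (kill v Ts) (dual T) (ℚ.- x) T ⟩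
  x ℚ.+ (ℚ.- x) ℚ.* avoid (dual T) T            ≡⟨ cong (λ z → x ℚ.+ (ℚ.- x) ℚ.* z) (avoid-dual-same T) ⟩
  x ℚ.+ (ℚ.- x) ℚ.* 1ℚ                          ≡⟨ solve 1 (λ x → x :+ (:- x) :* con 1ℚ := con 0ℚ) refl x ⟩
  0ℚ                                            ∎
  where
  open ≡-Reasoning
  x = avoid (kill v Ts) T

avoid-kill-other : ∀ {m} (v : Subset m → ℚ) T₀ Ts T → T₀ ≢ T → avoid (kill v (T₀ ∷ Ts)) T ≡ avoid (kill v Ts) T
avoid-kill-other v T₀ Ts T ≢ = begin
  avoid (kill v (T₀ ∷ Ts)) T                    ≡⟨ avoid-linear (kill v Ts) (dual T₀) (ℚ.- x) T ⟩
  y ℚ.+ (ℚ.- x) ℚ.* avoid (dual T₀) T           ≡⟨ cong (λ z → y ℚ.+ (ℚ.- x) ℚ.* z) (avoid-dual-other T₀ T ≢) ⟩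
  y ℚ.+ (ℚ.- x) ℚ.* 0ℚ                          ≡⟨ solve 2 (λ x y → y :+ (:- x) :* con 0ℚ := y) refl x y ⟩
  y                                             ∎
  where
  open ≡-Reasoning
  x = avoid (kill v Ts) T₀
  y = avoid (kill v Ts) T

avoid-kill : ∀ {m} (v : Subset m → ℚ) Ts {T} → T ∈ Ts → avoid (kill v Ts) T ≡ 0ℚ
avoid-kill v (T₀ ∷ Ts) (here refl) = avoid-kill-head v T₀ Ts
avoid-kill v (T₀ ∷ Ts) {T} (there T∈) with ≡-dec Bool._≟_ T₀ T
... | yes refl = avoid-kill-head v T₀ Ts
... | no  ≢    = trans (avoid-kill-other v T₀ Ts T ≢) (avoid-kill v Ts T∈)

module _ {m} (v : Subset m → ℚ) {K : ℚ} (bound : ∀ T → ℚ.∣ avoid v T ∣ ℚ.≤ K) where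

  -- A reset puts 0 in one place and leaves all other values unchanged, so the bound K never
  -- deteriorates. This makes the total change of the weight linear in the number of resets.
  ∣avoid-kill∣≤ : ∀ Ts T → ℚ.∣ avoid (kill v Ts) T ∣ ℚ.≤ K
  ∣avoid-kill∣≤ []        T = bound T
  ∣avoid-kill∣≤ (T₀ ∷ Ts) T with ≡-dec Bool._≟_ T₀ T
  ... | yes refl = ℚ.≤-trans (ℚ.≤-reflexive (cong ℚ.∣_∣ (avoid-kill-head v T₀ Ts))) (ℚ.≤-trans (ℚ.0≤∣p∣ _) (bound T₀))
  ... | no  ≢    = ℚ.≤-trans (ℚ.≤-reflexive (cong ℚ.∣_∣ (avoid-kill-other v T₀ Ts T ≢))) (∣avoid-kill∣≤ Ts T)

  v≤kill+ : ∀ Ts S → v S ℚ.≤ kill v Ts S ℚ.+ ι (length Ts) ℚ.* K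
  v≤kill+ []       S = ℚ.≤-reflexive (solve 2 (λ x k → x := x :+ con 0ℚ :* k) refl (v S) K)
  v≤kill+ (T ∷ Ts) S = begin
    v S                                                     ≤⟨ v≤kill+ Ts S ⟩
    kill v Ts S ℚ.+ ι (length Ts) ℚ.* K                     ≡⟨ solve 4 (λ x y d z → x :+ z := (x :+ (:- y) :* d) :+ (y :* d :+ z)) refl (kill v Ts S) x (dual T S) (ι (length Ts) ℚ.* K) ⟩
    kill v (T ∷ Ts) S ℚ.+ (x ℚ.* dual T S ℚ.+ ι (length Ts) ℚ.* K)
                                                            ≤⟨ ℚ.+-monoʳ-≤ (kill v (T ∷ Ts) S) (ℚ.+-monoˡ-≤ (ι (length Ts) ℚ.* K) xd≤K) ⟩
    kill v (T ∷ Ts) S ℚ.+ (K ℚ.+ ι (length Ts) ℚ.* K)       ≡⟨ cong (kill v (T ∷ Ts) S ℚ.+_) (solve 2 (λ k l → k :+ l :* k := (con 1ℚ :+ l) :* k) refl K (ι (length Ts))) ⟩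
    kill v (T ∷ Ts) S ℚ.+ (1ℚ ℚ.+ ι (length Ts)) ℚ.* K      ≡⟨ cong (λ l → kill v (T ∷ Ts) S ℚ.+ l ℚ.* K) (ι-suc (length Ts)) ⟨
    kill v (T ∷ Ts) S ℚ.+ ι (suc (length Ts)) ℚ.* K         ∎
    where
    open ℚ.≤-Reasoning
    x = avoid (kill v Ts) T
    xd≤K : x ℚ.* dual T S ℚ.≤ K
    xd≤K = begin
      x ℚ.* dual T S                     ≤⟨ p≤∣p∣ _ ⟩
      ℚ.∣ x ℚ.* dual T S ∣               ≡⟨ ℚ.∣p*q∣≡∣p∣*∣q∣ x (dual T S) ⟩
      ℚ.∣ x ∣ ℚ.* ℚ.∣ dual T S ∣         ≤⟨ *-mono (ℚ.0≤∣p∣ x) (ℚ.<⇒≤ 0<1) (∣avoid-kill∣≤ Ts T) (∣dual∣≤1 T S) ⟩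
      K ℚ.* 1ℚ                           ≡⟨ ℚ.*-identityʳ K ⟩
      K                                  ∎

-- `hit` at T is the difference of `avoid` at ⊥ and at T, so ⊥ is reset together with the queried
-- sets.
hit-kill : ∀ {m} (v : Subset m → ℚ) Ts {T} → T ∈ Ts → hit (kill v (⊥ ∷ Ts)) T ≡ 0ℚ
hit-kill v Ts {T} T∈ = begin
  hit v′ T                        ≡⟨ hit-avoid v′ T ⟩
  Σˢ v′ ℚ.- avoid v′ T            ≡⟨ cong (ℚ._- avoid v′ T) (avoid-⊥ v′) ⟨
  avoid v′ ⊥ ℚ.- avoid v′ T       ≡⟨ cong₂ ℚ._-_ (avoid-kill v (⊥ ∷ Ts) (here refl)) (avoid-kill v (⊥ ∷ Ts) (there T∈)) ⟩
  0ℚ                              ∎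
  where
  open ≡-Reasoning
  v′ = kill v (⊥ ∷ Ts)

-- Powers in ℚ

0≤^ℚ : ∀ {p} → 0ℚ ℚ.≤ p → ∀ n → 0ℚ ℚ.≤ p ^ℚ n
0≤^ℚ 0≤p zero    = ℚ.<⇒≤ 0<1
0≤^ℚ 0≤p (suc n) = *-nonNeg 0≤p (0≤^ℚ 0≤p n)

1≤^ℚ : ∀ {p} → 1ℚ ℚ.≤ p → ∀ n → 1ℚ ℚ.≤ p ^ℚ n
1≤^ℚ 1≤p zero    = ℚ.≤-refl
1≤^ℚ 1≤p (suc n) = *-mono (ℚ.<⇒≤ 0<1) (ℚ.≤-trans (ℚ.<⇒≤ 0<1) (1≤^ℚ 1≤p n)) 1≤p (1≤^ℚ 1≤p n)

^ℚ-mono : ∀ {p q} → 0ℚ ℚ.≤ p → p ℚ.≤ q → ∀ n → p ^ℚ n ℚ.≤ q ^ℚ n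
^ℚ-mono 0≤p p≤q zero    = ℚ.≤-refl
^ℚ-mono 0≤p p≤q (suc n) = *-mono 0≤p (0≤^ℚ (ℚ.≤-trans 0≤p p≤q) n) p≤q (^ℚ-mono 0≤p p≤q n)

^ℚ-+ : ∀ p a b → p ^ℚ (a ℕ.+ b) ≡ p ^ℚ a ℚ.* p ^ℚ b
^ℚ-+ p zero    b = sym (ℚ.*-identityˡ (p ^ℚ b))
^ℚ-+ p (suc a) b = trans (cong (p ℚ.*_) (^ℚ-+ p a b)) (sym (ℚ.*-assoc p (p ^ℚ a) (p ^ℚ b)))

^ℚ-* : ∀ p a b → p ^ℚ (a ℕ.* b) ≡ (p ^ℚ b) ^ℚ a
^ℚ-* p zero    b = refl
^ℚ-* p (suc a) b = trans (^ℚ-+ p b (a ℕ.* b)) (cong (p ^ℚ b ℚ.*_) (^ℚ-* p a b))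

*-^ℚ : ∀ p q n → (p ℚ.* q) ^ℚ n ≡ p ^ℚ n ℚ.* q ^ℚ n
*-^ℚ p q zero    = refl
*-^ℚ p q (suc n) = trans (cong (p ℚ.* q ℚ.*_) (*-^ℚ p q n))
  (solve 4 (λ p q x y → (p :* q) :* (x :* y) := (p :* x) :* (q :* y)) refl p q (p ^ℚ n) (q ^ℚ n))

^ℚ-monoʳ : ∀ {p} → 1ℚ ℚ.≤ p → ∀ {a b} → a ℕ.≤ b → p ^ℚ a ℚ.≤ p ^ℚ b
^ℚ-monoʳ {p} 1≤p {b = b} z≤n       = 1≤^ℚ 1≤p b
^ℚ-monoʳ {p} 1≤p (s≤s a≤b) = ℚ.*-monoˡ-≤-nonNeg p {{ℚ.nonNegative (ℚ.≤-trans (ℚ.<⇒≤ 0<1) 1≤p)}} (^ℚ-monoʳ 1≤p a≤b)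

^ℚ-1 : ∀ n → 1ℚ ^ℚ n ≡ 1ℚ
^ℚ-1 zero    = refl
^ℚ-1 (suc n) = trans (ℚ.*-identityˡ _) (^ℚ-1 n)

ι-+ : ∀ a b → ι (a ℕ.+ b) ≡ ι a ℚ.+ ι b
ι-+ zero    b = sym (ℚ.+-identityˡ (ι b))
ι-+ (suc a) b = begin
  ι (suc (a ℕ.+ b))             ≡⟨ ι-suc (a ℕ.+ b) ⟩
  1ℚ ℚ.+ ι (a ℕ.+ b)            ≡⟨ cong (1ℚ ℚ.+_) (ι-+ a b) ⟩
  1ℚ ℚ.+ (ι a ℚ.+ ι b)          ≡⟨ ℚ.+-assoc 1ℚ (ι a) (ι b) ⟨
  (1ℚ ℚ.+ ι a) ℚ.+ ι b          ≡⟨ cong (ℚ._+ ι b) (ι-suc a) ⟨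
  ι (suc a) ℚ.+ ι b             ∎
  where open ≡-Reasoning

ι-* : ∀ a b → ι (a ℕ.* b) ≡ ι a ℚ.* ι b
ι-* zero    b = sym (ℚ.*-zeroˡ (ι b))
ι-* (suc a) b = begin
  ι (b ℕ.+ a ℕ.* b)             ≡⟨ ι-+ b (a ℕ.* b) ⟩
  ι b ℚ.+ ι (a ℕ.* b)           ≡⟨ cong (ι b ℚ.+_) (ι-* a b) ⟩
  ι b ℚ.+ ι a ℚ.* ι b           ≡⟨ solve 2 (λ a b → b :+ a :* b := (con 1ℚ :+ a) :* b) refl (ι a) (ι b) ⟩
  (1ℚ ℚ.+ ι a) ℚ.* ι b          ≡⟨ cong (ℚ._* ι b) (ι-suc a) ⟨
  ι (suc a) ℚ.* ι b             ∎
  where open ≡-Reasoning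

ι-^ : ∀ a n → ι (a ℕ.^ n) ≡ ι a ^ℚ n
ι-^ a zero    = refl
ι-^ a (suc n) = trans (ι-* a (a ℕ.^ n)) (cong (ι a ℚ.*_) (ι-^ a n))

0≤ι : ∀ n → 0ℚ ℚ.≤ ι n
0≤ι n = ι-mono {0} {n} z≤n

-- The alternating weight and its binomial transform

-- Σ_j C(r,j) V j, by Pascal's rule.
binomial : (ℕ → ℚ) → ℕ → ℚ
binomial V zero    = V 0
binomial V (suc r) = binomial V r ℚ.+ binomial (V ∘ suc) r

binomial-cong : ∀ {V W} → V ≗ W → binomial V ≗ binomial W
binomial-cong h zero    = h 0
binomial-cong h (suc r) = cong₂ ℚ._+_ (binomial-cong h r) (binomial-cong (h ∘ suc) r)

binomial-linear : ∀ V W x y r → binomial (λ j → x ℚ.* V j ℚ.+ y ℚ.* W j) r ≡ x ℚ.* binomial V r ℚ.+ y ℚ.* binomial W r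
binomial-linear V W x y zero    = refl
binomial-linear V W x y (suc r) = trans
  (cong₂ ℚ._+_ (binomial-linear V W x y r) (binomial-linear (V ∘ suc) (W ∘ suc) x y r))
  (solve 6 (λ x y a b c d → (x :* a :+ y :* b) :+ (x :* c :+ y :* d) := x :* (a :+ c) :+ y :* (b :+ d)) refl
    x y (binomial V r) (binomial W r) (binomial (V ∘ suc) r) (binomial (W ∘ suc) r))

-- The sets avoiding T are the subsets of its complement, and C(|∁ T|, j) of them have size j.
avoid-symmetric : ∀ {m} V (T : Subset m) → avoid (V ∘ ∣_∣) T ≡ binomial V ∣ ∁ T ∣
avoid-symmetric V []            = refl
avoid-symmetric V (outside ∷ T) = cong₂ ℚ._+_ (avoid-symmetric V T) (avoid-symmetric (V ∘ suc) T)
avoid-symmetric V (inside ∷ T)  = avoid-symmetric V T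

-- alternator L a j = Σ_{k≤L} (-2)^k C(j-a,k): the polynomial of degree at most L in j
-- which interpolates (-1)^(j-a) at j = a, …, a+L.

alternator : ℕ → ℕ → ℕ → ℚ
alternator zero    a       j       = 1ℚ
alternator (suc L) zero    zero    = 1ℚ
alternator (suc L) zero    (suc j) = alternator (suc L) zero j ℚ.- ι 2 ℚ.* alternator L zero j
alternator (suc L) (suc a) j       = alternator (suc L) a j ℚ.+ ι 2 ℚ.* alternator L (suc a) j

-- The difference rule C(x+1,k) - C(x,k) = C(x,k-1). It is a defining clause only at a = 0. The
-- clause that raises a is the same rule read backwards, which reaches negative j - a without
-- integers; hence the mutual induction with `alternator-shift`.
alternator-step : ∀ L a j → alternator (suc L) a (suc j) ≡ alternator (suc L) a j ℚ.- ι 2 ℚ.* alternator L a j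
alternator-shift : ∀ L a j → alternator L (suc a) (suc j) ≡ alternator L a j

alternator-step L       zero    j = refl
alternator-step zero    (suc a) j = trans (cong (ℚ._+ ι 2 ℚ.* 1ℚ) (alternator-step zero a j))
  (solve 1 (λ x → (x :- con (ι 2) :* con 1ℚ) :+ con (ι 2) :* con 1ℚ := (x :+ con (ι 2) :* con 1ℚ) :- con (ι 2) :* con 1ℚ) refl
    (alternator 1 a j))
alternator-step (suc L) (suc a) j = trans
  (cong₂ (λ x y → x ℚ.+ ι 2 ℚ.* y) (alternator-step (suc L) a j) (alternator-shift (suc L) a j))
  (solve 3 (λ x y z → (x :- con (ι 2) :* y) :+ con (ι 2) :* y := (x :+ con (ι 2) :* z) :- con (ι 2) :* z) refl
    (alternator (suc (suc L)) a j) (alternator (suc L) a j) (alternator (suc L) (suc a) j))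

alternator-shift zero    a j = refl
alternator-shift (suc L) a j = begin
  alternator (suc L) a (suc j) ℚ.+ ι 2 ℚ.* alternator L (suc a) (suc j)
    ≡⟨ cong₂ (λ x y → x ℚ.+ ι 2 ℚ.* y) (alternator-step L a j) (alternator-shift L a j) ⟩
  (alternator (suc L) a j ℚ.- ι 2 ℚ.* alternator L a j) ℚ.+ ι 2 ℚ.* alternator L a j
    ≡⟨ solve 2 (λ x y → (x :- con (ι 2) :* y) :+ con (ι 2) :* y := x) refl (alternator (suc L) a j) (alternator L a j) ⟩
  alternator (suc L) a j ∎
  where open ≡-Reasoning

-- For t ≤ L the sum over k is the complete binomial expansion of (1 - 2)^t.
alternator-window : ∀ L a t → t ℕ.≤ L → alternator L a (a ℕ.+ t) ≡ (ℚ.- 1ℚ) ^ℚ t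
alternator-window L       (suc a) t       t≤L       = trans (alternator-shift L a (a ℕ.+ t)) (alternator-window L a t t≤L)
alternator-window zero    zero    zero    t≤L       = refl
alternator-window (suc L) zero    zero    t≤L       = refl
alternator-window (suc L) zero    (suc t) (s≤s t≤L) = trans
  (cong₂ (λ x y → x ℚ.- ι 2 ℚ.* y) (alternator-window (suc L) zero t (ℕ.m≤n⇒m≤1+n t≤L)) (alternator-window L zero t t≤L))
  (solve 1 (λ x → x :- con (ι 2) :* x := (:- con 1ℚ) :* x) refl ((ℚ.- 1ℚ) ^ℚ t))

-2ℚ : ℚ
-2ℚ = ℚ.- ι 2

profile : ℕ → ℕ → ℕ → ℚ
profile L a j = -2ℚ ^ℚ j ℚ.* alternator L a j

transform : ℕ → ℕ → ℕ → ℚ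
transform L a r = binomial (profile L a) r

-- The cancellation behind the whole construction: passing from r to r + 1 multiplies by 1 + (-2) =
-- -1.
transform-zero : ∀ a r → transform 0 a (suc r) ≡ ℚ.- transform 0 a r
transform-zero a r = begin
  T ℚ.+ binomial (profile 0 a ∘ suc) r
    ≡⟨ cong (T ℚ.+_) (binomial-cong (λ j → solve 2 (λ p u → (con -2ℚ :* p) :* u := con -2ℚ :* (p :* u) :+ con 0ℚ :* (p :* u)) refl (-2ℚ ^ℚ j) 1ℚ) r) ⟩
  T ℚ.+ binomial (λ j → -2ℚ ℚ.* profile 0 a j ℚ.+ 0ℚ ℚ.* profile 0 a j) r
    ≡⟨ cong (T ℚ.+_) (binomial-linear (profile 0 a) (profile 0 a) -2ℚ 0ℚ r) ⟩
  T ℚ.+ (-2ℚ ℚ.* T ℚ.+ 0ℚ ℚ.* T)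
    ≡⟨ solve 1 (λ t → t :+ (con -2ℚ :* t :+ con 0ℚ :* t) := :- t) refl T ⟩
  ℚ.- T ∎
  where
  open ≡-Reasoning
  T = transform 0 a r

-- A shift of the argument changes the polynomial only by one of lower degree, and the base -2 turns
-- T - 2T into -T. Growth in r therefore comes from lower degrees alone.
transform-stepʳ : ∀ L r → transform (suc L) 0 (suc r) ≡ ℚ.- transform (suc L) 0 r ℚ.+ ι 4 ℚ.* transform L 0 r
transform-stepʳ L r = begin
  T ℚ.+ binomial (profile (suc L) 0 ∘ suc) r
    ≡⟨ cong (T ℚ.+_) (binomial-cong (λ j → solve 3 (λ p u v → (con -2ℚ :* p) :* (u :- con (ι 2) :* v) := con -2ℚ :* (p :* u) :+ con (ι 4) :* (p :* v)) refl
         (-2ℚ ^ℚ j) (alternator (suc L) 0 j) (alternator L 0 j)) r) ⟩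
  T ℚ.+ binomial (λ j → -2ℚ ℚ.* profile (suc L) 0 j ℚ.+ ι 4 ℚ.* profile L 0 j) r
    ≡⟨ cong (T ℚ.+_) (binomial-linear (profile (suc L) 0) (profile L 0) -2ℚ (ι 4) r) ⟩
  T ℚ.+ (-2ℚ ℚ.* T ℚ.+ ι 4 ℚ.* transform L 0 r)
    ≡⟨ solve 2 (λ t s → t :+ (con -2ℚ :* t :+ con (ι 4) :* s) := (:- t) :+ con (ι 4) :* s) refl T (transform L 0 r) ⟩
  ℚ.- T ℚ.+ ι 4 ℚ.* transform L 0 r ∎
  where
  open ≡-Reasoning
  T = transform (suc L) 0 r

-- Carries the estimate from a = 0, where the recurrence in r applies, to general a with r fixed.
transform-stepᵃ : ∀ L a r → transform (suc L) (suc a) r ≡ transform (suc L) a r ℚ.+ ι 2 ℚ.* transform L (suc a) r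
transform-stepᵃ L a r = begin
  binomial (profile (suc L) (suc a)) r
    ≡⟨ binomial-cong (λ j → solve 3 (λ p u v → p :* (u :+ con (ι 2) :* v) := con 1ℚ :* (p :* u) :+ con (ι 2) :* (p :* v)) refl
         (-2ℚ ^ℚ j) (alternator (suc L) a j) (alternator L (suc a) j)) r ⟩
  binomial (λ j → 1ℚ ℚ.* profile (suc L) a j ℚ.+ ι 2 ℚ.* profile L (suc a) j) r
    ≡⟨ binomial-linear (profile (suc L) a) (profile L (suc a)) 1ℚ (ι 2) r ⟩
  1ℚ ℚ.* transform (suc L) a r ℚ.+ ι 2 ℚ.* transform L (suc a) r
    ≡⟨ cong (ℚ._+ ι 2 ℚ.* transform L (suc a) r) (ℚ.*-identityˡ (transform (suc L) a r)) ⟩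
  transform (suc L) a r ℚ.+ ι 2 ℚ.* transform L (suc a) r ∎
  where open ≡-Reasoning

-- With base x for the degree L the rates are x/(x-2) and 1 + 4/x. A larger x brings them closer to
-- 1 but makes each degree dearer; x = 64 leaves the product well below 2^a when L is near m/32.
γᵃ γʳ : ℚ
γᵃ = + 32 ℚ./ 31
γʳ = + 17 ℚ./ 16

1≤γᵃ : 1ℚ ℚ.≤ γᵃ
1≤γᵃ = toWitness {a? = 1ℚ ℚ.≤? γᵃ} tt

1≤γʳ : 1ℚ ℚ.≤ γʳ
1≤γʳ = toWitness {a? = 1ℚ ℚ.≤? γʳ} tt

-- The rates 64, γᵃ, γʳ solve 64 γᵃ = 64 + 2 γᵃ and 64 γʳ = 64 + 4, which turns the two recurrences into this estimate.
∣transform∣≤ : ∀ L a r → ℚ.∣ transform L a r ∣ ℚ.≤ (ι 64 ^ℚ L ℚ.* γᵃ ^ℚ a) ℚ.* γʳ ^ℚ r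
∣transform∣≤ zero a r = ℚ.≤-trans (ℚ.≤-reflexive (∣T∣≡1 r))
  (*-mono (ℚ.<⇒≤ 0<1) (ℚ.≤-trans (ℚ.<⇒≤ 0<1) (1≤^ℚ 1≤γʳ r))
    (ℚ.≤-trans (1≤^ℚ 1≤γᵃ a) (ℚ.≤-reflexive (sym (ℚ.*-identityˡ _)))) (1≤^ℚ 1≤γʳ r))
  where
  ∣T∣≡1 : ∀ r → ℚ.∣ transform 0 a r ∣ ≡ 1ℚ
  ∣T∣≡1 zero    = refl
  ∣T∣≡1 (suc r) = trans (cong ℚ.∣_∣ (transform-zero a r)) (trans (ℚ.∣-p∣≡∣p∣ (transform 0 a r)) (∣T∣≡1 r))
∣transform∣≤ (suc L) zero zero = begin
  1ℚ                                          ≤⟨ 1≤^ℚ (ι-mono {1} {64} (s≤s z≤n)) (suc L) ⟩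
  ι 64 ^ℚ suc L                               ≡⟨ solve 1 (λ x → x := (x :* con 1ℚ) :* con 1ℚ) refl (ι 64 ^ℚ suc L) ⟩
  (ι 64 ^ℚ suc L ℚ.* 1ℚ) ℚ.* 1ℚ               ∎
  where open ℚ.≤-Reasoning
∣transform∣≤ (suc L) zero (suc r) = begin
  ℚ.∣ transform (suc L) 0 (suc r) ∣
    ≡⟨ cong ℚ.∣_∣ (transform-stepʳ L r) ⟩
  ℚ.∣ ℚ.- transform (suc L) 0 r ℚ.+ ι 4 ℚ.* transform L 0 r ∣
    ≤⟨ ℚ.∣p+q∣≤∣p∣+∣q∣ (ℚ.- transform (suc L) 0 r) (ι 4 ℚ.* transform L 0 r) ⟩
  ℚ.∣ ℚ.- transform (suc L) 0 r ∣ ℚ.+ ℚ.∣ ι 4 ℚ.* transform L 0 r ∣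
    ≡⟨ cong₂ ℚ._+_ (ℚ.∣-p∣≡∣p∣ (transform (suc L) 0 r)) (ℚ.∣p*q∣≡∣p∣*∣q∣ (ι 4) (transform L 0 r)) ⟩
  ℚ.∣ transform (suc L) 0 r ∣ ℚ.+ ι 4 ℚ.* ℚ.∣ transform L 0 r ∣
    ≤⟨ ℚ.+-mono-≤ (∣transform∣≤ (suc L) 0 r) (ℚ.*-monoˡ-≤-nonNeg (ι 4) (∣transform∣≤ L 0 r)) ⟩
  ((ι 64 ℚ.* ι 64 ^ℚ L) ℚ.* 1ℚ) ℚ.* γʳ ^ℚ r ℚ.+ ι 4 ℚ.* ((ι 64 ^ℚ L ℚ.* 1ℚ) ℚ.* γʳ ^ℚ r)
    ≡⟨ solve 2 (λ x w → ((con (ι 64) :* x) :* con 1ℚ) :* w :+ con (ι 4) :* ((x :* con 1ℚ) :* w) := ((con (ι 64) :* x) :* con 1ℚ) :* (con γʳ :* w)) refl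
         (ι 64 ^ℚ L) (γʳ ^ℚ r) ⟩
  ((ι 64 ℚ.* ι 64 ^ℚ L) ℚ.* 1ℚ) ℚ.* (γʳ ℚ.* γʳ ^ℚ r) ∎
  where open ℚ.≤-Reasoning
∣transform∣≤ (suc L) (suc a) r = begin
  ℚ.∣ transform (suc L) (suc a) r ∣
    ≡⟨ cong ℚ.∣_∣ (transform-stepᵃ L a r) ⟩
  ℚ.∣ transform (suc L) a r ℚ.+ ι 2 ℚ.* transform L (suc a) r ∣
    ≤⟨ ℚ.∣p+q∣≤∣p∣+∣q∣ (transform (suc L) a r) (ι 2 ℚ.* transform L (suc a) r) ⟩
  ℚ.∣ transform (suc L) a r ∣ ℚ.+ ℚ.∣ ι 2 ℚ.* transform L (suc a) r ∣
    ≡⟨ cong (ℚ.∣ transform (suc L) a r ∣ ℚ.+_) (ℚ.∣p*q∣≡∣p∣*∣q∣ (ι 2) (transform L (suc a) r)) ⟩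
  ℚ.∣ transform (suc L) a r ∣ ℚ.+ ι 2 ℚ.* ℚ.∣ transform L (suc a) r ∣
    ≤⟨ ℚ.+-mono-≤ (∣transform∣≤ (suc L) a r) (ℚ.*-monoˡ-≤-nonNeg (ι 2) (∣transform∣≤ L (suc a) r)) ⟩
  ((ι 64 ℚ.* ι 64 ^ℚ L) ℚ.* γᵃ ^ℚ a) ℚ.* γʳ ^ℚ r ℚ.+ ι 2 ℚ.* ((ι 64 ^ℚ L ℚ.* (γᵃ ℚ.* γᵃ ^ℚ a)) ℚ.* γʳ ^ℚ r)
    ≡⟨ solve 3 (λ x v w → ((con (ι 64) :* x) :* v) :* w :+ con (ι 2) :* ((x :* (con γᵃ :* v)) :* w) := ((con (ι 64) :* x) :* (con γᵃ :* v)) :* w) refl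
         (ι 64 ^ℚ L) (γᵃ ^ℚ a) (γʳ ^ℚ r) ⟩
  ((ι 64 ℚ.* ι 64 ^ℚ L) ℚ.* (γᵃ ℚ.* γᵃ ^ℚ a)) ℚ.* γʳ ^ℚ r ∎
  where open ℚ.≤-Reasoning

-- Cauchy products

convolution : (ℕ → ℚ) → (ℕ → ℚ) → ℕ → ℚ
convolution a b zero    = a 0 ℚ.* b 0
convolution a b (suc n) = a 0 ℚ.* b (suc n) ℚ.+ convolution (a ∘ suc) b n

convolution-cong : ∀ {a a′ b b′} → a ≗ a′ → b ≗ b′ → convolution a b ≗ convolution a′ b′
convolution-cong h k zero    = cong₂ ℚ._*_ (h 0) (k 0)
convolution-cong h k (suc n) = cong₂ ℚ._+_ (cong₂ ℚ._*_ (h 0) (k (suc n))) (convolution-cong (h ∘ suc) k n)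

convolution-scaleˡ : ∀ x a b n → convolution (λ i → x ℚ.* a i) b n ≡ x ℚ.* convolution a b n
convolution-scaleˡ x a b zero    = ℚ.*-assoc x (a 0) (b 0)
convolution-scaleˡ x a b (suc n) = trans (cong (x ℚ.* a 0 ℚ.* b (suc n) ℚ.+_) (convolution-scaleˡ x (a ∘ suc) b n))
  (solve 4 (λ x a b c → (x :* a) :* b :+ x :* c := x :* (a :* b :+ c)) refl x (a 0) (b (suc n)) (convolution (a ∘ suc) b n))

convolution-scaleʳ : ∀ x a b n → convolution a (λ i → x ℚ.* b i) n ≡ x ℚ.* convolution a b n
convolution-scaleʳ x a b zero    = solve 3 (λ x a b → a :* (x :* b) := x :* (a :* b)) refl x (a 0) (b 0)
convolution-scaleʳ x a b (suc n) = trans (cong (a 0 ℚ.* (x ℚ.* b (suc n)) ℚ.+_) (convolution-scaleʳ x (a ∘ suc) b n))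
  (solve 4 (λ x a b c → a :* (x :* b) :+ x :* c := x :* (a :* b :+ c)) refl x (a 0) (b (suc n)) (convolution (a ∘ suc) b n))

convolution-shiftˡ : ∀ a b n → a 0 ≡ 0ℚ → convolution a b (suc n) ≡ convolution (a ∘ suc) b n
convolution-shiftˡ a b n a₀≡0 = trans (cong (λ x → x ℚ.* b (suc n) ℚ.+ convolution (a ∘ suc) b n) a₀≡0)
  (solve 2 (λ b c → con 0ℚ :* b :+ c := c) refl (b (suc n)) (convolution (a ∘ suc) b n))

convolution-shiftʳ : ∀ a b n → b 0 ≡ 0ℚ → convolution a b (suc n) ≡ convolution a (b ∘ suc) n
convolution-shiftʳ a b zero    b₀≡0 = trans (cong (λ x → a 0 ℚ.* b 1 ℚ.+ a 1 ℚ.* x) b₀≡0)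
  (solve 2 (λ a b → b :+ a :* con 0ℚ := b) refl (a 1) (a 0 ℚ.* b 1))
convolution-shiftʳ a b (suc n) b₀≡0 = cong (a 0 ℚ.* b (suc (suc n)) ℚ.+_) (convolution-shiftʳ (a ∘ suc) b n b₀≡0)

-- The product rule for the operator z d/dz on power series. The offset s makes the induction work:
-- dropping the first term of a raises the index, and hence s, by 1.
convolution-Leibniz : ∀ s a b n →
  convolution (λ i → (s ℚ.+ ι i) ℚ.* a i) b n ℚ.+ convolution a (λ i → ι i ℚ.* b i) n ≡ (s ℚ.+ ι n) ℚ.* convolution a b n
convolution-Leibniz s a b zero    = solve 3 (λ s a b → (s :+ con 0ℚ) :* a :* b :+ a :* (con 0ℚ :* b) := (s :+ con 0ℚ) :* (a :* b)) refl s (a 0) (b 0)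
convolution-Leibniz s a b (suc n) = begin
  ((s ℚ.+ 0ℚ) ℚ.* a 0 ℚ.* b (suc n) ℚ.+ convolution (λ i → (s ℚ.+ ι (suc i)) ℚ.* a (suc i)) b n) ℚ.+ (a 0 ℚ.* (ι (suc n) ℚ.* b (suc n)) ℚ.+ c₂)
    ≡⟨ cong₂ (λ x y → ((s ℚ.+ 0ℚ) ℚ.* a 0 ℚ.* b (suc n) ℚ.+ x) ℚ.+ (a 0 ℚ.* (y ℚ.* b (suc n)) ℚ.+ c₂))
         (convolution-cong (λ i → cong (ℚ._* a (suc i)) (trans (cong (s ℚ.+_) (ι-suc i)) (sym (ℚ.+-assoc s 1ℚ (ι i))))) (λ _ → refl) n)
         (ι-suc n) ⟩
  ((s ℚ.+ 0ℚ) ℚ.* a 0 ℚ.* b (suc n) ℚ.+ c₁) ℚ.+ (a 0 ℚ.* ((1ℚ ℚ.+ ι n) ℚ.* b (suc n)) ℚ.+ c₂)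
    ≡⟨ solve 6 (λ s a b n c d → ((s :+ con 0ℚ) :* a :* b :+ c) :+ (a :* ((con 1ℚ :+ n) :* b) :+ d) := (s :+ (con 1ℚ :+ n)) :* (a :* b) :+ (c :+ d)) refl
         s (a 0) (b (suc n)) (ι n) c₁ c₂ ⟩
  (s ℚ.+ (1ℚ ℚ.+ ι n)) ℚ.* (a 0 ℚ.* b (suc n)) ℚ.+ (c₁ ℚ.+ c₂)
    ≡⟨ cong ((s ℚ.+ (1ℚ ℚ.+ ι n)) ℚ.* (a 0 ℚ.* b (suc n)) ℚ.+_) (convolution-Leibniz (s ℚ.+ 1ℚ) (a ∘ suc) b n) ⟩
  (s ℚ.+ (1ℚ ℚ.+ ι n)) ℚ.* (a 0 ℚ.* b (suc n)) ℚ.+ (s ℚ.+ 1ℚ ℚ.+ ι n) ℚ.* c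
    ≡⟨ solve 4 (λ s n x c → (s :+ (con 1ℚ :+ n)) :* x :+ ((s :+ con 1ℚ) :+ n) :* c := (s :+ (con 1ℚ :+ n)) :* (x :+ c)) refl s (ι n) (a 0 ℚ.* b (suc n)) c ⟩
  (s ℚ.+ (1ℚ ℚ.+ ι n)) ℚ.* (a 0 ℚ.* b (suc n) ℚ.+ c)
    ≡⟨ cong (λ x → (s ℚ.+ x) ℚ.* (a 0 ℚ.* b (suc n) ℚ.+ c)) (ι-suc n) ⟨
  (s ℚ.+ ι (suc n)) ℚ.* convolution a b (suc n) ∎
  where
  open ≡-Reasoning
  c  = convolution (a ∘ suc) b n
  c₁ = convolution (λ i → ((s ℚ.+ 1ℚ) ℚ.+ ι i) ℚ.* a (suc i)) b n
  c₂ = convolution (a ∘ suc) (λ i → ι i ℚ.* b i) n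

ι-suc-cancel : ∀ n {x y} → ι (suc n) ℚ.* x ≡ ι (suc n) ℚ.* y → x ≡ y
ι-suc-cancel n {x} {y} eq = begin
  x                                               ≡⟨ ℚ.*-identityˡ x ⟨
  1ℚ ℚ.* x                                        ≡⟨ cong (ℚ._* x) (recip-inverse n) ⟨
  (+ 1 ℚ./ suc n) ℚ.* ι (suc n) ℚ.* x             ≡⟨ ℚ.*-assoc (+ 1 ℚ./ suc n) (ι (suc n)) x ⟩
  (+ 1 ℚ./ suc n) ℚ.* (ι (suc n) ℚ.* x)           ≡⟨ cong ((+ 1 ℚ./ suc n) ℚ.*_) eq ⟩
  (+ 1 ℚ./ suc n) ℚ.* (ι (suc n) ℚ.* y)           ≡⟨ ℚ.*-assoc (+ 1 ℚ./ suc n) (ι (suc n)) y ⟨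
  (+ 1 ℚ./ suc n) ℚ.* ι (suc n) ℚ.* y             ≡⟨ cong (ℚ._* y) (recip-inverse n) ⟩
  1ℚ ℚ.* y                                        ≡⟨ ℚ.*-identityˡ y ⟩
  y                                               ∎
  where open ≡-Reasoning

expTerm-absorb : ∀ x k → ι (suc k) ℚ.* expTerm x (suc k) ≡ x ℚ.* expTerm x k
expTerm-absorb x k = begin
  ι (suc k) ℚ.* expTerm x (suc k)                                    ≡⟨ cong (ι (suc k) ℚ.*_) (expTerm-suc x k) ⟩
  ι (suc k) ℚ.* (expTerm x k ℚ.* (x ℚ.* (+ 1 ℚ./ suc k)))            ≡⟨ solve 4 (λ i t x c → i :* (t :* (x :* c)) := (c :* i) :* (x :* t)) refl (ι (suc k)) (expTerm x k) x (+ 1 ℚ./ suc k) ⟩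
  (+ 1 ℚ./ suc k) ℚ.* ι (suc k) ℚ.* (x ℚ.* expTerm x k)              ≡⟨ cong (ℚ._* (x ℚ.* expTerm x k)) (recip-inverse k) ⟩
  1ℚ ℚ.* (x ℚ.* expTerm x k)                                         ≡⟨ ℚ.*-identityˡ _ ⟩
  x ℚ.* expTerm x k                                                  ∎
  where open ≡-Reasoning

-- Both sides satisfy (n+1) c(n+1) = (x+y) c(n), the coefficient form of the differential equation
-- of exp((x+y)z); the product rule gives it for the left side.
convolution-exp : ∀ x y n → convolution (expTerm x) (expTerm y) n ≡ expTerm (x ℚ.+ y) n
convolution-exp x y zero    = refl
convolution-exp x y (suc n) = ι-suc-cancel n (begin
  ι (suc n) ℚ.* convolution a b (suc n)
    ≡⟨ cong (ℚ._* convolution a b (suc n)) (ℚ.+-identityˡ (ι (suc n))) ⟨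
  (0ℚ ℚ.+ ι (suc n)) ℚ.* convolution a b (suc n)
    ≡⟨ convolution-Leibniz 0ℚ a b (suc n) ⟨
  convolution (λ i → (0ℚ ℚ.+ ι i) ℚ.* a i) b (suc n) ℚ.+ convolution a (λ i → ι i ℚ.* b i) (suc n)
    ≡⟨ cong₂ ℚ._+_ (convolution-shiftˡ (λ i → (0ℚ ℚ.+ ι i) ℚ.* a i) b n (ℚ.*-zeroˡ (a 0))) (convolution-shiftʳ a (λ i → ι i ℚ.* b i) n (ℚ.*-zeroˡ (b 0))) ⟩
  convolution (λ i → (0ℚ ℚ.+ ι (suc i)) ℚ.* a (suc i)) b n ℚ.+ convolution a (λ i → ι (suc i) ℚ.* b (suc i)) n
    ≡⟨ cong₂ ℚ._+_
         (convolution-cong {b = b} (λ i → trans (cong (ℚ._* a (suc i)) (ℚ.+-identityˡ (ι (suc i)))) (expTerm-absorb x i)) (λ _ → refl) n)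
         (convolution-cong {a} (λ _ → refl) (expTerm-absorb y) n) ⟩
  convolution (λ i → x ℚ.* a i) b n ℚ.+ convolution a (λ i → y ℚ.* b i) n
    ≡⟨ cong₂ ℚ._+_ (convolution-scaleˡ x a b n) (convolution-scaleʳ y a b n) ⟩
  x ℚ.* convolution a b n ℚ.+ y ℚ.* convolution a b n
    ≡⟨ ℚ.*-distribʳ-+ (convolution a b n) x y ⟨
  (x ℚ.+ y) ℚ.* convolution a b n
    ≡⟨ cong ((x ℚ.+ y) ℚ.*_) (convolution-exp x y n) ⟩
  (x ℚ.+ y) ℚ.* expTerm (x ℚ.+ y) n
    ≡⟨ expTerm-absorb (x ℚ.+ y) n ⟨
  ι (suc n) ℚ.* expTerm (x ℚ.+ y) (suc n) ∎)
  where
  open ≡-Reasoning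
  a = expTerm x
  b = expTerm y

-- Partial sums of series and of their Cauchy products

partialSum-cong : ∀ {t u} → t ≗ u → partialSum t ≗ partialSum u
partialSum-cong h zero    = refl
partialSum-cong h (suc n) = cong₂ ℚ._+_ (partialSum-cong h n) (h n)

partialSum-suc : ∀ t n → partialSum t (suc n) ≡ t 0 ℚ.+ partialSum (t ∘ suc) n
partialSum-suc t zero    = ℚ.+-comm 0ℚ (t 0)
partialSum-suc t (suc n) = trans (cong (ℚ._+ t (suc n)) (partialSum-suc t n)) (ℚ.+-assoc (t 0) (partialSum (t ∘ suc) n) (t (suc n)))

partialSum-mono : ∀ t → (∀ k → 0ℚ ℚ.≤ t k) → ∀ {i j} → i ℕ.≤ j → partialSum t i ℚ.≤ partialSum t j
partialSum-mono t 0≤t {i} {j} i≤j = subst (λ n → partialSum t i ℚ.≤ partialSum t n) (ℕ.m∸n+n≡m i≤j) (go (j ℕ.∸ i))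
  where
  go : ∀ d → partialSum t i ℚ.≤ partialSum t (d ℕ.+ i)
  go zero    = ℚ.≤-refl
  go (suc d) = ℚ.≤-trans (go d) (p≤p+q (partialSum t (d ℕ.+ i)) (0≤t (d ℕ.+ i)))

partialSum-convolution : ∀ a b n →
  partialSum (convolution a b) (suc n) ≡ a 0 ℚ.* partialSum b (suc n) ℚ.+ partialSum (convolution (a ∘ suc) b) n
partialSum-convolution a b zero    = solve 2 (λ a b → con 0ℚ :+ a :* b := a :* (con 0ℚ :+ b) :+ con 0ℚ) refl (a 0) (b 0)
partialSum-convolution a b (suc n) = trans (cong (ℚ._+ convolution a b (suc n)) (partialSum-convolution a b n))
  (solve 5 (λ a B s b c → (a :* B :+ s) :+ (a :* b :+ c) := a :* (B :+ b) :+ (s :+ c)) refl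
    (a 0) (partialSum b (suc n)) (partialSum (convolution (a ∘ suc) b) n) (b (suc n)) (convolution (a ∘ suc) b n))

module _ (b β : ℕ → ℚ) (b≤β : ∀ k → ℚ.∣ b k ∣ ℚ.≤ β k) where

  private
    B  = partialSum b
    B° = partialSum β

  -- The remainder is the sum of the a i * b j with i < n, j < M and i + j ≥ n, so the triangle
  -- inequality bounds it by the same remainder for the majorants.
  product-remainder : ∀ a α → (∀ k → ℚ.∣ a k ∣ ℚ.≤ α k) → ∀ {n M} → n ℕ.≤ M →
    ℚ.∣ partialSum a n ℚ.* B M ℚ.- partialSum (convolution a b) n ∣ ℚ.≤
    partialSum α n ℚ.* B° M ℚ.- partialSum (convolution α β) n
  product-remainder a α a≤α {zero}  {M} n≤M = ℚ.≤-reflexive (trans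
    (cong ℚ.∣_∣ (solve 1 (λ x → con 0ℚ :* x :- con 0ℚ := con 0ℚ) refl (B M)))
    (solve 1 (λ x → con 0ℚ := con 0ℚ :* x :- con 0ℚ) refl (B° M)))
  product-remainder a α a≤α {suc n} {M} n<M = begin
    ℚ.∣ partialSum a (suc n) ℚ.* B M ℚ.- partialSum (convolution a b) (suc n) ∣
      ≡⟨ cong ℚ.∣_∣ (split a b) ⟩
    ℚ.∣ a 0 ℚ.* (B M ℚ.- B (suc n)) ℚ.+ X ∣
      ≤⟨ ℚ.∣p+q∣≤∣p∣+∣q∣ (a 0 ℚ.* (B M ℚ.- B (suc n))) X ⟩
    ℚ.∣ a 0 ℚ.* (B M ℚ.- B (suc n)) ∣ ℚ.+ ℚ.∣ X ∣
      ≡⟨ cong (ℚ._+ ℚ.∣ X ∣) (ℚ.∣p*q∣≡∣p∣*∣q∣ (a 0) (B M ℚ.- B (suc n))) ⟩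
    ℚ.∣ a 0 ∣ ℚ.* ℚ.∣ B M ℚ.- B (suc n) ∣ ℚ.+ ℚ.∣ X ∣
      ≤⟨ ℚ.+-mono-≤
           (*-mono (ℚ.0≤∣p∣ (a 0)) (ℚ.≤-trans (ℚ.0≤∣p∣ (B M ℚ.- B (suc n))) (dominated b β b≤β n<M)) (a≤α 0) (dominated b β b≤β n<M))
           (product-remainder (a ∘ suc) (α ∘ suc) (a≤α ∘ suc) (ℕ.<⇒≤ n<M)) ⟩
    α 0 ℚ.* (B° M ℚ.- B° (suc n)) ℚ.+ (partialSum (α ∘ suc) n ℚ.* B° M ℚ.- partialSum (convolution (α ∘ suc) β) n)
      ≡⟨ split α β ⟨
    partialSum α (suc n) ℚ.* B° M ℚ.- partialSum (convolution α β) (suc n) ∎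
    where
    open ℚ.≤-Reasoning
    X = partialSum (a ∘ suc) n ℚ.* B M ℚ.- partialSum (convolution (a ∘ suc) b) n
    split : ∀ a b → partialSum a (suc n) ℚ.* partialSum b M ℚ.- partialSum (convolution a b) (suc n) ≡
            a 0 ℚ.* (partialSum b M ℚ.- partialSum b (suc n)) ℚ.+ (partialSum (a ∘ suc) n ℚ.* partialSum b M ℚ.- partialSum (convolution (a ∘ suc) b) n)
    split a b = trans (cong₂ (λ x y → x ℚ.* partialSum b M ℚ.- y) (partialSum-suc a n) (partialSum-convolution a b n))
      (solve 5 (λ a A B C s → (a :+ A) :* B :- (a :* C :+ s) := a :* (B :- C) :+ (A :* B :- s)) refl
        (a 0) (partialSum (a ∘ suc) n) (partialSum b M) (partialSum b (suc n)) (partialSum (convolution (a ∘ suc) b) n))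

-- The rectangle i < n, j < M lies in the triangle i + j < n + M, and all terms are non-negative.
product≤convolution : ∀ a b → (∀ k → 0ℚ ℚ.≤ a k) → (∀ k → 0ℚ ℚ.≤ b k) → ∀ n M →
  partialSum a n ℚ.* partialSum b M ℚ.≤ partialSum (convolution a b) (n ℕ.+ M)
product≤convolution a b 0≤a 0≤b zero M = ℚ.≤-trans (ℚ.≤-reflexive (ℚ.*-zeroˡ (partialSum b M))) (partialSum-mono (convolution a b) (0≤c a 0≤a) {0} {M} z≤n)
  where
  0≤c : ∀ a → (∀ k → 0ℚ ℚ.≤ a k) → ∀ k → 0ℚ ℚ.≤ convolution a b k
  0≤c a 0≤a zero    = *-nonNeg (0≤a 0) (0≤b 0)
  0≤c a 0≤a (suc k) = +-nonNeg (*-nonNeg (0≤a 0) (0≤b (suc k))) (0≤c (a ∘ suc) (0≤a ∘ suc) k)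
product≤convolution a b 0≤a 0≤b (suc n) M = begin
  partialSum a (suc n) ℚ.* B
    ≡⟨ cong (ℚ._* B) (partialSum-suc a n) ⟩
  (a 0 ℚ.+ partialSum (a ∘ suc) n) ℚ.* B
    ≡⟨ ℚ.*-distribʳ-+ B (a 0) (partialSum (a ∘ suc) n) ⟩
  a 0 ℚ.* B ℚ.+ partialSum (a ∘ suc) n ℚ.* B
    ≤⟨ ℚ.+-mono-≤
         (ℚ.*-monoˡ-≤-nonNeg (a 0) {{ℚ.nonNegative (0≤a 0)}} (partialSum-mono b 0≤b (ℕ.m≤n+m M (suc n))))
         (product≤convolution (a ∘ suc) b (0≤a ∘ suc) 0≤b n M) ⟩
  a 0 ℚ.* partialSum b (suc n ℕ.+ M) ℚ.+ partialSum (convolution (a ∘ suc) b) (n ℕ.+ M)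
    ≡⟨ partialSum-convolution a b (n ℕ.+ M) ⟨
  partialSum (convolution a b) (suc n ℕ.+ M) ∎
  where
  open ℚ.≤-Reasoning
  B = partialSum b M

-- Estimates for the partial sums of the exponential series

E : ℚ → ℕ → ℚ
E x = partialSum (expTerm x)

0≤expTerm : ∀ {x} → 0ℚ ℚ.≤ x → ∀ k → 0ℚ ℚ.≤ expTerm x k
0≤expTerm 0≤x zero    = ℚ.nonNegative⁻¹ 1ℚ
0≤expTerm {x} 0≤x (suc k) = ℚ.≤-trans (*-nonNeg (0≤expTerm 0≤x k) (*-nonNeg 0≤x (0≤recip (suc k)))) (ℚ.≤-reflexive (sym (expTerm-suc x k)))

∣expTerm∣ : ∀ x k → ℚ.∣ expTerm x k ∣ ≡ expTerm ℚ.∣ x ∣ k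
∣expTerm∣ x zero    = refl
∣expTerm∣ x (suc k) = begin
  ℚ.∣ expTerm x (suc k) ∣                                            ≡⟨ cong ℚ.∣_∣ (expTerm-suc x k) ⟩
  ℚ.∣ expTerm x k ℚ.* (x ℚ.* c) ∣                                    ≡⟨ ℚ.∣p*q∣≡∣p∣*∣q∣ (expTerm x k) (x ℚ.* c) ⟩
  ℚ.∣ expTerm x k ∣ ℚ.* ℚ.∣ x ℚ.* c ∣                                ≡⟨ cong₂ ℚ._*_ (∣expTerm∣ x k) (trans (ℚ.∣p*q∣≡∣p∣*∣q∣ x c) (cong (ℚ.∣ x ∣ ℚ.*_) (ℚ.0≤p⇒∣p∣≡p (0≤recip (suc k))))) ⟩
  expTerm ℚ.∣ x ∣ k ℚ.* (ℚ.∣ x ∣ ℚ.* c)                              ≡⟨ expTerm-suc ℚ.∣ x ∣ k ⟨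
  expTerm ℚ.∣ x ∣ (suc k)                                            ∎
  where
  open ≡-Reasoning
  c = + 1 ℚ./ suc k

expTerm-0 : ∀ k → expTerm 0ℚ (suc k) ≡ 0ℚ
expTerm-0 k = trans (expTerm-suc 0ℚ k) (solve 2 (λ t c → t :* (con 0ℚ :* c) := con 0ℚ) refl (expTerm 0ℚ k) (+ 1 ℚ./ suc k))

E-0 : ∀ n → E 0ℚ (suc n) ≡ 1ℚ
E-0 zero    = refl
E-0 (suc n) = cong₂ ℚ._+_ (E-0 n) (expTerm-0 n)

E-tail : ∀ x → 0ℚ ℚ.< x → ∃ λ N → ∀ i j → N ℕ.≤ i → i ℕ.≤ j → E x j ℚ.- E x i ℚ.≤ ½
E-tail x 0<x = let N , tail = Exp.tail x 0<x (½ ℚ.* ½) (ℚ.positive⁻¹ (½ ℚ.* ½)) in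
  N , λ i j N≤i i≤j → ℚ.≤-trans (tail i j N≤i i≤j) (ℚ.≤-reflexive refl)

-- The left side is the remainder of the product exp(x) exp(-x), whose Cauchy product sums to 1. Its
-- majorant is the remainder of exp(x) exp(x), which lies in a tail of the series of exp(2x).
E-inverse-gap : ∀ x → 0ℚ ℚ.≤ x → ∀ k → E 0ℚ k ≡ 1ℚ →
                ℚ.∣ E x k ℚ.* E (ℚ.- x) k ℚ.- 1ℚ ∣ ℚ.≤ E (x ℚ.+ x) (k ℕ.+ k) ℚ.- E (x ℚ.+ x) k
E-inverse-gap x 0≤x k E₀≡1 = begin
  ℚ.∣ E x k ℚ.* E (ℚ.- x) k ℚ.- 1ℚ ∣
    ≡⟨ cong (λ s → ℚ.∣ E x k ℚ.* E (ℚ.- x) k ℚ.- s ∣) one ⟨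
  ℚ.∣ E x k ℚ.* E (ℚ.- x) k ℚ.- partialSum (convolution α (expTerm (ℚ.- x))) k ∣
    ≤⟨ product-remainder (expTerm (ℚ.- x)) α dom α α dom′ (ℕ.≤-refl {k}) ⟩
  E x k ℚ.* E x k ℚ.- partialSum (convolution α α) k
    ≤⟨ ℚ.+-monoˡ-≤ (ℚ.- partialSum (convolution α α) k) (product≤convolution α α (0≤expTerm 0≤x) (0≤expTerm 0≤x) k k) ⟩
  partialSum (convolution α α) (k ℕ.+ k) ℚ.- partialSum (convolution α α) k
    ≡⟨ cong₂ ℚ._-_ (partialSum-cong (convolution-exp x x) (k ℕ.+ k)) (partialSum-cong (convolution-exp x x) k) ⟩
  E (x ℚ.+ x) (k ℕ.+ k) ℚ.- E (x ℚ.+ x) k ∎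
  where
  open ℚ.≤-Reasoning
  α = expTerm x
  dom : ∀ k → ℚ.∣ expTerm (ℚ.- x) k ∣ ℚ.≤ α k
  dom k = ℚ.≤-reflexive (trans (∣expTerm∣ (ℚ.- x) k) (cong (λ p → expTerm p k) (trans (ℚ.∣-p∣≡∣p∣ x) (ℚ.0≤p⇒∣p∣≡p 0≤x))))
  dom′ : ∀ k → ℚ.∣ α k ∣ ℚ.≤ α k
  dom′ k = ℚ.≤-reflexive (ℚ.0≤p⇒∣p∣≡p (0≤expTerm 0≤x k))
  one : partialSum (convolution α (expTerm (ℚ.- x))) k ≡ 1ℚ
  one = trans (partialSum-cong (convolution-exp x (ℚ.- x)) k) (trans (cong (λ p → E p k) (ℚ.+-inverseʳ x)) E₀≡1)

lower-from-gap : ∀ d → ℚ.∣ d ℚ.- 1ℚ ∣ ℚ.≤ ½ → ½ ℚ.≤ d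
lower-from-gap d gap = begin
  ½                                      ≡⟨ solve 1 (λ d → con ½ := (:- (d :- con 1ℚ)) :+ (d :- con ½)) refl d ⟩
  ℚ.- (d ℚ.- 1ℚ) ℚ.+ (d ℚ.- ½)           ≤⟨ ℚ.+-monoˡ-≤ (d ℚ.- ½) (p≤∣p∣ (ℚ.- (d ℚ.- 1ℚ))) ⟩
  ℚ.∣ ℚ.- (d ℚ.- 1ℚ) ∣ ℚ.+ (d ℚ.- ½)     ≡⟨ cong (ℚ._+ (d ℚ.- ½)) (ℚ.∣-p∣≡∣p∣ (d ℚ.- 1ℚ)) ⟩
  ℚ.∣ d ℚ.- 1ℚ ∣ ℚ.+ (d ℚ.- ½)           ≤⟨ ℚ.+-monoˡ-≤ (d ℚ.- ½) gap ⟩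
  ½ ℚ.+ (d ℚ.- ½)                        ≡⟨ solve 1 (λ d → con ½ :+ (d :- con ½) := d) refl d ⟩
  d                                      ∎
  where open ℚ.≤-Reasoning

-- Turns upper bounds on exp(x) into lower bounds on exp(-x) at the level of partial sums; the
-- constant ½ replaces the limit 1.
E-inverse : ∀ x → 0ℚ ℚ.< x → ∃ λ N → ∀ n → N ℕ.≤ n → ½ ℚ.≤ E x n ℚ.* E (ℚ.- x) n
E-inverse x 0<x =
  let N , tail = E-tail (x ℚ.+ x) (ℚ.+-mono-< 0<x 0<x)
  in suc N , λ n N<n → lower-from-gap (E x n ℚ.* E (ℚ.- x) n) (ℚ.≤-trans
       (E-inverse-gap x (ℚ.<⇒≤ 0<x) n (E₀≡1 n (ℕ.≤-trans (s≤s z≤n) N<n)))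
       (tail n (n ℕ.+ n) (ℕ.<⇒≤ N<n) (ℕ.m≤m+n n n)))
  where
  E₀≡1 : ∀ n → 1 ℕ.≤ n → E 0ℚ n ≡ 1ℚ
  E₀≡1 (suc n) _ = E-0 n

-- The mean value inequality for y^(k+1)/(k+1)!, whose derivative y^k/k! is increasing; summed in
-- `E-increment`, it gives the one for exp.
expTerm-increment : ∀ {x y} → 0ℚ ℚ.≤ x → x ℚ.≤ y → ∀ k →
                    expTerm y (suc k) ℚ.- expTerm x (suc k) ℚ.≤ (y ℚ.- x) ℚ.* expTerm y k
expTerm-increment {x} {y} 0≤x x≤y zero = ℚ.≤-reflexive
  (solve 2 (λ x y → (y :* con 1ℚ) :* con 1ℚ :- (x :* con 1ℚ) :* con 1ℚ := (y :- x) :* con 1ℚ) refl x y)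
expTerm-increment {x} {y} 0≤x x≤y (suc k) = ℚ.*-cancelˡ-≤-pos (ι (suc (suc k))) {{ℚ.normalize-pos (suc (suc k)) 1}} (begin
  i₂ ℚ.* (expTerm y (suc (suc k)) ℚ.- expTerm x (suc (suc k)))
    ≡⟨ solve 3 (λ i a b → i :* (a :- b) := i :* a :- i :* b) refl i₂ (expTerm y (suc (suc k))) (expTerm x (suc (suc k))) ⟩
  i₂ ℚ.* expTerm y (suc (suc k)) ℚ.- i₂ ℚ.* expTerm x (suc (suc k))
    ≡⟨ cong₂ ℚ._-_ (expTerm-absorb y (suc k)) (expTerm-absorb x (suc k)) ⟩
  y ℚ.* ty ℚ.- x ℚ.* tx
    ≡⟨ solve 4 (λ x y s t → y :* t :- x :* s := x :* (t :- s) :+ (y :- x) :* t) refl x y tx ty ⟩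
  x ℚ.* (ty ℚ.- tx) ℚ.+ h ℚ.* ty
    ≤⟨ ℚ.+-monoˡ-≤ (h ℚ.* ty) (*-mono 0≤x (*-nonNeg 0≤h (0≤expTerm 0≤y k)) x≤y (expTerm-increment 0≤x x≤y k)) ⟩
  y ℚ.* (h ℚ.* expTerm y k) ℚ.+ h ℚ.* ty
    ≡⟨ solve 4 (λ y h t s → y :* (h :* t) :+ h :* s := h :* (y :* t :+ s)) refl y h (expTerm y k) ty ⟩
  h ℚ.* (y ℚ.* expTerm y k ℚ.+ ty)
    ≡⟨ cong (λ z → h ℚ.* (z ℚ.+ ty)) (expTerm-absorb y k) ⟨
  h ℚ.* (ι (suc k) ℚ.* ty ℚ.+ ty)
    ≡⟨ solve 3 (λ h i t → h :* (i :* t :+ t) := (con 1ℚ :+ i) :* (h :* t)) refl h (ι (suc k)) ty ⟩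
  (1ℚ ℚ.+ ι (suc k)) ℚ.* (h ℚ.* ty)
    ≡⟨ cong (ℚ._* (h ℚ.* ty)) (ι-suc (suc k)) ⟨
  i₂ ℚ.* (h ℚ.* ty) ∎)
  where
  open ℚ.≤-Reasoning
  i₂ = ι (suc (suc k))
  ty = expTerm y (suc k)
  tx = expTerm x (suc k)
  h  = y ℚ.- x
  0≤h : 0ℚ ℚ.≤ h
  0≤h = ℚ.≤-trans (ℚ.≤-reflexive (sym (ℚ.+-inverseʳ x))) (ℚ.+-monoˡ-≤ (ℚ.- x) x≤y)
  0≤y = ℚ.≤-trans 0≤x x≤y

E-increment : ∀ {x y} → 0ℚ ℚ.≤ x → x ℚ.≤ y → ∀ n → E y (suc n) ℚ.- E x (suc n) ℚ.≤ (y ℚ.- x) ℚ.* E y n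
E-increment {x} {y} 0≤x x≤y zero    = ℚ.≤-reflexive (solve 1 (λ h → con 0ℚ := h :* con 0ℚ) refl (y ℚ.- x))
E-increment {x} {y} 0≤x x≤y (suc n) = begin
  (E y (suc n) ℚ.+ expTerm y (suc n)) ℚ.- (E x (suc n) ℚ.+ expTerm x (suc n))
    ≡⟨ solve 4 (λ a b c d → (a :+ b) :- (c :+ d) := (a :- c) :+ (b :- d)) refl (E y (suc n)) (expTerm y (suc n)) (E x (suc n)) (expTerm x (suc n)) ⟩
  (E y (suc n) ℚ.- E x (suc n)) ℚ.+ (expTerm y (suc n) ℚ.- expTerm x (suc n))
    ≤⟨ ℚ.+-mono-≤ (E-increment 0≤x x≤y n) (expTerm-increment 0≤x x≤y n) ⟩
  (y ℚ.- x) ℚ.* E y n ℚ.+ (y ℚ.- x) ℚ.* expTerm y n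
    ≡⟨ ℚ.*-distribˡ-+ (y ℚ.- x) (E y n) (expTerm y n) ⟨
  (y ℚ.- x) ℚ.* E y (suc n) ∎
  where open ℚ.≤-Reasoning

E-mono : ∀ {x y} → 0ℚ ℚ.≤ x → x ℚ.≤ y → ∀ n → E x n ℚ.≤ E y n
E-mono 0≤x x≤y zero    = ℚ.≤-refl
E-mono {x} {y} 0≤x x≤y (suc n) = ℚ.+-mono-≤ (E-mono 0≤x x≤y n)
  (ℚ.*-monoʳ-≤-nonNeg ((+ 1 ℚ./ n ℕ.!) {{n ℕ.!≢0}}) {{ℚ.nonNegative (0≤recip (n ℕ.!) {{n ℕ.!≢0}})}} (^ℚ-mono 0≤x x≤y n))

-- By the mean value inequality a step of ½ gains at most half of the new value.
E-half-step : ∀ {x} → 0ℚ ℚ.≤ x → ∀ n → E (x ℚ.+ ½) (suc n) ℚ.≤ ι 2 ℚ.* E x (suc n)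
E-half-step {x} 0≤x n = begin
  e                                             ≡⟨ solve 1 (λ e → e := con (ι 2) :* (e :- con ½ :* e)) refl e ⟩
  ι 2 ℚ.* (e ℚ.- ½ ℚ.* e)                       ≤⟨ ℚ.*-monoˡ-≤-nonNeg (ι 2) step ⟩
  ι 2 ℚ.* E x (suc n)                           ∎
  where
  open ℚ.≤-Reasoning
  x≤ : x ℚ.≤ x ℚ.+ ½
  x≤ = p≤p+q x (ℚ.nonNegative⁻¹ ½)
  e = E (x ℚ.+ ½) (suc n)
  f = E x (suc n)
  step : e ℚ.- ½ ℚ.* e ℚ.≤ f
  step = begin
    e ℚ.- ½ ℚ.* e                                                 ≡⟨ solve 2 (λ e f → e :- con ½ :* e := (e :- f) :+ (f :- con ½ :* e)) refl e f ⟩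
    (e ℚ.- f) ℚ.+ (f ℚ.- ½ ℚ.* e)                                 ≤⟨ ℚ.+-monoˡ-≤ (f ℚ.- ½ ℚ.* e) (E-increment 0≤x x≤ n) ⟩
    ((x ℚ.+ ½) ℚ.- x) ℚ.* E (x ℚ.+ ½) n ℚ.+ (f ℚ.- ½ ℚ.* e)       ≡⟨ cong (λ h → h ℚ.* E (x ℚ.+ ½) n ℚ.+ (f ℚ.- ½ ℚ.* e)) (solve 1 (λ x → (x :+ con ½) :- x := con ½) refl x) ⟩
    ½ ℚ.* E (x ℚ.+ ½) n ℚ.+ (f ℚ.- ½ ℚ.* e)                       ≤⟨ ℚ.+-monoˡ-≤ (f ℚ.- ½ ℚ.* e) (ℚ.*-monoˡ-≤-nonNeg ½ (partialSum-mono (expTerm (x ℚ.+ ½)) (0≤expTerm (ℚ.≤-trans 0≤x x≤)) (ℕ.n≤1+n n))) ⟩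
    ½ ℚ.* e ℚ.+ (f ℚ.- ½ ℚ.* e)                                   ≡⟨ solve 2 (λ e f → con ½ :* e :+ (f :- con ½ :* e) := f) refl e f ⟩
    f                                                             ∎

-- The crude bound exp(x) ≤ 2^(2x), by steps of ½ that at most double the value.
E≤2^ : ∀ k {x} → 0ℚ ℚ.≤ x → x ℚ.≤ ½ ℚ.* ι k → ∀ n → E x n ℚ.≤ ι 2 ^ℚ k
E≤2^ k 0≤x x≤ zero    = 0≤^ℚ (0≤ι 2) k
E≤2^ k 0≤x x≤ (suc n) = ℚ.≤-trans (E-mono 0≤x x≤ (suc n)) (go k)
  where
  open ℚ.≤-Reasoning
  go : ∀ k → E (½ ℚ.* ι k) (suc n) ℚ.≤ ι 2 ^ℚ k
  go zero    = ℚ.≤-reflexive (E-0 n)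
  go (suc k) = begin
    E (½ ℚ.* ι (suc k)) (suc n)           ≡⟨ cong (λ p → E p (suc n)) (trans (cong (½ ℚ.*_) (ι-suc k)) (solve 1 (λ i → con ½ :* (con 1ℚ :+ i) := con ½ :* i :+ con ½) refl (ι k))) ⟩
    E (½ ℚ.* ι k ℚ.+ ½) (suc n)           ≤⟨ E-half-step (*-nonNeg (ℚ.nonNegative⁻¹ ½) (0≤ι k)) n ⟩
    ι 2 ℚ.* E (½ ℚ.* ι k) (suc n)         ≤⟨ ℚ.*-monoˡ-≤-nonNeg (ι 2) (go k) ⟩
    ι 2 ℚ.* ι 2 ^ℚ k                      ∎

½^*2^ : ∀ k → ½ ^ℚ k ℚ.* ι 2 ^ℚ k ≡ 1ℚ
½^*2^ zero    = refl
½^*2^ (suc k) = trans (solve 2 (λ x y → (con ½ :* x) :* (con (ι 2) :* y) := x :* y) refl (½ ^ℚ k) (ι 2 ^ℚ k)) (½^*2^ k)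

½≤product⇒½^≤ : ∀ k e f → ½ ℚ.≤ f ℚ.* e → f ℚ.≤ ι 2 ^ℚ k → 0ℚ ℚ.≤ f → ½ ^ℚ suc k ℚ.≤ e
½≤product⇒½^≤ k e f ½≤fe f≤ 0≤f with ℚ.≤-total 0ℚ e
... | inj₂ e≤0 = contradiction (ℚ.<-≤-trans (ℚ.positive⁻¹ ½) ½≤0) (ℚ.<-irrefl refl)
  where
  open ℚ.≤-Reasoning
  ½≤0 : ½ ℚ.≤ 0ℚ
  ½≤0 = begin
    ½                     ≤⟨ ½≤fe ⟩
    f ℚ.* e               ≤⟨ ℚ.*-monoˡ-≤-nonNeg f {{ℚ.nonNegative 0≤f}} e≤0 ⟩
    f ℚ.* 0ℚ              ≡⟨ ℚ.*-zeroʳ f ⟩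
    0ℚ                    ∎
... | inj₁ 0≤e = begin
  ½ ℚ.* ½ ^ℚ k                        ≡⟨ ℚ.*-comm ½ (½ ^ℚ k) ⟩
  ½ ^ℚ k ℚ.* ½                        ≤⟨ ℚ.*-monoˡ-≤-nonNeg (½ ^ℚ k) {{ℚ.nonNegative (0≤½^ k)}} ½≤2^e ⟩
  ½ ^ℚ k ℚ.* (ι 2 ^ℚ k ℚ.* e)         ≡⟨ ℚ.*-assoc (½ ^ℚ k) (ι 2 ^ℚ k) e ⟨
  ½ ^ℚ k ℚ.* ι 2 ^ℚ k ℚ.* e           ≡⟨ cong (ℚ._* e) (½^*2^ k) ⟩
  1ℚ ℚ.* e                            ≡⟨ ℚ.*-identityˡ e ⟩
  e                                   ∎
  where
  open ℚ.≤-Reasoning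
  ½≤2^e : ½ ℚ.≤ ι 2 ^ℚ k ℚ.* e
  ½≤2^e = ℚ.≤-trans ½≤fe (ℚ.*-monoʳ-≤-nonNeg e {{ℚ.nonNegative 0≤e}} f≤)

½^≤E-neg : ∀ k {x} → 0ℚ ℚ.< x → x ℚ.≤ ½ ℚ.* ι k → ∃ λ N → ∀ n → N ℕ.≤ n → ½ ^ℚ suc k ℚ.≤ E (ℚ.- x) n
½^≤E-neg k {x} 0<x x≤ =
  let N , inv = E-inverse x 0<x
  in N , λ n N≤n → ½≤product⇒½^≤ k (E (ℚ.- x) n) (E x n) (inv n N≤n) (E≤2^ k (ℚ.<⇒≤ 0<x) x≤ n)
       (partialSum-mono (expTerm x) (0≤expTerm (ℚ.<⇒≤ 0<x)) {0} {n} z≤n)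

-- Bounds for ln 2

ln2≤1 : ∀ n → partialSum ln2Term n ℚ.≤ 1ℚ
ln2≤1 n = ℚ.≤-trans (p≤p+q (partialSum ln2Term n) (0≤½^ n)) (go n)
  where
  open ℚ.≤-Reasoning
  recip≤1 : ∀ k → + 1 ℚ./ suc k ℚ.≤ 1ℚ
  recip≤1 zero    = ℚ.≤-refl
  recip≤1 (suc k) = ℚ.≤-trans (recip-anti k) (recip≤1 k)
  -- Replacing 1/k by 1 turns the series into Σ ½^k, and ½ ^ℚ n is its remainder.
  go : ∀ n → partialSum ln2Term n ℚ.+ ½ ^ℚ n ℚ.≤ 1ℚ
  go zero    = ℚ.≤-refl
  go (suc n) = begin
    (partialSum ln2Term n ℚ.+ ln2Term n) ℚ.+ ½ ^ℚ suc n
      ≤⟨ ℚ.+-monoˡ-≤ (½ ^ℚ suc n) (ℚ.+-monoʳ-≤ (partialSum ln2Term n) (ℚ.*-monoʳ-≤-nonNeg (½ ^ℚ suc n) {{ℚ.nonNegative (0≤½^ (suc n))}} (recip≤1 n))) ⟩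
    (partialSum ln2Term n ℚ.+ 1ℚ ℚ.* ½ ^ℚ suc n) ℚ.+ ½ ^ℚ suc n
      ≡⟨ solve 2 (λ s h → (s :+ con 1ℚ :* (con ½ :* h)) :+ con ½ :* h := s :+ h) refl (partialSum ln2Term n) (½ ^ℚ n) ⟩
    partialSum ln2Term n ℚ.+ ½ ^ℚ n
      ≤⟨ go n ⟩
    1ℚ ∎

0≤ln2 : ∀ n → 0ℚ ℚ.≤ partialSum ln2Term n
0≤ln2 n = partialSum-mono ln2Term (λ k → *-nonNeg (0≤recip (suc k)) (0≤½^ (suc k))) {0} {n} z≤n

-- Counting

length-subsets : ∀ m → length (subsets m) ≡ 2 ℕ.^ m
length-subsets zero    = refl
length-subsets (suc m) = begin
  length (map (outside ∷_) (subsets m) ++ map (inside ∷_) (subsets m))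
    ≡⟨ List.length-++ (map (outside ∷_) (subsets m)) ⟩
  length (map (outside ∷_) (subsets m)) ℕ.+ length (map (inside ∷_) (subsets m))
    ≡⟨ cong₂ ℕ._+_ (List.length-map (outside ∷_) (subsets m)) (List.length-map (inside ∷_) (subsets m)) ⟩
  length (subsets m) ℕ.+ length (subsets m)
    ≡⟨ cong (λ n → n ℕ.+ n) (length-subsets m) ⟩
  2 ℕ.^ m ℕ.+ 2 ℕ.^ m
    ≡⟨ cong (2 ℕ.^ m ℕ.+_) (ℕ.+-identityʳ (2 ℕ.^ m)) ⟨
  2 ℕ.^ suc m ∎
  where open ≡-Reasoning

length≤filters : ∀ {A : Set} {P Q R : A → Set} (P? : Decidable P) (Q? : Decidable Q) (R? : Decidable R) →
                 (∀ x → ¬ P x → Q x ⊎ R x) → ∀ xs →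
                 length xs ℕ.≤ length (filter P? xs) ℕ.+ (length (filter Q? xs) ℕ.+ length (filter R? xs))
length≤filters P? Q? R? cover [] = z≤n
length≤filters P? Q? R? cover (x ∷ xs) with P? x | Q? x | R? x | length≤filters P? Q? R? cover xs
... | yes _ | yes _ | yes _ | le = s≤s (ℕ.≤-trans le (ℕ.+-monoʳ-≤ (length (filter P? xs)) (ℕ.+-mono-≤ (ℕ.n≤1+n _) (ℕ.n≤1+n _))))
... | yes _ | yes _ | no  _ | le = s≤s (ℕ.≤-trans le (ℕ.+-monoʳ-≤ (length (filter P? xs)) (ℕ.n≤1+n _)))
... | yes _ | no  _ | yes _ | le = s≤s (ℕ.≤-trans le (ℕ.+-monoʳ-≤ (length (filter P? xs)) (ℕ.+-monoʳ-≤ (length (filter Q? xs)) (ℕ.n≤1+n _))))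
... | yes _ | no  _ | no  _ | le = s≤s le
... | no  _ | yes _ | yes _ | le = ℕ.≤-trans (s≤s (ℕ.≤-trans le (ℕ.+-monoʳ-≤ (length (filter P? xs)) (ℕ.+-monoʳ-≤ (length (filter Q? xs)) (ℕ.n≤1+n _)))))
                                             (ℕ.≤-reflexive (sym (ℕ.+-suc (length (filter P? xs)) _)))
... | no  _ | yes _ | no  _ | le = ℕ.≤-trans (s≤s le) (ℕ.≤-reflexive (sym (ℕ.+-suc (length (filter P? xs)) _)))
... | no  _ | no  _ | yes _ | le = ℕ.≤-trans (s≤s le) (ℕ.≤-reflexive (sym
  (trans (cong (length (filter P? xs) ℕ.+_) (ℕ.+-suc (length (filter Q? xs)) _)) (ℕ.+-suc (length (filter P? xs)) _))))
... | no ¬p | no ¬q | no ¬r | le with cover x ¬p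
...   | inj₁ q = contradiction q ¬q
...   | inj₂ r = contradiction r ¬r

Markov : ∀ {A : Set} {P : A → Set} (P? : Decidable P) (g : A → ℚ) {K} →
         (∀ x → 0ℚ ℚ.≤ g x) → (∀ x → P x → K ℚ.≤ g x) → ∀ xs →
         ι (length (filter P? xs)) ℚ.* K ℚ.≤ ∑ (map g xs)
Markov P? g {K} 0≤g K≤g [] = ℚ.≤-reflexive (ℚ.*-zeroˡ K)
Markov P? g {K} 0≤g K≤g (x ∷ xs) with P? x
... | no  _ = ℚ.≤-trans (Markov P? g 0≤g K≤g xs) (ℚ.≤-trans (p≤p+q (∑ (map g xs)) (0≤g x)) (ℚ.≤-reflexive (ℚ.+-comm (∑ (map g xs)) (g x))))
... | yes p = begin
  ι (suc n) ℚ.* K          ≡⟨ cong (ℚ._* K) (ι-suc n) ⟩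
  (1ℚ ℚ.+ ι n) ℚ.* K       ≡⟨ solve 2 (λ i k → (con 1ℚ :+ i) :* k := k :+ i :* k) refl (ι n) K ⟩
  K ℚ.+ ι n ℚ.* K          ≤⟨ ℚ.+-mono-≤ (K≤g x p) (Markov P? g 0≤g K≤g xs) ⟩
  g x ℚ.+ ∑ (map g xs)     ∎
  where
  open ℚ.≤-Reasoning
  n = length (filter P? xs)

Σˢ-scale : ∀ {m} k (w : Subset m → ℚ) → Σˢ (λ S → k ℚ.* w S) ≡ k ℚ.* Σˢ w
Σˢ-scale {zero}  k w = refl
Σˢ-scale {suc m} k w = trans (cong₂ ℚ._+_ (Σˢ-scale k (w ∘ (outside ∷_))) (Σˢ-scale k (w ∘ (inside ∷_))))
  (sym (ℚ.*-distribˡ-+ k (Σˢ (w ∘ (outside ∷_))) (Σˢ (w ∘ (inside ∷_)))))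

Σˢ-^∣∣ : ∀ m x → Σˢ {m} (λ S → x ^ℚ ∣ S ∣) ≡ (1ℚ ℚ.+ x) ^ℚ m
Σˢ-^∣∣ zero    x = refl
Σˢ-^∣∣ (suc m) x = trans
  (cong₂ ℚ._+_ (Σˢ-^∣∣ m x) (trans (Σˢ-scale {m} x (λ S → x ^ℚ ∣ S ∣)) (cong (x ℚ.*_) (Σˢ-^∣∣ m x))))
  (solve 2 (λ x p → p :+ x :* p := (con 1ℚ :+ x) :* p) refl x ((1ℚ ℚ.+ x) ^ℚ m))

Σˢ-^∣∁∣ : ∀ m x → Σˢ {m} (λ S → x ^ℚ ∣ ∁ S ∣) ≡ (1ℚ ℚ.+ x) ^ℚ m
Σˢ-^∣∁∣ zero    x = refl
Σˢ-^∣∁∣ (suc m) x = trans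
  (cong₂ ℚ._+_ (trans (Σˢ-scale {m} x (λ S → x ^ℚ ∣ ∁ S ∣)) (cong (x ℚ.*_) (Σˢ-^∣∁∣ m x))) (Σˢ-^∣∁∣ m x))
  (solve 2 (λ x p → x :* p :+ p := (con 1ℚ :+ x) :* p) refl x ((1ℚ ℚ.+ x) ^ℚ m))

^ℚ-antimonoʳ : ∀ {p} → 0ℚ ℚ.≤ p → p ℚ.≤ 1ℚ → ∀ {a b} → a ℕ.≤ b → p ^ℚ b ℚ.≤ p ^ℚ a
^ℚ-antimonoʳ {p} 0≤p p≤1 {b = b} z≤n = ℚ.≤-trans (^ℚ-mono 0≤p p≤1 b) (ℚ.≤-reflexive (^ℚ-1 b))
^ℚ-antimonoʳ {p} 0≤p p≤1 (s≤s a≤b)   = ℚ.*-monoˡ-≤-nonNeg p {{ℚ.nonNegative 0≤p}} (^ℚ-antimonoʳ 0≤p p≤1 a≤b)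

-- Chernoff's bound

-- The optimal tilt for a = 31m/64 is a/(m - a) = 31/33. The nearby 15/16 makes 1 + tilt equal to
-- 31/16.
tilt : ℚ
tilt = + 15 ℚ./ 16

0≤tilt : 0ℚ ℚ.≤ tilt
0≤tilt = toWitness {a? = 0ℚ ℚ.≤? tilt} tt

tilt≤1 : tilt ℚ.≤ 1ℚ
tilt≤1 = toWitness {a? = tilt ℚ.≤? 1ℚ} tt

-- `size` is |S| for the lower tail and |∁ S| for the upper one.
tail-count : ∀ {m} a (size : Subset m → ℕ) → Σˢ (λ S → tilt ^ℚ size S) ≡ (1ℚ ℚ.+ tilt) ^ℚ m →
             ι (length (filter (λ S → size S ℕ.<? a) (subsets m))) ℚ.* tilt ^ℚ a ℚ.≤ (1ℚ ℚ.+ tilt) ^ℚ m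
tail-count {m} a size eq = ℚ.≤-trans
  (Markov (λ S → size S ℕ.<? a) (λ S → tilt ^ℚ size S) (λ S → 0≤^ℚ 0≤tilt (size S)) (λ S <a → ^ℚ-antimonoʳ 0≤tilt tilt≤1 (ℕ.<⇒≤ <a)) (subsets m))
  (ℚ.≤-reflexive (trans (∑-subsets (λ S → tilt ^ℚ size S)) eq))

-- shrink is half of 1 + tilt, so that (1 + tilt)^m = 2^m shrink^m; the 32nd power of margin supplies the factor 2.
shrink margin : ℚ
shrink = + 31 ℚ./ 32
margin = + 41 ℚ./ 40

0≤shrink : 0ℚ ℚ.≤ shrink
0≤shrink = toWitness {a? = 0ℚ ℚ.≤? shrink} tt

abstract

  shrink^64*margin≤tilt^31 : shrink ^ℚ 64 ℚ.* margin ℚ.≤ tilt ^ℚ 31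
  shrink^64*margin≤tilt^31 = toWitness {a? = shrink ^ℚ 64 ℚ.* margin ℚ.≤? tilt ^ℚ 31} tt

  2≤margin^32 : ι 2 ℚ.≤ margin ^ℚ 32
  2≤margin^32 = toWitness {a? = ι 2 ℚ.≤? margin ^ℚ 32} tt

  γᵃ^31≤4 : γᵃ ^ℚ 31 ℚ.≤ ι 2 ^ℚ 2
  γᵃ^31≤4 = toWitness {a? = γᵃ ^ℚ 31 ℚ.≤? ι 2 ^ℚ 2} tt

  γʳ^64≤64 : γʳ ^ℚ 64 ℚ.≤ ι 2 ^ℚ 6
  γʳ^64≤64 = toWitness {a? = γʳ ^ℚ 64 ℚ.≤? ι 2 ^ℚ 6} tt

-- The exponents 992 = 32 * 31 and 2048 = 32 * 64 stay factored, so that inequalities between small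
-- powers, decided by computation, can be raised to the power 32p.
^ℚ-split : ∀ p a b c → p ^ℚ (a ℕ.* (b ℕ.* c)) ≡ ((p ^ℚ c) ^ℚ b) ^ℚ a
^ℚ-split p a b c = trans (^ℚ-* p a (b ℕ.* c)) (cong (_^ℚ a) (^ℚ-* p b c))

shrink^2048*2≤tilt^992 : ∀ p → shrink ^ℚ (p ℕ.* (32 ℕ.* 64)) ℚ.* ι 2 ^ℚ p ℚ.≤ tilt ^ℚ (p ℕ.* (32 ℕ.* 31))
shrink^2048*2≤tilt^992 p = begin
  shrink ^ℚ (p ℕ.* (32 ℕ.* 64)) ℚ.* ι 2 ^ℚ p
    ≡⟨ cong (ℚ._* ι 2 ^ℚ p) (^ℚ-split shrink p 32 64) ⟩
  ((shrink ^ℚ 64) ^ℚ 32) ^ℚ p ℚ.* ι 2 ^ℚ p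
    ≤⟨ ℚ.*-monoˡ-≤-nonNeg (((shrink ^ℚ 64) ^ℚ 32) ^ℚ p) {{ℚ.nonNegative (0≤^ℚ (0≤^ℚ (0≤^ℚ 0≤shrink 64) 32) p)}} (^ℚ-mono (0≤ι 2) 2≤margin^32 p) ⟩
  ((shrink ^ℚ 64) ^ℚ 32) ^ℚ p ℚ.* (margin ^ℚ 32) ^ℚ p
    ≡⟨ *-^ℚ ((shrink ^ℚ 64) ^ℚ 32) (margin ^ℚ 32) p ⟨
  ((shrink ^ℚ 64) ^ℚ 32 ℚ.* margin ^ℚ 32) ^ℚ p
    ≡⟨ cong (_^ℚ p) (*-^ℚ (shrink ^ℚ 64) margin 32) ⟨
  ((shrink ^ℚ 64 ℚ.* margin) ^ℚ 32) ^ℚ p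
    ≤⟨ ^ℚ-mono (0≤^ℚ 0≤base 32) (^ℚ-mono 0≤base shrink^64*margin≤tilt^31 32) p ⟩
  ((tilt ^ℚ 31) ^ℚ 32) ^ℚ p
    ≡⟨ ^ℚ-split tilt p 32 31 ⟨
  tilt ^ℚ (p ℕ.* (32 ℕ.* 31)) ∎
  where
  open ℚ.≤-Reasoning
  0≤base : 0ℚ ℚ.≤ shrink ^ℚ 64 ℚ.* margin
  0≤base = *-nonNeg (0≤^ℚ 0≤shrink 64) (toWitness {a? = 0ℚ ℚ.≤? margin} tt)

-- The parameters m = 2048 p + ρ, a = 992 p, L = m - 2a

0<^ℚ : ∀ {p} → 0ℚ ℚ.< p → ∀ n → 0ℚ ℚ.< p ^ℚ n
0<^ℚ 0<p zero    = 0<1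
0<^ℚ {p} 0<p (suc n) = ℚ.positive⁻¹ (p ℚ.* p ^ℚ n)
  {{ℚ.pos*pos⇒pos p {{ℚ.positive 0<p}} (p ^ℚ n) {{ℚ.positive (0<^ℚ 0<p n)}}}}

tail-bound : ∀ p ρ O → O ℚ.* tilt ^ℚ (p ℕ.* (32 ℕ.* 31)) ℚ.≤ (1ℚ ℚ.+ tilt) ^ℚ (ρ ℕ.+ p ℕ.* (32 ℕ.* 64)) →
             O ℚ.* ι 2 ^ℚ p ℚ.≤ ι 2 ^ℚ (ρ ℕ.+ p ℕ.* (32 ℕ.* 64))
tail-bound p ρ O count = ℚ.*-cancelʳ-≤-pos sa {{ℚ.positive (0<^ℚ (toWitness {a? = 0ℚ ℚ.<? tilt} tt) (p ℕ.* (32 ℕ.* 31)))}} (begin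
  O ℚ.* P ℚ.* sa                           ≡⟨ solve 3 (λ o p t → (o :* p) :* t := (o :* t) :* p) refl O P sa ⟩
  O ℚ.* sa ℚ.* P                           ≤⟨ ℚ.*-monoʳ-≤-nonNeg P {{ℚ.nonNegative (0≤^ℚ (0≤ι 2) p)}} count ⟩
  -- `1ℚ + tilt` and `ι 2 * shrink` evaluate to the same rational.
  (ι 2 ℚ.* shrink) ^ℚ m ℚ.* P                   ≡⟨ cong (ℚ._* P) (*-^ℚ (ι 2) shrink m) ⟩
  ι 2 ^ℚ m ℚ.* shrink ^ℚ m ℚ.* P                ≡⟨ ℚ.*-assoc (ι 2 ^ℚ m) (shrink ^ℚ m) P ⟩
  ι 2 ^ℚ m ℚ.* (shrink ^ℚ m ℚ.* P)              ≤⟨ ℚ.*-monoˡ-≤-nonNeg (ι 2 ^ℚ m) {{ℚ.nonNegative (0≤^ℚ (0≤ι 2) m)}} rm ⟩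
  ι 2 ^ℚ m ℚ.* sa                          ∎)
  where
  open ℚ.≤-Reasoning
  m = ρ ℕ.+ p ℕ.* (32 ℕ.* 64)
  P = ι 2 ^ℚ p
  sa = tilt ^ℚ (p ℕ.* (32 ℕ.* 31))
  rm : shrink ^ℚ m ℚ.* P ℚ.≤ sa
  rm = ℚ.≤-trans
    (ℚ.*-monoʳ-≤-nonNeg P {{ℚ.nonNegative (0≤^ℚ (0≤ι 2) p)}} (^ℚ-antimonoʳ 0≤shrink (toWitness {a? = shrink ℚ.≤? 1ℚ} tt) (ℕ.m≤n+m (p ℕ.* (32 ℕ.* 64)) ρ)))
    (shrink^2048*2≤tilt^992 p)

amplitude : ℕ → ℕ → ℕ → ℚ
amplitude L a m = (ι 64 ^ℚ L ℚ.* γᵃ ^ℚ a) ℚ.* γʳ ^ℚ m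

γᵃ^≤ : ∀ p → γᵃ ^ℚ (p ℕ.* (32 ℕ.* 31)) ℚ.≤ ι 2 ^ℚ (p ℕ.* (32 ℕ.* 2))
γᵃ^≤ p = begin
  γᵃ ^ℚ (p ℕ.* (32 ℕ.* 31))         ≡⟨ ^ℚ-split γᵃ p 32 31 ⟩
  ((γᵃ ^ℚ 31) ^ℚ 32) ^ℚ p           ≤⟨ ^ℚ-mono (0≤^ℚ 0≤γᵃ^31 32) (^ℚ-mono 0≤γᵃ^31 γᵃ^31≤4 32) p ⟩
  ((ι 2 ^ℚ 2) ^ℚ 32) ^ℚ p          ≡⟨ ^ℚ-split (ι 2) p 32 2 ⟨
  ι 2 ^ℚ (p ℕ.* (32 ℕ.* 2))        ∎
  where
  open ℚ.≤-Reasoning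
  0≤γᵃ^31 = 0≤^ℚ (ℚ.≤-trans (ℚ.<⇒≤ 0<1) 1≤γᵃ) 31

γʳ^≤ : ∀ p → γʳ ^ℚ (p ℕ.* (32 ℕ.* 64)) ℚ.≤ ι 2 ^ℚ (p ℕ.* (32 ℕ.* 6))
γʳ^≤ p = begin
  γʳ ^ℚ (p ℕ.* (32 ℕ.* 64))         ≡⟨ ^ℚ-split γʳ p 32 64 ⟩
  ((γʳ ^ℚ 64) ^ℚ 32) ^ℚ p           ≤⟨ ^ℚ-mono (0≤^ℚ 0≤γʳ^64 32) (^ℚ-mono 0≤γʳ^64 γʳ^64≤64 32) p ⟩
  ((ι 2 ^ℚ 6) ^ℚ 32) ^ℚ p          ≡⟨ ^ℚ-split (ι 2) p 32 6 ⟨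
  ι 2 ^ℚ (p ℕ.* (32 ℕ.* 6))        ∎
  where
  open ℚ.≤-Reasoning
  0≤γʳ^64 = 0≤^ℚ (ℚ.≤-trans (ℚ.<⇒≤ 0<1) 1≤γʳ) 64

amplitude≤ : ∀ p ρ → amplitude (p ℕ.* 64 ℕ.+ ρ) (p ℕ.* (32 ℕ.* 31)) (ρ ℕ.+ p ℕ.* (32 ℕ.* 64)) ℚ.≤
             ι 2 ^ℚ (((p ℕ.* 64 ℕ.+ ρ) ℕ.* 6 ℕ.+ p ℕ.* (32 ℕ.* 2)) ℕ.+ (ρ ℕ.+ p ℕ.* (32 ℕ.* 6)))
amplitude≤ p ρ = begin
  (ι 64 ^ℚ L ℚ.* Y) ℚ.* γʳ ^ℚ (ρ ℕ.+ n)
    ≡⟨ cong₂ (λ x w → (x ℚ.* Y) ℚ.* w) (sym (^ℚ-* (ι 2) L 6)) (^ℚ-+ γʳ ρ n) ⟩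
  (ι 2 ^ℚ (L ℕ.* 6) ℚ.* Y) ℚ.* (γʳ ^ℚ ρ ℚ.* γʳ ^ℚ n)
    ≤⟨ *-mono (*-nonNeg (0≤2^ (L ℕ.* 6)) (ℚ.≤-trans (ℚ.<⇒≤ 0<1) (1≤^ℚ 1≤γᵃ (p ℕ.* (32 ℕ.* 31)))))
         (*-nonNeg (0≤2^ ρ) (0≤2^ e))
         (ℚ.*-monoˡ-≤-nonNeg (ι 2 ^ℚ (L ℕ.* 6)) {{ℚ.nonNegative (0≤2^ (L ℕ.* 6))}} (γᵃ^≤ p))
         (*-mono (0≤^ℚ 0≤z ρ) (0≤2^ e) (^ℚ-mono 0≤z (toWitness {a? = γʳ ℚ.≤? ι 2} tt) ρ) (γʳ^≤ p)) ⟩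
  (ι 2 ^ℚ (L ℕ.* 6) ℚ.* ι 2 ^ℚ f) ℚ.* (ι 2 ^ℚ ρ ℚ.* ι 2 ^ℚ e)
    ≡⟨ cong₂ ℚ._*_ (^ℚ-+ (ι 2) (L ℕ.* 6) f) (^ℚ-+ (ι 2) ρ e) ⟨
  ι 2 ^ℚ (L ℕ.* 6 ℕ.+ f) ℚ.* ι 2 ^ℚ (ρ ℕ.+ e)
    ≡⟨ ^ℚ-+ (ι 2) (L ℕ.* 6 ℕ.+ f) (ρ ℕ.+ e) ⟨
  ι 2 ^ℚ ((L ℕ.* 6 ℕ.+ f) ℕ.+ (ρ ℕ.+ e)) ∎
  where
  open ℚ.≤-Reasoning
  L = p ℕ.* 64 ℕ.+ ρ
  n = p ℕ.* (32 ℕ.* 64)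
  e = p ℕ.* (32 ℕ.* 6)
  f = p ℕ.* (32 ℕ.* 2)
  Y = γᵃ ^ℚ (p ℕ.* (32 ℕ.* 31))
  0≤z = ℚ.≤-trans (ℚ.<⇒≤ 0<1) 1≤γʳ
  0≤2^ : ∀ n → 0ℚ ℚ.≤ ι 2 ^ℚ n
  0≤2^ = 0≤^ℚ (0≤ι 2)

-- The left side is 641p + 7ρ + 1. The surplus 351p must cover 7 * 2047 + 1 = 14330, which holds
-- from p = 41 on.
exponents : ∀ p ρ → 41 ℕ.≤ p → ρ ℕ.≤ 2047 →
  suc p ℕ.+ (((p ℕ.* 64 ℕ.+ ρ) ℕ.* 6 ℕ.+ p ℕ.* (32 ℕ.* 2)) ℕ.+ (ρ ℕ.+ p ℕ.* (32 ℕ.* 6))) ℕ.≤ p ℕ.* (32 ℕ.* 31)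
exponents p ρ 41≤p ρ≤2047 = begin
  suc p ℕ.+ (((p ℕ.* 64 ℕ.+ ρ) ℕ.* 6 ℕ.+ p ℕ.* 64) ℕ.+ (ρ ℕ.+ p ℕ.* 192))
    ≡⟨ collect p ρ ⟩
  641 ℕ.* p ℕ.+ (7 ℕ.* ρ ℕ.+ 1)
    ≤⟨ ℕ.+-monoʳ-≤ (641 ℕ.* p) (ℕ.+-monoˡ-≤ 1 (ℕ.*-monoʳ-≤ 7 ρ≤2047)) ⟩
  641 ℕ.* p ℕ.+ 14330
    ≤⟨ ℕ.+-monoʳ-≤ (641 ℕ.* p) (ℕ.≤-trans (ℕ.≤ᵇ⇒≤ 14330 (351 ℕ.* 41) tt) (ℕ.*-monoʳ-≤ 351 41≤p)) ⟩
  641 ℕ.* p ℕ.+ 351 ℕ.* p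
    ≡⟨ ℕ.*-distribʳ-+ p 641 351 ⟨
  992 ℕ.* p
    ≡⟨ ℕ.*-comm 992 p ⟩
  p ℕ.* 992 ∎
  where
  open ℕ.≤-Reasoning
  collect : ∀ p ρ → suc p ℕ.+ (((p ℕ.* 64 ℕ.+ ρ) ℕ.* 6 ℕ.+ p ℕ.* 64) ℕ.+ (ρ ℕ.+ p ℕ.* 192)) ≡ 641 ℕ.* p ℕ.+ (7 ℕ.* ρ ℕ.+ 1)
  collect = ℕ-Ring.solve-∀

room : ∀ p ρ → 41 ℕ.≤ p → ρ ℕ.≤ 2047 →
       ι 2 ^ℚ suc p ℚ.* amplitude (p ℕ.* 64 ℕ.+ ρ) (p ℕ.* (32 ℕ.* 31)) (ρ ℕ.+ p ℕ.* (32 ℕ.* 64)) ℚ.≤ ι 2 ^ℚ (p ℕ.* (32 ℕ.* 31))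
room p ρ 41≤p ρ≤2047 = begin
  ι 2 ^ℚ suc p ℚ.* amplitude (p ℕ.* 64 ℕ.+ ρ) (p ℕ.* (32 ℕ.* 31)) (ρ ℕ.+ p ℕ.* (32 ℕ.* 64))
    ≤⟨ ℚ.*-monoˡ-≤-nonNeg (ι 2 ^ℚ suc p) {{ℚ.nonNegative (0≤^ℚ (0≤ι 2) (suc p))}} (amplitude≤ p ρ) ⟩
  ι 2 ^ℚ suc p ℚ.* ι 2 ^ℚ e
    ≡⟨ ^ℚ-+ (ι 2) (suc p) e ⟨
  ι 2 ^ℚ (suc p ℕ.+ e)
    ≤⟨ ^ℚ-monoʳ (ι-mono {1} {2} (s≤s z≤n)) (exponents p ρ 41≤p ρ≤2047) ⟩
  ι 2 ^ℚ (p ℕ.* (32 ℕ.* 31)) ∎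
  where
  open ℚ.≤-Reasoning
  e = ((p ℕ.* 64 ℕ.+ ρ) ℕ.* 6 ℕ.+ p ℕ.* (32 ℕ.* 2)) ℕ.+ (ρ ℕ.+ p ℕ.* (32 ℕ.* 6))

-- T = 2^m, M = T - 1, W counts the window, O₁ and O₂ the tails, and x approximates exp(-cm). The 3
-- in the exponent pays for three factors of 2: the two tails, T ≤ 2M, and the `suc` in the bound on
-- x.
fraction-bound : ∀ k T M W O₁ O₂ x → 0ℚ ℚ.≤ T → M ℚ.≤ T → T ℚ.≤ ι 2 ℚ.* M → T ℚ.≤ W ℚ.+ (O₁ ℚ.+ O₂) →
                 O₁ ℚ.* ι 2 ^ℚ (3 ℕ.+ k) ℚ.≤ T → O₂ ℚ.* ι 2 ^ℚ (3 ℕ.+ k) ℚ.≤ T → ½ ^ℚ suc k ℚ.≤ x →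
                 (1ℚ ℚ.- x) ℚ.* M ℚ.≤ W
fraction-bound k T M W O₁ O₂ x 0≤T M≤T T≤2M T≤ O₁≤ O₂≤ x≥ = begin
  (1ℚ ℚ.- x) ℚ.* M
    ≡⟨ solve 2 (λ x m → (con 1ℚ :- x) :* m := m :- x :* m) refl x M ⟩
  M ℚ.- x ℚ.* M
    ≤⟨ ℚ.+-mono-≤ M≤T (ℚ.neg-antimono-≤ tT≤xM) ⟩
  T ℚ.- (t ℚ.* T ℚ.+ t ℚ.* T)
    ≤⟨ ℚ.+-monoˡ-≤ (ℚ.- (t ℚ.* T ℚ.+ t ℚ.* T)) (ℚ.≤-trans T≤ (ℚ.+-monoʳ-≤ W (ℚ.+-mono-≤ (scaled-down O₁ O₁≤) (scaled-down O₂ O₂≤)))) ⟩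
  (W ℚ.+ (t ℚ.* T ℚ.+ t ℚ.* T)) ℚ.- (t ℚ.* T ℚ.+ t ℚ.* T)
    ≡⟨ solve 2 (λ w u → (w :+ u) :- u := w) refl W (t ℚ.* T ℚ.+ t ℚ.* T) ⟩
  W ∎
  where
  open ℚ.≤-Reasoning
  t = ½ ^ℚ (3 ℕ.+ k)
  u = ½ ^ℚ k
  0≤t : 0ℚ ℚ.≤ t
  0≤t = 0≤½^ (3 ℕ.+ k)
  0≤M : 0ℚ ℚ.≤ M
  0≤M = ℚ.*-cancelˡ-≤-pos (ι 2) (ℚ.≤-trans (ℚ.≤-reflexive (ℚ.*-zeroʳ (ι 2))) (ℚ.≤-trans 0≤T T≤2M))
  scaled-down : ∀ O → O ℚ.* ι 2 ^ℚ (3 ℕ.+ k) ℚ.≤ T → O ℚ.≤ t ℚ.* T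
  scaled-down O O≤ = begin
    O                                        ≡⟨ ℚ.*-identityʳ O ⟨
    O ℚ.* 1ℚ                                 ≡⟨ cong (O ℚ.*_) (½^*2^ (3 ℕ.+ k)) ⟨
    O ℚ.* (t ℚ.* ι 2 ^ℚ (3 ℕ.+ k))           ≡⟨ solve 3 (λ o t p → o :* (t :* p) := t :* (o :* p)) refl O t (ι 2 ^ℚ (3 ℕ.+ k)) ⟩
    t ℚ.* (O ℚ.* ι 2 ^ℚ (3 ℕ.+ k))           ≤⟨ ℚ.*-monoˡ-≤-nonNeg t {{ℚ.nonNegative 0≤t}} O≤ ⟩
    t ℚ.* T                                  ∎
  tT≤xM : t ℚ.* T ℚ.+ t ℚ.* T ℚ.≤ x ℚ.* M
  tT≤xM = begin
    t ℚ.* T ℚ.+ t ℚ.* T                                     ≤⟨ ℚ.+-mono-≤ tT tT ⟩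
    t ℚ.* (ι 2 ℚ.* M) ℚ.+ t ℚ.* (ι 2 ℚ.* M)                 ≡⟨ solve 2 (λ u m → (con ½ :* (con ½ :* (con ½ :* u))) :* (con (ι 2) :* m) :+ (con ½ :* (con ½ :* (con ½ :* u))) :* (con (ι 2) :* m) := (con ½ :* u) :* m) refl u M ⟩
    ½ ^ℚ suc k ℚ.* M                                        ≤⟨ ℚ.*-monoʳ-≤-nonNeg M {{ℚ.nonNegative 0≤M}} x≥ ⟩
    x ℚ.* M                                                 ∎
    where
    tT = ℚ.*-monoˡ-≤-nonNeg t {{ℚ.nonNegative 0≤t}} T≤2M

-- W-coefficients of a weighted hitting function

seq≤⇒≤ : ∀ {x y} → (∀ n → seq x n ℚ.≤ seq y n) → x ≤ y
seq≤⇒≤ {x} {y} h ε 0<ε = 0 , λ n _ → ℚ.≤-trans (h n) (p≤p+q (seq y n) (ℚ.<⇒≤ 0<ε))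

seq≡⇒≈ : ∀ {x y} → (∀ n → seq x n ≡ seq y n) → x ≈ y
seq≡⇒≈ {x} {y} h = seq≤⇒≤ {x} {y} (ℚ.≤-reflexive ∘ h) , seq≤⇒≤ {y} {x} (ℚ.≤-reflexive ∘ sym ∘ h)

seq-sum : ∀ {A : Set} (g : A → ℝ) xs n → seq (sum (map g xs)) n ≡ ∑ (map (λ x → seq (g x) n) xs)
seq-sum g []       n = refl
seq-sum g (x ∷ xs) n = cong (seq (g x) n ℚ.+_) (seq-sum g xs n)

seq-^ : ∀ x k n → seq (x ^ k) n ≡ seq x n ^ℚ k
seq-^ x zero    n = refl
seq-^ x (suc k) n = cong (seq x n ℚ.*_) (seq-^ x k n)

-- A constant sequence: equal rational values give propositionally equal reals, as `run-cong`
-- requires.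
hitℝ : ∀ {m} → (Subset m → ℚ) → Subset m → ℝ
hitℝ w T = fromℚ (hit w T)

wCoefficient-hit : ∀ {m} (w : Subset m → ℚ) S → Nonempty S → ∀ n → seq (wCoefficient (hitℝ w) S) n ≡ w S
wCoefficient-hit {m} w S ne n = begin
  seq (wCoefficient (hitℝ w) S) n
    ≡⟨ seq-sum (λ T → (- 1ℝ) ^ (∣ S ∩ T ∣ ℕ.+ 1) * hitℝ w T) (filter (covers? S) (subsets m)) n ⟩
  ∑ (map (λ T → seq ((- 1ℝ) ^ (∣ S ∩ T ∣ ℕ.+ 1)) n ℚ.* hit w T) (filter (covers? S) (subsets m)))
    ≡⟨ cong ∑ (List.map-cong (λ T → cong (ℚ._* hit w T) (seq-^ (- 1ℝ) (∣ S ∩ T ∣ ℕ.+ 1) n)) (filter (covers? S) (subsets m))) ⟩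
  ∑ (map (λ T → (ℚ.- 1ℚ) ^ℚ (∣ S ∩ T ∣ ℕ.+ 1) ℚ.* hit w T) (filter (covers? S) (subsets m)))
    ≡⟨ ∑-filter (covers? S) (λ T → (ℚ.- 1ℚ) ^ℚ (∣ S ∩ T ∣ ℕ.+ 1) ℚ.* hit w T) (subsets m) ⟩
  ∑ (map (signed 1 (hit w) S) (subsets m))
    ≡⟨ ∑-subsets (signed 1 (hit w) S) ⟩
  Σˢ (signed 1 (hit w) S)
    ≡⟨ Σˢ-signed 1 (hit w) S ⟩
  (ℚ.- 1ℚ) ^ℚ 1 ℚ.* mobius (hit w) S
    ≡⟨ cong ((ℚ.- 1ℚ) ^ℚ 1 ℚ.*_) (mobius-hit w S ne) ⟩
  (ℚ.- 1ℚ) ^ℚ 1 ℚ.* (ℚ.- w S)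
    ≡⟨ solve 1 (λ x → (con (ℚ.- 1ℚ) :* con 1ℚ) :* (:- x) := x) refl (w S) ⟩
  w S ∎
  where open ≡-Reasoning

-- Non-negative weights give coverage functions

meets : ∀ {m} → Subset m → Subset m → Bool
meets []            []            = false
meets (_ ∷ S)       (outside ∷ T) = meets S T
meets (outside ∷ S) (inside  ∷ T) = meets S T
meets (inside  ∷ S) (inside  ∷ T) = true

meets⁺ : ∀ {m} (S T : Subset m) {i} → i Subset.∈ S → i Subset.∈ T → meets S T ≡ true
meets⁺ (inside  ∷ S) (inside  ∷ T) here        here        = refl
meets⁺ (inside  ∷ S) (inside  ∷ T) (there i∈S) (there i∈T) = refl
meets⁺ (outside ∷ S) (inside  ∷ T) (there i∈S) (there i∈T) = meets⁺ S T i∈S i∈T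
meets⁺ (_       ∷ S) (outside ∷ T) (there i∈S) (there i∈T) = meets⁺ S T i∈S i∈T

meets⁻ : ∀ {m} (S T : Subset m) → meets S T ≡ true → ∃ λ i → i Subset.∈ S × i Subset.∈ T
meets⁻ []            []            ()
meets⁻ (_       ∷ S) (outside ∷ T) eq = let i , i∈S , i∈T = meets⁻ S T eq in suc i , there i∈S , there i∈T
meets⁻ (outside ∷ S) (inside  ∷ T) eq = let i , i∈S , i∈T = meets⁻ S T eq in suc i , there i∈S , there i∈T
meets⁻ (inside  ∷ S) (inside  ∷ T) eq = zero , here , here

Σˢ-meets : ∀ {m} (w : Subset m → ℚ) T → Σˢ (λ S → if meets S T then w S else 0ℚ) ≡ hit w T
Σˢ-meets w []            = refl
Σˢ-meets w (outside ∷ T) = cong₂ ℚ._+_ (Σˢ-meets (w ∘ (outside ∷_)) T) (Σˢ-meets (w ∘ (inside ∷_)) T)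
Σˢ-meets w (inside  ∷ T) = cong (ℚ._+ Σˢ (w ∘ (inside ∷_))) (Σˢ-meets (w ∘ (outside ∷_)) T)

∈-⋃⁺ : ∀ {n} {A : Subset n} {As x} → A ∈ As → x Subset.∈ A → x Subset.∈ ⋃ As
∈-⋃⁺ {As = A ∷ As} (here refl) x∈A = x∈p∪q⁺ {p = A} {⋃ As} (inj₁ x∈A)
∈-⋃⁺ {As = A ∷ As} (there A∈)  x∈A = x∈p∪q⁺ {p = A} {⋃ As} (inj₂ (∈-⋃⁺ A∈ x∈A))

∈-⋃⁻ : ∀ {n} (As : List (Subset n)) {x} → x Subset.∈ ⋃ As → ∃ λ A → A ∈ As × x Subset.∈ A
∈-⋃⁻ []       x∈ = contradiction x∈ ∉⊥
∈-⋃⁻ (A ∷ As) x∈ with x∈p∪q⁻ A (⋃ As) x∈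
... | inj₁ x∈A = A , here refl , x∈A
... | inj₂ x∈⋃ = let B , B∈ , x∈B = ∈-⋃⁻ As x∈⋃ in B , there B∈ , x∈B

does-≡ : ∀ {P : Set} (P? : Dec P) b → (P → b ≡ true) → (b ≡ true → P) → does P? ≡ b
does-≡ P? true  f g = dec-true P? (g refl)
does-≡ P? false f g = dec-false P? (λ p → contradiction (f p) λ ())

module _ {m} (w : Subset m → ℚ) where

  private
    Sₓ : Fin (length (subsets m)) → Subset m
    Sₓ = lookup (subsets m)

    sets-containing : Fin m → Subset (length (subsets m))
    sets-containing i = Vec.tabulate (λ u → Vec.lookup (Sₓ u) i)

    ∈-containing⁺ : ∀ {u i} → i Subset.∈ Sₓ u → u Subset.∈ sets-containing i
    ∈-containing⁺ {u} {i} i∈ = Vec.lookup⇒[]= u (sets-containing i)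
      (trans (Vec.lookup∘tabulate (λ u → Vec.lookup (Sₓ u) i) u) (Vec.[]=⇒lookup i∈))

    ∈-containing⁻ : ∀ {u i} → u Subset.∈ sets-containing i → i Subset.∈ Sₓ u
    ∈-containing⁻ {u} {i} u∈ = Vec.lookup⇒[]= i (Sₓ u)
      (trans (sym (Vec.lookup∘tabulate (λ u → Vec.lookup (Sₓ u) i) u)) (Vec.[]=⇒lookup u∈))

    covered : Subset m → Subset (length (subsets m))
    covered T = ⋃ (map sets-containing (elements T))

    ∈-covered : ∀ T u → does (u ∈? covered T) ≡ meets (Sₓ u) T
    ∈-covered T u = does-≡ (u ∈? covered T) (meets (Sₓ u) T) to from
      where
      to : u Subset.∈ covered T → meets (Sₓ u) T ≡ true
      to u∈ with ∈-⋃⁻ (map sets-containing (elements T)) u∈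
      ... | A , A∈ , u∈A with ∈-map⁻ sets-containing A∈
      ...   | i , i∈ , refl = meets⁺ (Sₓ u) T (∈-containing⁻ u∈A) (proj₂ (∈-filter⁻ (_∈? T) {xs = allFin m} i∈))
      from : meets (Sₓ u) T ≡ true → u Subset.∈ covered T
      from eq with meets⁻ (Sₓ u) T eq
      ... | i , i∈S , i∈T = ∈-⋃⁺ (∈-map⁺ sets-containing (∈-filter⁺ (_∈? T) (∈-allFin i) i∈T)) (∈-containing⁺ i∈S)

  covered-weight : ∀ T → ∑ (map (w ∘ Sₓ) (elements (covered T))) ≡ hit w T
  covered-weight T = begin
    ∑ (map (w ∘ Sₓ) (elements (covered T)))
      ≡⟨ ∑-filter (_∈? covered T) (w ∘ Sₓ) (allFin _) ⟩
    ∑ (map (λ u → if does (u ∈? covered T) then w (Sₓ u) else 0ℚ) (allFin _))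
      ≡⟨ cong ∑ (List.map-cong (λ u → cong (λ b → if b then w (Sₓ u) else 0ℚ) (∈-covered T u)) (allFin _)) ⟩
    ∑ (map (g ∘ Sₓ) (allFin _))
      ≡⟨ cong ∑ (List.map-∘ {g = g} {f = Sₓ} (allFin _)) ⟩
    ∑ (map g (map Sₓ (allFin _)))
      ≡⟨ cong (∑ ∘ map g) (trans (List.map-tabulate (λ u → u) Sₓ) (List.tabulate-lookup (subsets m))) ⟩
    ∑ (map g (subsets m))
      ≡⟨ ∑-subsets g ⟩
    Σˢ g
      ≡⟨ Σˢ-meets w T ⟩
    hit w T ∎
    where
    open ≡-Reasoning
    g : Subset m → ℚ
    g S = if meets S T then w S else 0ℚ

  -- The universe consists of the subsets of [m], as positions in `subsets m`, and A i of those
  -- containing i. The union of the A i over i in T then consists of the sets that meet T.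
  hit-isCoverage : (∀ S → 0ℚ ℚ.≤ w S) → IsCoverage (hitℝ w)
  hit-isCoverage 0≤w = record
    { ∣U∣      = length (subsets m)
    ; weight   = λ u → fromℚ (w (Sₓ u))
    ; weight≥0 = λ u → seq≤⇒≤ {0ℝ} {fromℚ (w (Sₓ u))} (λ _ → 0≤w (Sₓ u))
    ; A        = sets-containing
    ; f≈       = λ T → seq≡⇒≈ {hitℝ w T} {sum (map (λ u → fromℚ (w (Sₓ u))) (elements (covered T)))} (λ n →
        sym (trans (seq-sum (λ u → fromℚ (w (Sₓ u))) (elements (covered T)) n) (covered-weight T)))
    }

hit-nonNeg : ∀ {m} (w : Subset m → ℚ) → (∀ S → 0ℚ ℚ.≤ w S) → ∀ T → 0ℚ ℚ.≤ hit w T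
hit-nonNeg w 0≤w []            = ℚ.≤-refl
hit-nonNeg w 0≤w (outside ∷ T) = +-nonNeg (hit-nonNeg (w ∘ (outside ∷_)) (0≤w ∘ (outside ∷_)) T) (hit-nonNeg (w ∘ (inside ∷_)) (0≤w ∘ (inside ∷_)) T)
hit-nonNeg w 0≤w (inside  ∷ T) = +-nonNeg (hit-nonNeg (w ∘ (outside ∷_)) (0≤w ∘ (outside ∷_)) T) (Σˢ-nonNeg (w ∘ (inside ∷_)) (0≤w ∘ (inside ∷_)))
  where
  Σˢ-nonNeg : ∀ {m} (w : Subset m → ℚ) → (∀ S → 0ℚ ℚ.≤ w S) → 0ℚ ℚ.≤ Σˢ w
  Σˢ-nonNeg {zero}  w 0≤w = 0≤w []
  Σˢ-nonNeg {suc m} w 0≤w = +-nonNeg (Σˢ-nonNeg (w ∘ (outside ∷_)) (0≤w ∘ (outside ∷_))) (Σˢ-nonNeg (w ∘ (inside ∷_)) (0≤w ∘ (inside ∷_)))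

-- Adaptive algorithms

queries : ∀ {m} → DecisionTree m → (Subset m → ℝ) → List (Subset m)
queries (output b)  f = []
queries (query T k) f = T ∷ queries (k (f T)) f

length-queries : ∀ {m} (t : DecisionTree m) f → length (queries t f) ≡ queryCount t f
length-queries (output b)  f = refl
length-queries (query T k) f = cong suc (length-queries (k (f T)) f)

-- Equal answers select the same continuation, so agreement on the path taken by f alone fixes the
-- path taken by g.
run-cong : ∀ {m} (t : DecisionTree m) f g → (∀ {T} → T ∈ queries t f → f T ≡ g T) → run t f ≡ run t g
run-cong (output b)  f g agree = refl
run-cong (query T k) f g agree = trans (run-cong (k (f T)) f g (agree ∘ there)) (cong (λ x → run (k x) g) (agree (here refl)))

-- Probability of the empty event

¼ ⅛ : ℚ
¼ = + 1 ℚ./ 4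
⅛ = + 1 ℚ./ 8

0<⅛ : 0ℚ ℚ.< ⅛
0<⅛ = toWitness {a? = 0ℚ ℚ.<? ⅛} tt

0≤copies : ∀ {x} → 0ℚ ℚ.≤ x → (is : List ℕ) → 0ℚ ℚ.≤ ∑ (map (λ _ → x) is)
0≤copies 0≤x []       = ℚ.≤-refl
0≤copies 0≤x (_ ∷ is) = +-nonNeg 0≤x (0≤copies 0≤x is)

-- 2x ≤ x + ¼ + ⅛ gives x ≤ 3/8, whereas x ≥ 2/3 - ⅛. The slack ¼ comes from the convergence of the
-- sums, each ⅛ from one inequality between reals.
two-copies-absurd : ∀ x is → + 2 ℚ./ 3 ℚ.≤ x ℚ.+ ⅛ → ¬ (∑ (map (λ _ → x) (0 ∷ 1 ∷ is)) ℚ.≤ (x ℚ.+ ¼) ℚ.+ ⅛)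
two-copies-absurd x is lower upper = toWitnessFalse {a? = + 2 ℚ./ 3 ℚ.≤? ½} tt (begin
  + 2 ℚ./ 3                                          ≤⟨ lower ⟩
  x ℚ.+ ⅛                                            ≡⟨ solve 1 (λ x → x :+ con ⅛ := (x :+ (x :+ con 0ℚ)) :+ (con ⅛ :- x)) refl x ⟩
  (x ℚ.+ (x ℚ.+ 0ℚ)) ℚ.+ (⅛ ℚ.- x)                   ≤⟨ ℚ.+-monoˡ-≤ (⅛ ℚ.- x) (ℚ.≤-trans (ℚ.+-monoʳ-≤ x (ℚ.+-monoʳ-≤ x (0≤copies 0≤x is))) upper) ⟩
  ((x ℚ.+ ¼) ℚ.+ ⅛) ℚ.+ (⅛ ℚ.- x)                    ≡⟨ solve 1 (λ x → ((x :+ con ¼) :+ con ⅛) :+ (con ⅛ :- x) := con ½) refl x ⟩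
  ½                                                  ∎)
  where
  open ℚ.≤-Reasoning
  0≤x : 0ℚ ℚ.≤ x
  0≤x = begin
    0ℚ                             ≤⟨ toWitness {a? = 0ℚ ℚ.≤? (+ 2 ℚ./ 3) ℚ.- ⅛} tt ⟩
    (+ 2 ℚ./ 3) ℚ.- ⅛              ≤⟨ ℚ.+-monoˡ-≤ (ℚ.- ⅛) lower ⟩
    (x ℚ.+ ⅛) ℚ.- ⅛                ≡⟨ solve 1 (λ x → (x :+ con ⅛) :- con ⅛ := x) refl x ⟩
    x                              ∎

copies-limit-absurd : ∀ x → fromℚ (+ 2 ℚ./ 3) ≤ x → ¬ ((λ n → sum (map (λ _ → x) (upTo n))) ⟶ x)
copies-limit-absurd x 2/3≤x converges =
  let N , close  = converges ¼ (toWitness {a? = 0ℚ ℚ.<? ¼} tt)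
      -- 2 + N terms guarantee two copies, however small N is.
      K₁ , upper = proj₁ (close (2 ℕ.+ N) (ℕ.m≤n+m N 2)) ⅛ 0<⅛
      K₂ , lower = 2/3≤x ⅛ 0<⅛
      n          = K₁ ℕ.⊔ K₂
  in two-copies-absurd (seq x n) (applyUpTo (λ i → suc (suc i)) N) (lower n (ℕ.m≤n⊔m K₁ K₂))
       (ℚ.≤-trans (ℚ.≤-reflexive (sym (seq-sum (λ _ → x) (0 ∷ 1 ∷ applyUpTo (λ i → suc (suc i)) N) n))) (upper n (ℕ.m≤m⊔n K₁ K₂)))

module _ (space : ProbabilitySpace) where

  open ProbabilitySpace space

  -- The empty event is a disjoint union of copies of itself.
  P-empty : ∀ {B} → Measurable B → (∀ ω → B ω ≡ false) → ¬ (fromℚ (+ 2 ℚ./ 3) ≤ P B)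
  P-empty {B} measurable-B empty 2/3≤P = copies-limit-absurd (P B) 2/3≤P
    (P-⋃ {λ _ → B} {B} (λ _ → measurable-B) (λ _ _ _ ω _ → empty ω) (λ ω → mk⇔ (0 ,_) proj₂))

-- The function far from coverage and its decoys

subsets-unique : ∀ m → Unique (subsets m)
subsets-unique zero    = [] ∷ []
subsets-unique (suc m) = Unique.++⁺
  (Unique.map⁺ (λ { refl → refl }) (subsets-unique m))
  (Unique.map⁺ (λ { refl → refl }) (subsets-unique m))
  (λ (o , i) → let _ , _ , eq = ∈-map⁻ (outside ∷_) o; _ , _ , eq′ = ∈-map⁻ (inside ∷_) i in contradiction (trans (sym eq) eq′) λ ())

-1^*-2^ : ∀ n → (ℚ.- 1ℚ) ^ℚ n ℚ.* -2ℚ ^ℚ n ≡ ι 2 ^ℚ n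
-1^*-2^ zero    = refl
-1^*-2^ (suc n) = trans (solve 2 (λ x γᵃ → (con (ℚ.- 1ℚ) :* x) :* (con -2ℚ :* γᵃ) := con (ι 2) :* (x :* γᵃ)) refl ((ℚ.- 1ℚ) ^ℚ n) (-2ℚ ^ℚ n))
  (cong (ι 2 ℚ.*_) (-1^*-2^ n))

∣-1^∣ : ∀ n → ℚ.∣ (ℚ.- 1ℚ) ^ℚ n ∣ ≡ 1ℚ
∣-1^∣ zero    = refl
∣-1^∣ (suc n) = trans (ℚ.∣p*q∣≡∣p∣*∣q∣ (ℚ.- 1ℚ) ((ℚ.- 1ℚ) ^ℚ n)) (cong (1ℚ ℚ.*_) (∣-1^∣ n))

-- Here l is the loss through resets, k the reset weight, x the value of v and p = 2^a: on the
-- window v exceeds the loss by at least 1, which outweighs the -1.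
nonNeg-inside : ∀ l k x p → 1ℚ ℚ.+ l ℚ.≤ p → p ℚ.≤ x → x ℚ.≤ k ℚ.+ l → 0ℚ ℚ.≤ ℚ.- 1ℚ ℚ.+ k
nonNeg-inside l k x p 1+l≤p p≤x x≤k+l = begin
  0ℚ                                      ≡⟨ ℚ.+-inverseˡ (1ℚ ℚ.+ l) ⟨
  ℚ.- (1ℚ ℚ.+ l) ℚ.+ (1ℚ ℚ.+ l)           ≤⟨ ℚ.+-monoʳ-≤ (ℚ.- (1ℚ ℚ.+ l)) (ℚ.≤-trans 1+l≤p (ℚ.≤-trans p≤x x≤k+l)) ⟩
  ℚ.- (1ℚ ℚ.+ l) ℚ.+ (k ℚ.+ l)            ≡⟨ solve 2 (λ l k → :- (con 1ℚ :+ l) :+ (k :+ l) := con (ℚ.- 1ℚ) :+ k) refl l k ⟩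
  ℚ.- 1ℚ ℚ.+ k                            ∎
  where open ℚ.≤-Reasoning

nonNeg-outside : ∀ l k x p → 1ℚ ℚ.+ l ℚ.≤ p → x ℚ.≤ k ℚ.+ l → 0ℚ ℚ.≤ (ℚ.∣ x ∣ ℚ.+ p) ℚ.+ k
nonNeg-outside l k x p 1+l≤p x≤k+l = begin
  0ℚ                                      ≡⟨ ℚ.+-inverseˡ x ⟨
  ℚ.- x ℚ.+ x                             ≤⟨ ℚ.+-mono-≤ (ℚ.≤-trans (p≤∣p∣ (ℚ.- x)) (ℚ.≤-reflexive (ℚ.∣-p∣≡∣p∣ x))) x≤k+l ⟩
  ℚ.∣ x ∣ ℚ.+ (k ℚ.+ l)                   ≤⟨ ℚ.+-monoʳ-≤ ℚ.∣ x ∣ (ℚ.+-monoʳ-≤ k l≤p) ⟩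
  ℚ.∣ x ∣ ℚ.+ (k ℚ.+ p)                   ≡⟨ solve 3 (λ x k p → x :+ (k :+ p) := (x :+ p) :+ k) refl ℚ.∣ x ∣ k p ⟩
  (ℚ.∣ x ∣ ℚ.+ p) ℚ.+ k                   ∎
  where
  open ℚ.≤-Reasoning
  l≤p : l ℚ.≤ p
  l≤p = ℚ.≤-trans (ℚ.≤-reflexive (sym (ℚ.+-identityˡ l))) (ℚ.≤-trans (ℚ.+-monoˡ-≤ l (ℚ.<⇒≤ 0<1)) 1+l≤p)

module Hard (m a L : ℕ) (a>0 : 0 ℕ.< a) (m≤ : m ℕ.≤ (a ℕ.+ L) ℕ.+ a) where

  InWindow : Subset m → Set
  InWindow S = a ℕ.≤ ∣ S ∣ × a ℕ.≤ ∣ ∁ S ∣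

  inWindow? : Decidable InWindow
  inWindow? S = (a ℕ.≤? ∣ S ∣) ×-dec (a ℕ.≤? ∣ ∁ S ∣)

  -- At |S| = a + t in the window the signs (-1)^a, (-1)^(a+t) and (-1)^t multiply to 1, leaving
  -- 2^|S|.
  v : Subset m → ℚ
  v S = (ℚ.- 1ℚ) ^ℚ a ℚ.* profile L a ∣ S ∣

  K : ℚ
  K = amplitude L a m

  1≤K : 1ℚ ℚ.≤ K
  1≤K = 1≤* (1≤* (1≤^ℚ (ι-mono {1} {64} (s≤s z≤n)) L) (1≤^ℚ 1≤γᵃ a)) (1≤^ℚ 1≤γʳ m)
    where
    1≤* : ∀ {p q} → 1ℚ ℚ.≤ p → 1ℚ ℚ.≤ q → 1ℚ ℚ.≤ p ℚ.* q
    1≤* 1≤p 1≤q = *-mono {1ℚ} {r = 1ℚ} (ℚ.<⇒≤ 0<1) (ℚ.≤-trans (ℚ.<⇒≤ 0<1) 1≤q) 1≤p 1≤q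

  ∣avoid-v∣≤K : ∀ T → ℚ.∣ avoid v T ∣ ℚ.≤ K
  ∣avoid-v∣≤K T = begin
    ℚ.∣ avoid v T ∣
      ≡⟨ cong ℚ.∣_∣ avoid-v ⟩
    ℚ.∣ σ ℚ.* transform L a ∣ ∁ T ∣ ∣
      ≡⟨ trans (ℚ.∣p*q∣≡∣p∣*∣q∣ σ (transform L a ∣ ∁ T ∣)) (trans (cong (ℚ._* ℚ.∣ transform L a ∣ ∁ T ∣ ∣) (∣-1^∣ a)) (ℚ.*-identityˡ _)) ⟩
    ℚ.∣ transform L a ∣ ∁ T ∣ ∣
      ≤⟨ ∣transform∣≤ L a ∣ ∁ T ∣ ⟩
    (ι 64 ^ℚ L ℚ.* γᵃ ^ℚ a) ℚ.* γʳ ^ℚ ∣ ∁ T ∣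
      ≤⟨ ℚ.*-monoˡ-≤-nonNeg (ι 64 ^ℚ L ℚ.* γᵃ ^ℚ a)
           {{ℚ.nonNegative (*-nonNeg (0≤^ℚ (0≤ι 64) L) (0≤^ℚ (ℚ.≤-trans (ℚ.<⇒≤ 0<1) 1≤γᵃ) a))}}
           (^ℚ-monoʳ 1≤γʳ (∣p∣≤n (∁ T))) ⟩
    K ∎
    where
    open ℚ.≤-Reasoning
    σ = (ℚ.- 1ℚ) ^ℚ a
    avoid-v : avoid v T ≡ σ ℚ.* transform L a ∣ ∁ T ∣
    avoid-v = begin-equality
      avoid v T                                                   ≡⟨ avoid-cong (λ S → sym (ℚ.+-identityˡ (v S))) T ⟩
      avoid (λ S → 0ℚ ℚ.+ σ ℚ.* profile L a ∣ S ∣) T              ≡⟨ avoid-linear (λ _ → 0ℚ) (λ S → profile L a ∣ S ∣) σ T ⟩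
      avoid (λ _ → 0ℚ) T ℚ.+ σ ℚ.* avoid (λ S → profile L a ∣ S ∣) T
                                                                  ≡⟨ cong₂ (λ x w → x ℚ.+ σ ℚ.* w) (avoid-zero T) (avoid-symmetric (profile L a) T) ⟩
      0ℚ ℚ.+ σ ℚ.* transform L a ∣ ∁ T ∣                          ≡⟨ ℚ.+-identityˡ _ ⟩
      σ ℚ.* transform L a ∣ ∁ T ∣                                 ∎

  v-window : ∀ S → InWindow S → ι 2 ^ℚ a ℚ.≤ v S
  v-window S (a≤S , a≤∁S) = begin
    ι 2 ^ℚ a                                          ≤⟨ ^ℚ-monoʳ (ι-mono {1} {2} (s≤s z≤n)) (ℕ.m≤m+n a t) ⟩
    ι 2 ^ℚ (a ℕ.+ t)                                  ≡⟨ -1^*-2^ (a ℕ.+ t) ⟨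
    (ℚ.- 1ℚ) ^ℚ (a ℕ.+ t) ℚ.* -2ℚ ^ℚ (a ℕ.+ t)        ≡⟨ cong (ℚ._* -2ℚ ^ℚ (a ℕ.+ t)) (^ℚ-+ (ℚ.- 1ℚ) a t) ⟩
    (σ ℚ.* τ) ℚ.* -2ℚ ^ℚ (a ℕ.+ t)                    ≡⟨ solve 3 (λ σ τ x → (σ :* τ) :* x := σ :* (x :* τ)) refl σ τ (-2ℚ ^ℚ (a ℕ.+ t)) ⟩
    σ ℚ.* (-2ℚ ^ℚ (a ℕ.+ t) ℚ.* τ)                    ≡⟨ cong (λ x → σ ℚ.* (-2ℚ ^ℚ (a ℕ.+ t) ℚ.* x)) (alternator-window L a t t≤L) ⟨
    σ ℚ.* profile L a (a ℕ.+ t)                       ≡⟨ cong (λ n → σ ℚ.* profile L a n) a+t≡ ⟩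
    v S                                               ∎
    where
    open ℚ.≤-Reasoning
    t = ∣ S ∣ ℕ.∸ a
    σ = (ℚ.- 1ℚ) ^ℚ a
    τ = (ℚ.- 1ℚ) ^ℚ t
    a+t≡ : a ℕ.+ t ≡ ∣ S ∣
    a+t≡ = ℕ.m+[n∸m]≡n a≤S
    ∣S∣+a≤m : ∣ S ∣ ℕ.+ a ℕ.≤ m
    ∣S∣+a≤m = ℕ.≤-trans (ℕ.+-monoʳ-≤ ∣ S ∣ (ℕ.≤-trans a≤∁S (ℕ.≤-reflexive (∣∁p∣≡n∸∣p∣ S)))) (ℕ.≤-reflexive (ℕ.m+[n∸m]≡n (∣p∣≤n S)))
    t≤L : t ℕ.≤ L
    t≤L = ℕ.≤-trans (ℕ.∸-monoˡ-≤ a (ℕ.+-cancelʳ-≤ a ∣ S ∣ (a ℕ.+ L) (ℕ.≤-trans ∣S∣+a≤m m≤))) (ℕ.≤-reflexive (ℕ.m+n∸m≡n a L))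

  -- Outside the window the sign of v is not controlled: the term |v S| compensates for v, the term
  -- 2^a for the loss through resets.
  w : Subset m → ℚ
  w S = if does (inWindow? S) then ℚ.- 1ℚ else ℚ.∣ v S ∣ ℚ.+ ι 2 ^ℚ a

  window-nonempty : ∀ {S} → InWindow S → Nonempty S
  window-nonempty (a≤S , _) = nonempty _ (ℕ.≤-trans a>0 a≤S)
    where
    nonempty : ∀ {n} (S : Subset n) → 0 ℕ.< ∣ S ∣ → Nonempty S
    nonempty (inside  ∷ S) _   = zero , here
    nonempty (outside ∷ S) 0<S = let i , i∈S = nonempty S 0<S in suc i , there i∈S

  wCoefficient-window : ∀ S → InWindow S → wCoefficient (hitℝ w) S < 0ℝ
  wCoefficient-window S S∈W = 1ℚ , 0<1 , 0 , λ n _ → ℚ.≤-reflexive (begin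
    seq (wCoefficient (hitℝ w) S) n ℚ.+ 1ℚ     ≡⟨ cong (ℚ._+ 1ℚ) (wCoefficient-hit w S (window-nonempty S∈W) n) ⟩
    w S ℚ.+ 1ℚ                                 ≡⟨ cong (λ b → (if b then ℚ.- 1ℚ else ℚ.∣ v S ∣ ℚ.+ ι 2 ^ℚ a) ℚ.+ 1ℚ) (dec-true (inWindow? S) S∈W) ⟩
    0ℚ                                         ∎)
    where open ≡-Reasoning

  window-count : 2 ℕ.^ m ℕ.≤ length (filter inWindow? (subsets m)) ℕ.+
    (length (filter (λ S → ∣ S ∣ ℕ.<? a) (subsets m)) ℕ.+ length (filter (λ S → ∣ ∁ S ∣ ℕ.<? a) (subsets m)))
  window-count = ℕ.≤-trans (ℕ.≤-reflexive (sym (length-subsets m)))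
    (length≤filters inWindow? (λ S → ∣ S ∣ ℕ.<? a) (λ S → ∣ ∁ S ∣ ℕ.<? a) outside-window (subsets m))
    where
    outside-window : ∀ S → ¬ InWindow S → ∣ S ∣ ℕ.< a ⊎ ∣ ∁ S ∣ ℕ.< a
    outside-window S ∉W with a ℕ.≤? ∣ S ∣ | a ℕ.≤? ∣ ∁ S ∣
    ... | no a≰  | _      = inj₁ (ℕ.≰⇒> a≰)
    ... | yes _  | no a≰  = inj₂ (ℕ.≰⇒> a≰)
    ... | yes a≤ | yes a≤′ = contradiction (a≤ , a≤′) ∉W

  module Fooled (B : ℕ) (capacity : ι (2 ℕ.+ B) ℚ.* K ℚ.≤ ι 2 ^ℚ a) where

    module _ (Ts : List (Subset m)) (Ts≤B : length Ts ℕ.≤ B) where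

      w′ : Subset m → ℚ
      w′ S = w S ℚ.+ kill v (⊥ ∷ Ts) S

      agrees : ∀ {T} → T ∈ Ts → hit w T ≡ hit w′ T
      agrees {T} T∈ = sym (begin
        hit w′ T                                   ≡⟨ hit-+ w (kill v (⊥ ∷ Ts)) T ⟩
        hit w T ℚ.+ hit (kill v (⊥ ∷ Ts)) T        ≡⟨ cong (hit w T ℚ.+_) (hit-kill v Ts T∈) ⟩
        hit w T ℚ.+ 0ℚ                             ≡⟨ ℚ.+-identityʳ (hit w T) ⟩
        hit w T                                    ∎)
        where open ≡-Reasoning

      loss : ℚ
      loss = ι (length (⊥ ∷ Ts)) ℚ.* K

      -- The 2 in `capacity` pays for the reset at ⊥ and, through 1 ≤ K, for the value -1 on the
      -- window.
      1+loss≤ : 1ℚ ℚ.+ loss ℚ.≤ ι 2 ^ℚ a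
      1+loss≤ = begin
        1ℚ ℚ.+ loss                                ≤⟨ ℚ.+-monoˡ-≤ loss 1≤K ⟩
        K ℚ.+ loss                                 ≡⟨ solve 2 (λ k l → k :+ l :* k := (con 1ℚ :+ l) :* k) refl K (ι (length (⊥ ∷ Ts))) ⟩
        (1ℚ ℚ.+ ι (length (⊥ ∷ Ts))) ℚ.* K         ≡⟨ cong (ℚ._* K) (ι-suc (length (⊥ ∷ Ts))) ⟨
        ι (2 ℕ.+ length Ts) ℚ.* K                  ≤⟨ ℚ.*-monoʳ-≤-nonNeg K {{ℚ.nonNegative (ℚ.≤-trans (ℚ.<⇒≤ 0<1) 1≤K)}} (ι-mono (s≤s (s≤s Ts≤B))) ⟩
        ι (2 ℕ.+ B) ℚ.* K                          ≤⟨ capacity ⟩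
        ι 2 ^ℚ a                                   ∎
        where open ℚ.≤-Reasoning

      0≤w′ : ∀ S → 0ℚ ℚ.≤ w′ S
      0≤w′ S = by-cases (inWindow? S)
        where
        v≤ : v S ℚ.≤ kill v (⊥ ∷ Ts) S ℚ.+ loss
        v≤ = v≤kill+ v ∣avoid-v∣≤K (⊥ ∷ Ts) S
        by-cases : (d : Dec (InWindow S)) → 0ℚ ℚ.≤ (if does d then ℚ.- 1ℚ else ℚ.∣ v S ∣ ℚ.+ ι 2 ^ℚ a) ℚ.+ kill v (⊥ ∷ Ts) S
        by-cases (yes S∈W) = nonNeg-inside loss (kill v (⊥ ∷ Ts) S) (v S) (ι 2 ^ℚ a) 1+loss≤ (v-window S S∈W) v≤
        by-cases (no _)    = nonNeg-outside loss (kill v (⊥ ∷ Ts) S) (v S) (ι 2 ^ℚ a) 1+loss≤ v≤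

      decoy : SetFunction m
      decoy = record
        { value      = hitℝ w′
        ; nonNeg     = λ T → seq≤⇒≤ {0ℝ} {hitℝ w′ T} (λ _ → hit-nonNeg w′ 0≤w′ T)
        ; value-of-∅ = seq≡⇒≈ {hitℝ w′ ⊥} {0ℝ} (λ _ → hit-⊥ w′)
        }

      decoy-isCoverage : IsCoverage (value decoy)
      decoy-isCoverage = hit-isCoverage w′ 0≤w′

    hard : 1 ℕ.≤ B → SetFunction m
    hard 1≤B = record
      { value      = hitℝ w
      -- The decoy for the single query T is a non-negative function with the same value at T.
      ; nonNeg     = λ T → seq≤⇒≤ {0ℝ} {hitℝ w T} (λ _ → ℚ.≤-trans
          (hit-nonNeg (w′ (T ∷ []) 1≤B) (0≤w′ (T ∷ []) 1≤B) T)
          (ℚ.≤-reflexive (sym (agrees (T ∷ []) 1≤B (here refl)))))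
      ; value-of-∅ = seq≡⇒≈ {hitℝ w ⊥} {0ℝ} (λ _ → hit-⊥ w)
      }

    accepts-hard : ∀ (t : DecisionTree m) → queryCount t (hitℝ w) ℕ.≤ B →
                   (∀ f → IsCoverage (value f) → run t (value f) ≡ true) → run t (hitℝ w) ≡ true
    accepts-hard t count≤B complete = trans
      (run-cong t (hitℝ w) (hitℝ (w′ Ts Ts≤B)) (λ T∈ → cong fromℚ (agrees Ts Ts≤B T∈)))
      (complete (decoy Ts Ts≤B) (decoy-isCoverage Ts Ts≤B))
      where
      Ts = queries t (hitℝ w)
      Ts≤B : length Ts ℕ.≤ B
      Ts≤B = ℕ.≤-trans (ℕ.≤-reflexive (length-queries t (hitℝ w))) count≤B

-- The constants and the lower bound

rate : ℚ
rate = + 1 ℚ./ 8192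

0<rate : 0ℚ ℚ.< rate
0<rate = toWitness {a? = 0ℚ ℚ.<? rate} tt

-- 8192 = 2 * 4096. The 2 comes from exp(x) ≤ 2^(2x). The 4096 comes from m < 2048(p + 1) and p + 1
-- ≤ 2j, used with j = p for the query bound and j = p - 3 for the distance.
rate*≤ : ∀ {m j} → m ℕ.≤ j ℕ.* 4096 → rate ℚ.* ι m ℚ.≤ ½ ℚ.* ι j
rate*≤ {m} {j} m≤ = begin
  rate ℚ.* ι m                      ≤⟨ ℚ.*-monoˡ-≤-nonNeg rate (ι-mono m≤) ⟩
  rate ℚ.* ι (j ℕ.* 4096)           ≡⟨ cong (rate ℚ.*_) (ι-* j 4096) ⟩
  rate ℚ.* (ι j ℚ.* ι 4096)         ≡⟨ solve 1 (λ i → con rate :* (i :* con (ι 4096)) := con ½ :* i) refl (ι j) ⟩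
  ½ ℚ.* ι j                         ∎
  where open ℚ.≤-Reasoning

≤*4096 : ∀ {p ρ j} → ρ ℕ.≤ 2048 → suc p ℕ.≤ j ℕ.+ j → ρ ℕ.+ p ℕ.* 2048 ℕ.≤ j ℕ.* 4096
≤*4096 {p} {ρ} {j} ρ≤ p<2j = begin
  ρ ℕ.+ p ℕ.* 2048              ≤⟨ ℕ.+-monoˡ-≤ (p ℕ.* 2048) ρ≤ ⟩
  suc p ℕ.* 2048                ≤⟨ ℕ.*-monoˡ-≤ 2048 p<2j ⟩
  (j ℕ.+ j) ℕ.* 2048            ≡⟨ ℕ.*-distribʳ-+ 2048 j j ⟩
  j ℕ.* 2048 ℕ.+ j ℕ.* 2048     ≡⟨ ℕ.*-distribˡ-+ j 2048 2048 ⟨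
  j ℕ.* 4096                    ∎
  where open ℕ.≤-Reasoning

2≤2^ : ∀ {n} → 1 ℕ.≤ n → 2 ℕ.≤ 2 ℕ.^ n
2≤2^ = ℕ.^-monoʳ-≤ 2

n≤2[n∸1] : ∀ {n} → 2 ℕ.≤ n → n ℕ.≤ 2 ℕ.* (n ℕ.∸ 1)
n≤2[n∸1] {suc zero}    (s≤s ())
n≤2[n∸1] {suc (suc n)} _ = s≤s (ℕ.≤-trans (ℕ.m≤n+m (suc n) n) (ℕ.+-monoʳ-≤ n (ℕ.≤-reflexive (sym (ℕ.+-identityʳ (suc n))))))

δ : ℕ → ℝ
δ m = 1ℝ - exp (- (fromℚ rate * fromℕ m))

0≤rate*ι : ∀ m → 0ℚ ℚ.≤ rate ℚ.* ι m
0≤rate*ι m = *-nonNeg (ℚ.<⇒≤ 0<rate) (0≤ι m)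

-- With ln 2 ≤ 1, 2^x = exp(x ln 2) is at most exp(x).
2^rate*≤ : ∀ {m} p → m ℕ.≤ p ℕ.* 4096 → ∀ {q} → 2 ℕ.^ p ℕ.≤ q → 2^ (fromℚ rate * fromℕ m) ≤ fromℕ q
2^rate*≤ {m} p m≤ {q} 2^p≤q = seq≤⇒≤ {2^ (fromℚ rate * fromℕ m)} {fromℕ q} λ n → begin
  E ((rate ℚ.* ι m) ℚ.* partialSum ln2Term n) n   ≤⟨ E≤2^ p (*-nonNeg (0≤rate*ι m) (0≤ln2 n)) (exponent≤ n) n ⟩
  ι 2 ^ℚ p                                        ≡⟨ ι-^ 2 p ⟨
  ι (2 ℕ.^ p)                                     ≤⟨ ι-mono 2^p≤q ⟩
  ι q                                             ∎
  where
  open ℚ.≤-Reasoning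
  exponent≤ : ∀ n → (rate ℚ.* ι m) ℚ.* partialSum ln2Term n ℚ.≤ ½ ℚ.* ι p
  exponent≤ n = begin
    (rate ℚ.* ι m) ℚ.* partialSum ln2Term n       ≤⟨ ℚ.*-monoˡ-≤-nonNeg (rate ℚ.* ι m) {{ℚ.nonNegative (0≤rate*ι m)}} (ln2≤1 n) ⟩
    (rate ℚ.* ι m) ℚ.* 1ℚ                         ≡⟨ ℚ.*-identityʳ (rate ℚ.* ι m) ⟩
    rate ℚ.* ι m                                  ≤⟨ rate*≤ {m} {p} m≤ ⟩
    ½ ℚ.* ι p                                     ∎

module Parameters (p k ρ : ℕ) (p≡3+k : p ≡ 3 ℕ.+ k) (41≤p : 41 ℕ.≤ p) (ρ≤2047 : ρ ℕ.≤ 2047) where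

  m a L : ℕ
  m = ρ ℕ.+ p ℕ.* 2048
  a = p ℕ.* 992
  L = p ℕ.* 64 ℕ.+ ρ

  1≤p : 1 ℕ.≤ p
  1≤p = ℕ.≤-trans (s≤s z≤n) 41≤p

  1≤p* : ∀ n → 1 ℕ.≤ n → 1 ℕ.≤ p ℕ.* n
  1≤p* n 1≤n = ℕ.*-mono-≤ 1≤p 1≤n

  1≤m : 1 ℕ.≤ m
  1≤m = ℕ.≤-trans (1≤p* 2048 (s≤s z≤n)) (ℕ.m≤n+m (p ℕ.* 2048) ρ)

  m≡ : m ≡ (a ℕ.+ L) ℕ.+ a
  m≡ = split p ρ
    where
    split : ∀ p ρ → ρ ℕ.+ p ℕ.* 2048 ≡ (p ℕ.* 992 ℕ.+ (p ℕ.* 64 ℕ.+ ρ)) ℕ.+ p ℕ.* 992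
    split = ℕ-Ring.solve-∀

  open Hard m a L (1≤p* 992 (s≤s z≤n)) (ℕ.≤-reflexive m≡)

  capacity : ι (2 ℕ.+ 2 ℕ.^ p) ℚ.* K ℚ.≤ ι 2 ^ℚ a
  capacity = ℚ.≤-trans
    (ℚ.*-monoʳ-≤-nonNeg K {{ℚ.nonNegative (ℚ.≤-trans (ℚ.<⇒≤ 0<1) 1≤K)}}
      (ℚ.≤-trans (ι-mono 2+≤) (ℚ.≤-reflexive (ι-^ 2 (suc p)))))
    (room p ρ 41≤p ρ≤2047)
    where
    2+≤ : 2 ℕ.+ 2 ℕ.^ p ℕ.≤ 2 ℕ.^ suc p
    2+≤ = ℕ.+-mono-≤ (2≤2^ 1≤p) (ℕ.≤-reflexive (sym (ℕ.+-identityʳ (2 ℕ.^ p))))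

  open Fooled (2 ℕ.^ p) capacity

  f : SetFunction m
  f = hard (ℕ.≤-trans (s≤s z≤n) (2≤2^ 1≤p))

  window : List (Subset m)
  window = filter inWindow? (subsets m)

  rate*m≤½k : rate ℚ.* ι m ℚ.≤ ½ ℚ.* ι k
  rate*m≤½k = rate*≤ {m} {k} (≤*4096 {p} {ρ} {k} (ℕ.m≤n⇒m≤1+n ρ≤2047) (ℕ.≤-trans (ℕ.≤-reflexive (cong suc p≡3+k)) (ℕ.+-monoˡ-≤ k 4≤k)))
    where
    4≤k : 4 ℕ.≤ k
    4≤k = ℕ.+-cancelˡ-≤ 3 4 k (ℕ.≤-trans (ℕ.≤ᵇ⇒≤ 7 41 tt) (ℕ.≤-trans 41≤p (ℕ.≤-reflexive p≡3+k)))

  tail≤ : ∀ (size : Subset m → ℕ) → Σˢ (λ S → tilt ^ℚ size S) ≡ (1ℚ ℚ.+ tilt) ^ℚ m →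
          ι (length (filter (λ S → size S ℕ.<? a) (subsets m))) ℚ.* ι 2 ^ℚ (3 ℕ.+ k) ℚ.≤ ι 2 ^ℚ m
  tail≤ size eq = subst (λ n → O ℚ.* ι 2 ^ℚ n ℚ.≤ ι 2 ^ℚ m) p≡3+k (tail-bound p ρ O (tail-count a size eq))
    where O = ι (length (filter (λ S → size S ℕ.<? a) (subsets m)))

  f-far : WDistanceAtLeast (δ m) (value f)
  f-far = record
    { sets     = window
    ; distinct = Unique.filter⁺ inWindow? (subsets-unique m)
    ; nonempty = All.map window-nonempty (All.all-filter inWindow? (subsets m))
    ; negative = All.map (λ {S} → wCoefficient-window S) (All.all-filter inWindow? (subsets m))
    ; many     = λ ε 0<ε → let N , small = ½^≤E-neg k 0<rate*m rate*m≤½k in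
        N , λ n N≤n → ℚ.≤-trans (fraction (E (ℚ.- (rate ℚ.* ι m)) n) (small n N≤n)) (p≤p+q (ι (length window)) (ℚ.<⇒≤ 0<ε))
    }
    where
    0<rate*m : 0ℚ ℚ.< rate ℚ.* ι m
    0<rate*m = ℚ.<-≤-trans 0<rate (ℚ.≤-trans (ℚ.≤-reflexive (sym (ℚ.*-identityʳ rate))) (ℚ.*-monoˡ-≤-nonNeg rate (ι-mono 1≤m)))
    2^m : ι (2 ℕ.^ m) ≡ ι 2 ^ℚ m
    2^m = ι-^ 2 m
    low  = filter (λ S → ∣ S ∣ ℕ.<? a) (subsets m)
    high = filter (λ S → ∣ ∁ S ∣ ℕ.<? a) (subsets m)
    fraction : ∀ x → ½ ^ℚ suc k ℚ.≤ x → (1ℚ ℚ.- x) ℚ.* ι (2 ℕ.^ m ℕ.∸ 1) ℚ.≤ ι (length window)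
    fraction x ½^≤x = fraction-bound k (ι 2 ^ℚ m) (ι (2 ℕ.^ m ℕ.∸ 1)) (ι (length window)) (ι (length low)) (ι (length high)) x
      (0≤^ℚ (0≤ι 2) m)
      (ℚ.≤-trans (ι-mono (ℕ.m∸n≤m (2 ℕ.^ m) 1)) (ℚ.≤-reflexive 2^m))
      (ℚ.≤-trans (ℚ.≤-reflexive (sym 2^m)) (ℚ.≤-trans (ι-mono (n≤2[n∸1] (2≤2^ 1≤m))) (ℚ.≤-reflexive (ι-* 2 (2 ℕ.^ m ℕ.∸ 1)))))
      (ℚ.≤-trans (ℚ.≤-reflexive (sym 2^m)) (ℚ.≤-trans (ι-mono window-count) (ℚ.≤-reflexive
        (trans (ι-+ (length window) (length low ℕ.+ length high)) (cong (ι (length window) ℚ.+_) (ι-+ (length low) (length high)))))))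
      (tail≤ ∣_∣ (Σˢ-^∣∣ m tilt))
      (tail≤ (λ S → ∣ ∁ S ∣) (Σˢ-^∣∁∣ m tilt))
      ½^≤x

  -- The decoy may depend on ω, since completeness holds for every outcome. With fewer than 2^p
  -- queries each outcome accepts its own decoy and hence f, so the event of rejecting f is empty.
  many-queries : (A : RandomizedAlgorithm m) → IsTester (δ m) A → (q : ℕ) → QueriesAtMost A q → 2 ℕ.^ p ℕ.≤ q
  many-queries A tester q atMost = ℕ.≮⇒≥ λ q<2^p →
    P-empty space (measurable f) (λ ω → cong not (always-accepts (ℕ.<⇒≤ q<2^p) ω)) (soundness f f-far)
    where
    open RandomizedAlgorithm A
    open IsTester tester
    always-accepts : q ℕ.≤ 2 ℕ.^ p → ∀ ω → accepts f ω ≡ true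
    always-accepts q≤2^p ω = accepts-hard (tree ω) (ℕ.≤-trans (atMost f ω) q≤2^p) (λ g coverage → completeness g coverage ω)

-- A predicate of m, to be transported along the division of m by 2048.
LowerBound : ℕ → Set₁
LowerBound m = (A : RandomizedAlgorithm m) → IsTester (δ m) A → (q : ℕ) → QueriesAtMost A q → 2^ (fromℚ rate * fromℕ m) ≤ fromℕ q

lowerBound : ∀ p ρ → 41 ℕ.≤ p → ρ ℕ.≤ 2047 → LowerBound (ρ ℕ.+ p ℕ.* 2048)
lowerBound p ρ 41≤p ρ≤2047 A tester q atMost = 2^rate*≤ p
  (≤*4096 {p} {ρ} {p} (ℕ.m≤n⇒m≤1+n ρ≤2047) (ℕ.+-monoˡ-≤ p 1≤p))
  (many-queries A tester q atMost)
  where open Parameters p (p ℕ.∸ 3) ρ (sym (ℕ.m+[n∸m]≡n (ℕ.≤-trans (ℕ.≤ᵇ⇒≤ 3 41 tt) 41≤p))) 41≤p ρ≤2047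

corollary3p3 : ∃ λ (c : ℝ) → ∃ λ (c′ : ℝ) → ∃ λ (m₀ : ℕ) →
    0ℝ < c × 0ℝ < c′ ×
    (∀ m → m₀ ℕ.≤ m →
    (A : RandomizedAlgorithm m) → IsTester (1ℝ - exp (- (c * fromℕ m))) A →
    (q : ℕ) → QueriesAtMost A q →
    2^ (c′ * fromℕ m) ≤ fromℕ q)
-- 83968 = 41 * 2048, so that the quotient p is at least 41.
corollary3p3 = fromℚ rate , fromℚ rate , 83968 , positive , positive , λ m m₀≤m →
  subst LowerBound (sym (m≡m%n+[m/n]*n m 2048)) (lowerBound (m / 2048) (m % 2048) (/-monoˡ-≤ 2048 m₀≤m) (ℕ.s≤s⁻¹ (m%n<n m 2048)))
  where
  positive : 0ℝ < fromℚ rate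
  positive = rate , 0<rate , 0 , λ _ _ → ℚ.≤-reflexive (ℚ.+-identityˡ rate)
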